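{- Let $\mathrm{per}$ be the permanent, regarded as a graded p-family, and let $\mathrm{nc}e_3$ be the graded p-family $(n,d)\mapsto \mathrm{nc}e_{3,n,d}$ (the sum of all entries of the noncommutative elementary symmetric polynomial of degree $d$ in $n$ generic $3\times 3$ matrices). Then: (1) $\mathsf{VNP}=\mathsf{VF}$ if and only if $\mathrm{per}\leq_{\text{p-homlin}}\mathrm{nc}e_3$; (2) $\mathsf{VNP}\subseteq\overline{\mathsf{VF}}$ if and only if $\mathrm{per}\trianglelefteq_{\text{p-homlin}}\mathrm{nc}e_3$; (3) $\mathsf{VNP}\subseteq\mathsf{VQP}$ if and only if $\mathrm{per}\leq_{\text{qp-homlin}}\mathrm{nc}e_3$; (4) $\mathsf{VNP}\subseteq\overline{\mathsf{VQP}}$ if and only if $\mathrm{per}\trianglelefteq_{\text{qp-homlin}}\mathrm{nc}e_3$.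
   Context: All polynomials are over $\mathbb{C}$ in the variables $x_1,x_2,\ldots$ (renamed as convenient); $\mathbb{S}=\mathbb{C}[x_1,x_2,\ldots]$. Bounds. A sequence $(m_n)_{n\in\mathbb N}$ of natural numbers is polynomially bounded if $m_n\le t(n)$ for all $n$, for some univariate polynomial $t$; it is quasipolynomially bounded if there is a polynomial $q$ with $m_n\le n^{q(\log_2 n)}$ for all $n\ge 2$. A function $m:\mathbb N\times\mathbb N\to\mathbb N$ is bivariately polynomially bounded if $m_{n,d}\le t(n,d)$ for some bivariate polynomial $t$ and all $n,d$. p-families. A p-family (ungraded) is a sequence $(g_n)_{n\in\mathbb N}$ of polynomials whose degree and number of occurring variables are polynomially bounded in $n$. A graded p-family is a map $f:\mathbb N\times\mathbb N\to\mathbb S$ such that the number of variables of $f_{n,d}$ is bivariately polynomially bounded and each $f_{n,d}$ is zero or homogeneous of degree $d$. An ungraded p-family $g$ is regarded as a graded p-family by letting $g_{n,d}$ be the homogeneous degree $d$ component of $g_n$. In particular $\mathrm{per}_n=\sum_{\sigma\in\mathfrak S_n}\prod_{i=1}^n x_{i,\sigma(i)}$ becomes a graded p-family. Classes. An algebraic formula is a directed tree with a unique sink, sources labelled by affine linear polynomials, and internal nodes (of arity 2) labelled $+$ or $\times$; its size is its number of vertices. $\mathsf{VF}$ is the class of p-families $(f_n)$ whose minimal formula size is polynomially bounded. The permanental complexity of $f$ is the least $n$ such that $f$ is the permanent of an $n\times n$ matrix of affine linear polynomials; $\mathsf{VNP}$ is the class of p-families with polynomially bounded permanental complexity. $\mathsf{VQP}$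 is the class of p-families with quasipolynomially bounded formula size (using circuit size instead gives the same class). The border formula size of $f$ is at most $k$ if $f$ is a limit (in the Euclidean topology on coefficient vectors) of polynomials of formula size at most $k$. $\overline{\mathsf{VF}}$ (resp. $\overline{\mathsf{VQP}}$) is the class of p-families with polynomially (resp. quasipolynomially) bounded border formula size. Reductions. For finite dimensional complex vector spaces $U,W$, $d>0$ and homogeneous degree $d$ polynomials $p\in\mathbb C[U]_d$, $q\in\mathbb C[W]_d$ (zero allowed), write $p\le_{\text{homlin}}q$ if $p\in\{q\circ A\mid A:U\to W\text{ linear}\}$, and $p\trianglelefteq_{\text{homlin}}q$ if $p$ lies in the closure of this set. For $d=0$, $p\le_{\text{homlin}}q$ (and $p\trianglelefteq_{\text{homlin}}q$) holds for every nonzero $q$. For graded p-families $f,h$, write $f\le_{\text{p-homlin}}h$ if there is a polynomially bounded sequence $m$ with $f_{n,d}\le_{\text{homlin}}h_{m_n,d}$ for all $n,d$; $f\trianglelefteq_{\text{p-homlin}}h$ is defined in the same way with $\trianglelefteq_{\text{homlin}}$. The relations $\le_{\text{qp-homlin}}$, $\trianglelefteq_{\text{qp-homlin}}$ are defined in the same way with $m$ only required to be quasipolynomially bounded. The family $\mathrm{nc}e_3$. Let $\mathrm{nc}e_d(X_1,\ldots,X_n)=\sum_{1\le i_1<\cdots<i_d\le n}X_{i_1}\cdots X_{i_d}$ in noncommuting $X_1,\ldots,X_n$ (for $d=0$ the empty product is the identity). Let $L:\mathbb C^{3\times3}\to\mathbb C$ be the sum of all 9 entries. Then $\mathrm{nc}e_{3,n,d}:=L(\mathrm{nc}e_d(A_1,\ldots,A_n))$,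 where each $A_i$ is a $3\times3$ matrix of 9 fresh variables. -}

module Defs where

open import Algebra.Bundles using (CommutativeRing)
open import Algebra.Structures using (IsCommutativeRing)
open import Data.Bool.Base using (if_then_else_)
open import Data.Fin.Base as Fin using (Fin; toℕ; combine)
open import Data.Fin.Permutation using (Permutation′; _⟨$⟩ʳ_)
import Data.Fin.Permutation as Perm
import Data.Fin.Properties as Fin
open import Data.List.Base as List
  using (List; []; _∷_; _++_; length; map; concatMap; foldr; filter; allFin)
open import Data.List.Membership.Propositional using (_∈_; _∉_)
open import Data.List.Membership.Propositional.Properties using (∈-∃++)
open import Data.List.Relation.Binary.Permutation.Propositional
  using (_↭_; prep; ↭-refl; ↭-sym; ↭-trans)
open import Data.List.Relation.Binary.Permutation.Propositional.Properties
  using (shift; ∈-resp-↭; drop-∷; ¬x∷xs↭[])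
open import Data.List.Relation.Unary.Any using (here)
open import Data.Nat.Base as ℕ using (ℕ; zero; suc)
open import Data.Nat.Logarithm using (⌈log₂_⌉)
import Data.Nat.Properties as ℕ
open import Data.Product.Base using (_×_; _,_; proj₁; proj₂; ∃; ∃-syntax)
open import Data.Sum.Base using ([_,_]′)
open import Data.Rational.Base as ℚ using (ℚ; 0ℚ; 1ℚ; ½)
import Data.Rational.Properties as ℚ
open import Data.Rational.Solver using (module +-*-Solver)
open import Function.Base using (_∘_)
open import Level using (0ℓ)
open import Relation.Binary.Definitions using (Decidable)
open import Relation.Binary.PropositionalEquality
  using (_≡_; refl; sym; trans; cong; cong₂; subst)
open import Relation.Nullary.Decidable.Core using (yes; no; does)
open import Relation.Nullary.Negation.Core using (¬_)

import Data.List.Membership.DecPropositional as DecMembership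

open +-*-Solver using (solve; _:+_; _:*_; _:-_; :-_; _:=_; con)

------------------------------------------------------------------------
-- Families of rationals indexed by I that vanish along a filter with base
-- Beyond 0, Beyond 1, ….  Used for I = ℕ (equality of reals) and for
-- I = ℕ × ℕ (Cauchy sequences).

module Vanishing {I : Set} (Beyond : ℕ → I → Set)
  (antitone : ∀ {M N i} → M ℕ.≤ N → Beyond N i → Beyond M i) where

  Vanishes : (I → ℚ) → Set
  Vanishes z = ∀ ε → 0ℚ ℚ.< ε → ∃[ N ] (∀ i → Beyond N i → ℚ.∣ z i ∣ ℚ.< ε)

  EventuallyBounded : (I → ℚ) → Set
  EventuallyBounded z =
    ∃[ B ] 0ℚ ℚ.< B × ∃[ N ] (∀ i → Beyond N i → ℚ.∣ z i ∣ ℚ.< B)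

  vanishes-resp : ∀ {z w} → (∀ i → z i ≡ w i) → Vanishes z → Vanishes w
  vanishes-resp z≡w z→0 ε 0<ε with z→0 ε 0<ε
  ... | N , bound =
    N , λ i b → subst (λ q → ℚ.∣ q ∣ ℚ.< ε) (z≡w i) (bound i b)

  vanishes-0 : ∀ {z} → (∀ i → z i ≡ 0ℚ) → Vanishes z
  vanishes-0 z≡0 ε 0<ε =
    0 , λ i _ → subst (λ q → ℚ.∣ q ∣ ℚ.< ε) (sym (z≡0 i)) 0<ε

  vanishes-∣∣≤ : ∀ {z w} → (∀ i → ℚ.∣ w i ∣ ℚ.≤ ℚ.∣ z i ∣) → Vanishes z → Vanishes w
  vanishes-∣∣≤ w≤z z→0 ε 0<ε with z→0 ε 0<ε
  ... | N , bound = N , λ i b → ℚ.≤-<-trans (w≤z i) (bound i b)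

  vanishes-neg : ∀ {z} → Vanishes z → Vanishes (λ i → ℚ.- z i)
  vanishes-neg {z} = vanishes-∣∣≤ (λ i → ℚ.≤-reflexive (ℚ.∣-p∣≡∣p∣ (z i)))

  private
    0<½*_ : ∀ {ε} → 0ℚ ℚ.< ε → 0ℚ ℚ.< ½ ℚ.* ε
    0<½*_ {ε} 0<ε = subst (ℚ._< ½ ℚ.* ε) (ℚ.*-zeroʳ ½) (ℚ.*-monoʳ-<-pos ½ 0<ε)

    halves : ∀ ε → ½ ℚ.* ε ℚ.+ ½ ℚ.* ε ≡ ε
    halves = solve 1 (λ e → con ½ :* e :+ con ½ :* e := e) refl

  vanishes-+ : ∀ {z w} → Vanishes z → Vanishes w → Vanishes (λ i → z i ℚ.+ w i)
  vanishes-+ {z} {w} z→0 w→0 ε 0<ε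
    with z→0 (½ ℚ.* ε) (0<½* 0<ε) | w→0 (½ ℚ.* ε) (0<½* 0<ε)
  ... | M , z< | N , w< = M ℕ.⊔ N , λ i b →
    ℚ.≤-<-trans (ℚ.∣p+q∣≤∣p∣+∣q∣ (z i) (w i))
      (subst (ℚ.∣ z i ∣ ℚ.+ ℚ.∣ w i ∣ ℚ.<_) (halves ε)
        (ℚ.+-mono-< (z< i (antitone (ℕ.m≤m⊔n M N) b))
                    (w< i (antitone (ℕ.m≤n⊔m M N) b))))

  vanishes-* : ∀ {z w} → EventuallyBounded z → Vanishes w →
               Vanishes (λ i → z i ℚ.* w i)
  vanishes-* {z} {w} (B , 0<B , M , z<B) w→0 ε 0<ε = M ℕ.⊔ N , bound
    where
    instance
      B-pos : ℚ.Positive B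
      B-pos = ℚ.positive 0<B
      B-nonNeg : ℚ.NonNegative B
      B-nonNeg = ℚ.pos⇒nonNeg B
      B-nonZero : ℚ.NonZero B
      B-nonZero = ℚ.pos⇒nonZero B
      1/B-pos : ℚ.Positive (ℚ.1/ B)
      1/B-pos = ℚ.1/pos⇒pos B
    δ : ℚ
    δ = ℚ.1/ B ℚ.* ε
    0<δ : 0ℚ ℚ.< δ
    0<δ = subst (ℚ._< δ) (ℚ.*-zeroʳ (ℚ.1/ B)) (ℚ.*-monoʳ-<-pos (ℚ.1/ B) 0<ε)
    Bδ≡ε : B ℚ.* δ ≡ ε
    Bδ≡ε = trans (sym (ℚ.*-assoc B (ℚ.1/ B) ε))
             (trans (cong (ℚ._* ε) (ℚ.*-inverseʳ B)) (ℚ.*-identityˡ ε))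
    N : ℕ
    N = proj₁ (w→0 δ 0<δ)
    bound : ∀ i → Beyond (M ℕ.⊔ N) i → ℚ.∣ z i ℚ.* w i ∣ ℚ.< ε
    bound i b = subst (ℚ._< ε) (sym (ℚ.∣p*q∣≡∣p∣*∣q∣ (z i) (w i)))
      (ℚ.≤-<-trans
        (ℚ.*-monoʳ-≤-nonNeg ℚ.∣ w i ∣ {{ℚ.∣-∣-nonNeg (w i)}}
          (ℚ.<⇒≤ (z<B i (antitone (ℕ.m≤m⊔n M N) b))))
        (subst (B ℚ.* ℚ.∣ w i ∣ ℚ.<_) Bδ≡ε
          (ℚ.*-monoʳ-<-pos B
            (proj₂ (w→0 δ 0<δ) i (antitone (ℕ.m≤n⊔m M N) b)))))

BothBeyond : ℕ → ℕ × ℕ → Set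
BothBeyond N (m , n) = N ℕ.≤ m × N ℕ.≤ n

bothBeyond-antitone : ∀ {M N i} → M ℕ.≤ N → BothBeyond N i → BothBeyond M i
bothBeyond-antitone M≤N (N≤m , N≤n) = ℕ.≤-trans M≤N N≤m , ℕ.≤-trans M≤N N≤n

module Vanishing₁ = Vanishing {ℕ} ℕ._≤_ ℕ.≤-trans
module Vanishing₂ = Vanishing {ℕ × ℕ} BothBeyond bothBeyond-antitone

------------------------------------------------------------------------
-- The real numbers: Cauchy sequences of rationals, up to null sequences.

IsCauchy : (ℕ → ℚ) → Set
IsCauchy x = Vanishing₂.Vanishes (λ i → x (proj₁ i) ℚ.- x (proj₂ i))

record ℝ : Set where
  constructor mkℝ
  field
    seq    : ℕ → ℚ
    cauchy : IsCauchy seq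

open ℝ public

module Real where

  infix  4 _≈_ _<_
  infixl 6 _+_ _-_
  infixl 7 _*_
  infix  8 -_

  open Vanishing₁ using (Vanishes; vanishes-0; vanishes-resp; vanishes-neg;
                         vanishes-+; vanishes-*)
  private
    module V₂ = Vanishing₂

  -- A record, so that x and y can be inferred from a proof of x ≈ y.
  record _≈_ (x y : ℝ) : Set where
    constructor mk≈
    field
      difference-vanishes : Vanishes (λ n → seq x n ℚ.- seq y n)

  open _≈_ public

  _<_ : ℝ → ℝ → Set
  x < y = ∃[ δ ] 0ℚ ℚ.< δ × ∃[ N ] (∀ n → N ℕ.≤ n → seq x n ℚ.+ δ ℚ.≤ seq y n)

  private
    +-difference : ∀ a b c d → (a ℚ.- b) ℚ.+ (c ℚ.- d) ≡ (a ℚ.+ c) ℚ.- (b ℚ.+ d)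
    +-difference = solve 4 (λ a b c d →
      (a :- b) :+ (c :- d) := (a :+ c) :- (b :+ d)) refl

    neg-difference : ∀ a b → ℚ.- (a ℚ.- b) ≡ ℚ.- a ℚ.- (ℚ.- b)
    neg-difference = solve 2 (λ a b → :- (a :- b) := :- a :- (:- b)) refl

    *-difference : ∀ a b c d →
      a ℚ.* (c ℚ.- d) ℚ.+ d ℚ.* (a ℚ.- b) ≡ a ℚ.* c ℚ.- b ℚ.* d
    *-difference = solve 4 (λ a b c d →
      a :* (c :- d) :+ d :* (a :- b) := a :* c :- b :* d) refl

    swap : ∀ a b → ℚ.- (a ℚ.- b) ≡ b ℚ.- a
    swap = solve 2 (λ a b → :- (a :- b) := b :- a) refl

    cancel : ∀ a b → (a ℚ.- b) ℚ.+ b ≡ a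
    cancel = solve 2 (λ a b → (a :- b) :+ b := a) refl

  pointwise : ∀ {x y} → (∀ n → seq x n ≡ seq y n) → x ≈ y
  pointwise {x} {y} eq = mk≈ (vanishes-0 λ n →
    trans (cong (ℚ._- seq y n) (eq n)) (ℚ.+-inverseʳ (seq y n)))

  -- The Cauchy proofs are opaque: the modulus of a sum or product is never
  -- needed to compute, and unfolding it makes conversion checking very slow.
  opaque

    fromℚ-cauchy : ∀ q → IsCauchy (λ _ → q)
    fromℚ-cauchy q = V₂.vanishes-0 λ _ → ℚ.+-inverseʳ q

    +-cauchy : ∀ x y → IsCauchy (λ n → seq x n ℚ.+ seq y n)
    +-cauchy x y = V₂.vanishes-resp
      (λ i → +-difference (seq x (proj₁ i)) (seq x (proj₂ i))
                          (seq y (proj₁ i)) (seq y (proj₂ i)))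
      (V₂.vanishes-+ (cauchy x) (cauchy y))

    neg-cauchy : ∀ x → IsCauchy (λ n → ℚ.- seq x n)
    neg-cauchy x = V₂.vanishes-resp
      (λ i → neg-difference (seq x (proj₁ i)) (seq x (proj₂ i)))
      (V₂.vanishes-neg (cauchy x))

  fromℚ : ℚ → ℝ
  fromℚ q = mkℝ (λ _ → q) (fromℚ-cauchy q)

  0# 1# : ℝ
  0# = fromℚ 0ℚ
  1# = fromℚ 1ℚ

  _+_ : ℝ → ℝ → ℝ
  x + y = mkℝ (λ n → seq x n ℚ.+ seq y n) (+-cauchy x y)

  -_ : ℝ → ℝ
  - x = mkℝ (λ n → ℚ.- seq x n) (neg-cauchy x)

  _-_ : ℝ → ℝ → ℝ
  x - y = x + (- y)

  eventuallyBounded : ∀ x → Vanishing₁.EventuallyBounded (seq x)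
  eventuallyBounded x with cauchy x 1ℚ (ℚ.positive⁻¹ 1ℚ)
  ... | N , close = B , 0<B , N , λ n N≤n →
    subst (λ q → ℚ.∣ q ∣ ℚ.< B) (cancel (seq x n) (seq x N))
      (ℚ.≤-<-trans (ℚ.∣p+q∣≤∣p∣+∣q∣ (seq x n ℚ.- seq x N) (seq x N))
        (ℚ.+-monoˡ-< ℚ.∣ seq x N ∣ (close (n , N) (N≤n , ℕ.≤-refl))))
    where
    B = 1ℚ ℚ.+ ℚ.∣ seq x N ∣
    0<B : 0ℚ ℚ.< B
    0<B = ℚ.+-mono-<-≤ (ℚ.positive⁻¹ 1ℚ) (ℚ.0≤∣p∣ (seq x N))

  opaque

    *-cauchy : ∀ x y → IsCauchy (λ n → seq x n ℚ.* seq y n)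
    *-cauchy x y = V₂.vanishes-resp
      {z = λ i → first i ℚ.+ second i}
      (λ i → *-difference (seq x (proj₁ i)) (seq x (proj₂ i)) (seq y (proj₁ i)) (seq y (proj₂ i)))
      (V₂.vanishes-+ {z = first} {w = second}
        (V₂.vanishes-* {z = λ i → seq x (proj₁ i)} (bounded x proj₁ proj₁) (cauchy y))
        (V₂.vanishes-* {z = λ i → seq y (proj₂ i)} (bounded y proj₂ proj₂) (cauchy x)))
      where
      first second : ℕ × ℕ → ℚ
      first  i = seq x (proj₁ i) ℚ.* (seq y (proj₁ i) ℚ.- seq y (proj₂ i))
      second i = seq y (proj₂ i) ℚ.* (seq x (proj₁ i) ℚ.- seq x (proj₂ i))
      bounded : ∀ z (π : ℕ × ℕ → ℕ) →
                (∀ {N i} → BothBeyond N i → N ℕ.≤ π i) →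
                V₂.EventuallyBounded (λ i → seq z (π i))
      bounded z π beyond =
        let B , 0<B , N , bound = eventuallyBounded z
        in  B , 0<B , N , λ i b → bound (π i) (beyond {N} {i} b)

  _*_ : ℝ → ℝ → ℝ
  x * y = mkℝ (λ n → seq x n ℚ.* seq y n) (*-cauchy x y)

  opaque

    abs-cauchy : ∀ x → IsCauchy (λ n → ℚ.∣ seq x n ∣)
    abs-cauchy x = V₂.vanishes-∣∣≤
      (λ i → reverse-triangle (seq x (proj₁ i)) (seq x (proj₂ i))) (cauchy x)
      where
      one-sided : ∀ a b → ℚ.∣ a ∣ ℚ.- ℚ.∣ b ∣ ℚ.≤ ℚ.∣ a ℚ.- b ∣
      one-sided a b = subst (ℚ.∣ a ∣ ℚ.- ℚ.∣ b ∣ ℚ.≤_)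
        (cancelʳ ℚ.∣ a ℚ.- b ∣ ℚ.∣ b ∣)
        (ℚ.+-monoˡ-≤ (ℚ.- ℚ.∣ b ∣)
          (subst (λ q → ℚ.∣ q ∣ ℚ.≤ ℚ.∣ a ℚ.- b ∣ ℚ.+ ℚ.∣ b ∣) (cancel a b)
            (ℚ.∣p+q∣≤∣p∣+∣q∣ (a ℚ.- b) b)))
        where
        cancelʳ : ∀ p q → (p ℚ.+ q) ℚ.- q ≡ p
        cancelʳ = solve 2 (λ p q → (p :+ q) :- q := p) refl
      reverse-triangle : ∀ a b → ℚ.∣ ℚ.∣ a ∣ ℚ.- ℚ.∣ b ∣ ∣ ℚ.≤ ℚ.∣ a ℚ.- b ∣
      reverse-triangle a b = [ case₁ , case₂ ]′ (ℚ.∣p∣≡p∨∣p∣≡-p d)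
        where
        d : ℚ
        d = ℚ.∣ a ∣ ℚ.- ℚ.∣ b ∣
        case₁ : ℚ.∣ d ∣ ≡ d → ℚ.∣ d ∣ ℚ.≤ ℚ.∣ a ℚ.- b ∣
        case₁ eq = subst (ℚ._≤ ℚ.∣ a ℚ.- b ∣) (sym eq) (one-sided a b)
        case₂ : ℚ.∣ d ∣ ≡ ℚ.- d → ℚ.∣ d ∣ ℚ.≤ ℚ.∣ a ℚ.- b ∣
        case₂ eq = subst (ℚ._≤ ℚ.∣ a ℚ.- b ∣)
          (sym (trans eq (swap ℚ.∣ a ∣ ℚ.∣ b ∣)))
          (subst (ℚ.∣ b ∣ ℚ.- ℚ.∣ a ∣ ℚ.≤_)
            (trans (sym (ℚ.∣-p∣≡∣p∣ (b ℚ.- a))) (cong ℚ.∣_∣ (swap b a)))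
            (one-sided b a))

  ∣_∣ : ℝ → ℝ
  ∣ x ∣ = mkℝ (λ n → ℚ.∣ seq x n ∣) (abs-cauchy x)

  ≈-refl : ∀ {x} → x ≈ x
  ≈-refl = pointwise (λ _ → refl)

  ≈-sym : ∀ {x y} → x ≈ y → y ≈ x
  ≈-sym {x} {y} (mk≈ p) =
    mk≈ (vanishes-resp (λ n → swap (seq x n) (seq y n)) (vanishes-neg p))

  ≈-trans : ∀ {x y z} → x ≈ y → y ≈ z → x ≈ z
  ≈-trans {x} {y} {z} (mk≈ p) (mk≈ q) =
    mk≈ (vanishes-resp (λ n → telescope (seq x n) (seq y n) (seq z n)) (vanishes-+ p q))
    where
    telescope : ∀ a b c → (a ℚ.- b) ℚ.+ (b ℚ.- c) ≡ a ℚ.- c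
    telescope = solve 3 (λ a b c → (a :- b) :+ (b :- c) := a :- c) refl

  +-cong : ∀ {x y u v} → x ≈ y → u ≈ v → x + u ≈ y + v
  +-cong {x} {y} {u} {v} (mk≈ p) (mk≈ q) =
    mk≈ (vanishes-resp (λ n → +-difference (seq x n) (seq y n) (seq u n) (seq v n))
      (vanishes-+ p q))

  -‿cong : ∀ {x y} → x ≈ y → - x ≈ - y
  -‿cong {x} {y} (mk≈ p) =
    mk≈ (vanishes-resp (λ n → neg-difference (seq x n) (seq y n)) (vanishes-neg p))

  *-cong : ∀ {x y u v} → x ≈ y → u ≈ v → x * u ≈ y * v
  *-cong {x} {y} {u} {v} (mk≈ p) (mk≈ q) =
    mk≈ (vanishes-resp (λ n → *-difference (seq x n) (seq y n) (seq u n) (seq v n))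
      (vanishes-+ (vanishes-* (eventuallyBounded x) q)
                  (vanishes-* (eventuallyBounded v) p)))

------------------------------------------------------------------------
-- The complex numbers

record ℂ : Set where
  constructor _+i_
  field
    re im : ℝ

open ℂ public

module Complex where

  infix  4 _≈_
  infixl 6 _+_
  infixl 7 _*_
  infix  8 -_

  record _≈_ (z w : ℂ) : Set where
    constructor mk≈
    field
      re-≈ : re z Real.≈ re w
      im-≈ : im z Real.≈ im w

  open _≈_ public

  0# 1# : ℂ
  0# = Real.0# +i Real.0#
  1# = Real.1# +i Real.0#

  _+_ _*_ : ℂ → ℂ → ℂ
  (a +i b) + (c +i d) = (a Real.+ c) +i (b Real.+ d)
  (a +i b) * (c +i d) =
    (a Real.* c Real.- b Real.* d) +i (a Real.* d Real.+ b Real.* c)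

  -_ : ℂ → ℂ
  - (a +i b) = (Real.- a) +i (Real.- b)

  private
    pointwise : ∀ {z w} → (∀ n → seq (re z) n ≡ seq (re w) n) →
                (∀ n → seq (im z) n ≡ seq (im w) n) → z ≈ w
    pointwise p q = mk≈ (Real.pointwise p) (Real.pointwise q)

    -- Each ring law holds termwise, by an identity between rationals.
    assoc-re : ∀ a b c d e f →
      (a ℚ.* c ℚ.- b ℚ.* d) ℚ.* e ℚ.- (a ℚ.* d ℚ.+ b ℚ.* c) ℚ.* f
      ≡ a ℚ.* (c ℚ.* e ℚ.- d ℚ.* f) ℚ.- b ℚ.* (c ℚ.* f ℚ.+ d ℚ.* e)
    assoc-re = solve 6 (λ a b c d e f →
      (a :* c :- b :* d) :* e :- (a :* d :+ b :* c) :* f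
      := a :* (c :* e :- d :* f) :- b :* (c :* f :+ d :* e)) refl

    assoc-im : ∀ a b c d e f →
      (a ℚ.* c ℚ.- b ℚ.* d) ℚ.* f ℚ.+ (a ℚ.* d ℚ.+ b ℚ.* c) ℚ.* e
      ≡ a ℚ.* (c ℚ.* f ℚ.+ d ℚ.* e) ℚ.+ b ℚ.* (c ℚ.* e ℚ.- d ℚ.* f)
    assoc-im = solve 6 (λ a b c d e f →
      (a :* c :- b :* d) :* f :+ (a :* d :+ b :* c) :* e
      := a :* (c :* f :+ d :* e) :+ b :* (c :* e :- d :* f)) refl

    comm-re : ∀ a b c d → a ℚ.* c ℚ.- b ℚ.* d ≡ c ℚ.* a ℚ.- d ℚ.* b
    comm-re a b c d = cong₂ ℚ._-_ (ℚ.*-comm a c) (ℚ.*-comm b d)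

    comm-im : ∀ a b c d → a ℚ.* d ℚ.+ b ℚ.* c ≡ c ℚ.* b ℚ.+ d ℚ.* a
    comm-im = solve 4 (λ a b c d → a :* d :+ b :* c := c :* b :+ d :* a) refl

    identity-re : ∀ a b → 1ℚ ℚ.* a ℚ.- 0ℚ ℚ.* b ≡ a
    identity-re = solve 2 (λ a b → con 1ℚ :* a :- con 0ℚ :* b := a) refl

    identity-im : ∀ a b → 1ℚ ℚ.* b ℚ.+ 0ℚ ℚ.* a ≡ b
    identity-im = solve 2 (λ a b → con 1ℚ :* b :+ con 0ℚ :* a := b) refl

    distrib-re : ∀ a b c d e f →
      (a ℚ.+ c) ℚ.* e ℚ.- (b ℚ.+ d) ℚ.* f
      ≡ (a ℚ.* e ℚ.- b ℚ.* f) ℚ.+ (c ℚ.* e ℚ.- d ℚ.* f)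
    distrib-re = solve 6 (λ a b c d e f →
      (a :+ c) :* e :- (b :+ d) :* f := (a :* e :- b :* f) :+ (c :* e :- d :* f)) refl

    distrib-im : ∀ a b c d e f →
      (a ℚ.+ c) ℚ.* f ℚ.+ (b ℚ.+ d) ℚ.* e
      ≡ (a ℚ.* f ℚ.+ b ℚ.* e) ℚ.+ (c ℚ.* f ℚ.+ d ℚ.* e)
    distrib-im = solve 6 (λ a b c d e f →
      (a :+ c) :* f :+ (b :+ d) :* e := (a :* f :+ b :* e) :+ (c :* f :+ d :* e)) refl

    *-assoc : ∀ x y z → (x * y) * z ≈ x * (y * z)
    *-assoc (a +i b) (c +i d) (e +i f) = pointwise
      (λ n → assoc-re (seq a n) (seq b n) (seq c n) (seq d n) (seq e n) (seq f n))
      (λ n → assoc-im (seq a n) (seq b n) (seq c n) (seq d n) (seq e n) (seq f n))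

    *-comm : ∀ x y → x * y ≈ y * x
    *-comm (a +i b) (c +i d) = pointwise
      (λ n → comm-re (seq a n) (seq b n) (seq c n) (seq d n))
      (λ n → comm-im (seq a n) (seq b n) (seq c n) (seq d n))

    *-identityˡ : ∀ x → 1# * x ≈ x
    *-identityˡ (a +i b) = pointwise
      (λ n → identity-re (seq a n) (seq b n))
      (λ n → identity-im (seq a n) (seq b n))

    *-distribʳ : ∀ z x y → (x + y) * z ≈ x * z + y * z
    *-distribʳ (e +i f) (a +i b) (c +i d) = pointwise
      (λ n → distrib-re (seq a n) (seq b n) (seq c n) (seq d n) (seq e n) (seq f n))
      (λ n → distrib-im (seq a n) (seq b n) (seq c n) (seq d n) (seq e n) (seq f n))

    ≈-trans : ∀ {x y z} → x ≈ y → y ≈ z → x ≈ z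
    ≈-trans (mk≈ p q) (mk≈ r s) = mk≈ (Real.≈-trans p r) (Real.≈-trans q s)

    +-cong : ∀ {x y u v} → x ≈ y → u ≈ v → x + u ≈ y + v
    +-cong (mk≈ p q) (mk≈ r s) = mk≈ (Real.+-cong p r) (Real.+-cong q s)

    *-cong : ∀ {x y u v} → x ≈ y → u ≈ v → x * u ≈ y * v
    *-cong {x} {y} {u} {v} (mk≈ p q) (mk≈ r s) = mk≈
      (Real.+-cong {re x Real.* re u} {re y Real.* re v}
                   {Real.- (im x Real.* im u)} {Real.- (im y Real.* im v)}
        (Real.*-cong p r) (Real.-‿cong (Real.*-cong q s)))
      (Real.+-cong {re x Real.* im u} {re y Real.* im v}
                   {im x Real.* re u} {im y Real.* re v}
        (Real.*-cong p s) (Real.*-cong q r))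

    +-comm : ∀ x y → x + y ≈ y + x
    +-comm (a +i b) (c +i d) = pointwise
      (λ n → ℚ.+-comm (seq a n) (seq c n)) (λ n → ℚ.+-comm (seq b n) (seq d n))

    +-identityˡ : ∀ x → 0# + x ≈ x
    +-identityˡ (a +i b) = pointwise
      (λ n → ℚ.+-identityˡ (seq a n)) (λ n → ℚ.+-identityˡ (seq b n))

    -‿inverseˡ : ∀ x → - x + x ≈ 0#
    -‿inverseˡ (a +i b) = pointwise
      (λ n → ℚ.+-inverseˡ (seq a n)) (λ n → ℚ.+-inverseˡ (seq b n))

    *-distribˡ : ∀ x y z → x * (y + z) ≈ x * y + x * z
    *-distribˡ x y z = ≈-trans (*-comm x (y + z))
      (≈-trans (*-distribʳ x y z) (+-cong (*-comm y x) (*-comm z x)))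

    isCommutativeRing : IsCommutativeRing _≈_ _+_ _*_ -_ 0# 1#
    isCommutativeRing = record
      { isRing = record
        { +-isAbelianGroup = record
          { isGroup = record
            { isMonoid = record
              { isSemigroup = record
                { isMagma = record
                  { isEquivalence = record
                    { refl  = mk≈ Real.≈-refl Real.≈-refl
                    ; sym   = λ { (mk≈ p q) → mk≈ (Real.≈-sym p) (Real.≈-sym q) }
                    ; trans = ≈-trans
                    }
                  ; ∙-cong = +-cong
                  }
                ; assoc = λ { (a +i b) (c +i d) (e +i f) → pointwise
                    (λ n → ℚ.+-assoc (seq a n) (seq c n) (seq e n))
                    (λ n → ℚ.+-assoc (seq b n) (seq d n) (seq f n)) }
                }
              ; identity = +-identityˡ ,
                  λ x → ≈-trans (+-comm x 0#) (+-identityˡ x)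
              }
            ; inverse = -‿inverseˡ ,
                λ x → ≈-trans (+-comm x (- x)) (-‿inverseˡ x)
            ; ⁻¹-cong = λ { (mk≈ p q) → mk≈ (Real.-‿cong p) (Real.-‿cong q) }
            }
          ; comm = +-comm
          }
        ; *-cong = *-cong
        ; *-assoc = *-assoc
        ; *-identity = *-identityˡ ,
            λ x → ≈-trans (*-comm x 1#) (*-identityˡ x)
        ; distrib = *-distribˡ , *-distribʳ
        }
      ; *-comm = *-comm
      }

  commutativeRing : CommutativeRing 0ℓ 0ℓ
  commutativeRing = record { isCommutativeRing = isCommutativeRing }

------------------------------------------------------------------------
-- Polynomials over a commutative ring in the variables x₀, x₁, x₂, …

-- x_{i₁} ⋯ x_{iᵣ} is the word i₁ … iᵣ, up to permutation.
Monomial : Set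
Monomial = List ℕ

module Membershipℕ = DecMembership ℕ._≟_

_↭?_ : Decidable {A = Monomial} _↭_
[]      ↭? []      = yes ↭-refl
[]      ↭? (y ∷ ν) = no (λ p → ¬x∷xs↭[] (↭-sym p))
(x ∷ μ) ↭? ν with x Membershipℕ.∈? ν
... | no x∉ν = no (λ p → x∉ν (∈-resp-↭ p (here refl)))
... | yes x∈ν with ∈-∃++ x∈ν
...   | as , bs , refl with μ ↭? (as ++ bs)
...     | yes p = yes (↭-trans (prep x p) (↭-sym (shift x as bs)))
...     | no ¬p = no (λ p → ¬p (drop-∷ (↭-trans p (shift x as bs))))

-- Each permutation of Fin (suc n) is insert zero j π for exactly one j (the
-- image of zero) and, up to pointwise equality, one permutation π of Fin n.
permutations : ∀ n → List (Permutation′ n)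
permutations zero    = Perm.id ∷ []
permutations (suc n) =
  concatMap (λ j → map (Perm.insert Fin.zero j) (permutations n)) (allFin (suc n))

-- The sublists of length d, with multiplicity; on allFin n these are the
-- strictly increasing sequences i₁ < ⋯ < i_d.
sublists : ∀ {A : Set} → ℕ → List A → List (List A)
sublists zero    _        = [] ∷ []
sublists (suc d) []       = []
sublists (suc d) (x ∷ xs) = map (x ∷_) (sublists d xs) ++ sublists (suc d) xs

module Polynomials (K : CommutativeRing 0ℓ 0ℓ) where

  open CommutativeRing K using (_≈_; _+_; _*_; 0#; 1#) renaming (Carrier to Scalar)

  infix  4 _≋_
  infixl 6 _⊕_
  infixl 7 _⊗_

  -- A finite list of terms; repeated monomials and zero coefficients are
  -- allowed, so polynomials are compared by _≋_.
  Poly : Set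
  Poly = List (Scalar × Monomial)

  coeff : Poly → Monomial → Scalar
  coeff []            μ = 0#
  coeff ((c , ν) ∷ p) μ = if does (ν ↭? μ) then c + coeff p μ else coeff p μ

  record _≋_ (p q : Poly) : Set where
    constructor mk≋
    field
      coeff-≈ : ∀ μ → coeff p μ ≈ coeff q μ

  open _≋_ public

  const : Scalar → Poly
  const c = (c , []) ∷ []

  var : ℕ → Poly
  var i = (1# , i ∷ []) ∷ []

  0ₚ 1ₚ : Poly
  0ₚ = []
  1ₚ = const 1#

  _⊕_ _⊗_ : Poly → Poly → Poly
  _⊕_ = _++_
  _⊗_ = List.cartesianProductWith (λ { (c , μ) (d , ν) → c * d , μ ++ ν })

  ∑ ∏ : List Poly → Poly
  ∑ = foldr _⊕_ 0ₚ
  ∏ = foldr _⊗_ 1ₚ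

  substitute : (ℕ → Poly) → Poly → Poly
  substitute s p = ∑ (map (λ { (c , μ) → const c ⊗ ∏ (map s μ) }) p)

  homogeneousPart : ℕ → Poly → Poly
  homogeneousPart d = filter (λ t → length (proj₂ t) ℕ.≟ d)

  Degree≤ : Poly → ℕ → Set
  Degree≤ p d = ∀ μ → d ℕ.< length μ → coeff p μ ≈ 0#

  -- At most k variables occur in p.
  Variables≤ : Poly → ℕ → Set
  Variables≤ p k = ∃[ vs ] length vs ℕ.≤ k ×
    (∀ μ i → i ∈ μ → i ∉ vs → coeff p μ ≈ 0#)

  Affine : Poly → Set
  Affine p = Degree≤ p 1

  ----------------------------------------------------------------------
  -- Permanents and formulas

  Matrix : ℕ → Set
  Matrix n = Fin n → Fin n → Poly

  permanent : ∀ {n} → Matrix n → Poly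
  permanent {n} M =
    ∑ (map (λ σ → ∏ (map (λ i → M i (σ ⟨$⟩ʳ i)) (allFin n))) (permutations n))

  -- x_{i,j} is the variable with index i n + j.
  per : ℕ → Poly
  per n = permanent {n} (λ i j → var (toℕ (combine i j)))

  PermanentalComplexity≤ : Poly → ℕ → Set
  PermanentalComplexity≤ p k = ∃[ n ] n ℕ.≤ k ×
    (∃ λ (M : Matrix n) → (∀ i j → Affine (M i j)) × p ≋ permanent M)

  data Formula : Set where
    leaf    : (p : Poly) → Affine p → Formula
    add mul : Formula → Formula → Formula

  size : Formula → ℕ
  size (leaf _ _) = 1
  size (add F G)  = suc (size F ℕ.+ size G)
  size (mul F G)  = suc (size F ℕ.+ size G)

  value : Formula → Poly
  value (leaf p _) = p
  value (add F G)  = value F ⊕ value G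
  value (mul F G)  = value F ⊗ value G

  FormulaSize≤ : Poly → ℕ → Set
  FormulaSize≤ p k = ∃[ F ] size F ℕ.≤ k × value F ≋ p

  ----------------------------------------------------------------------
  -- Noncommutative elementary symmetric polynomials of matrices

  _⊕ₘ_ _⊗ₘ_ : ∀ {r} → Matrix r → Matrix r → Matrix r
  (A ⊕ₘ B) i j = A i j ⊕ B i j
  _⊗ₘ_ {r} A B i j = ∑ (map (λ k → A i k ⊗ B k j) (allFin r))

  0ₘ 1ₘ : ∀ {r} → Matrix r
  0ₘ i j = 0ₚ
  1ₘ i j = if does (i Fin.≟ j) then 1ₚ else 0ₚ

  ∑ₘ ∏ₘ : ∀ {r} → List (Matrix r) → Matrix r
  ∑ₘ = foldr _⊕ₘ_ 0ₘ
  ∏ₘ = foldr _⊗ₘ_ 1ₘ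

  nce : ∀ {r n} → ℕ → (Fin n → Matrix r) → Matrix r
  nce {n = n} d X = ∑ₘ (map (λ is → ∏ₘ (map X is)) (sublists d (allFin n)))

  sumOfEntries : ∀ {r} → Matrix r → Poly
  sumOfEntries {r} A = ∑ (concatMap (λ i → map (A i) (allFin r)) (allFin r))

  -- The (a , b) entry of the i-th matrix is the variable with index 9i + 3a + b.
  nce₃ : ℕ → ℕ → Poly
  nce₃ n d = sumOfEntries
    (nce {3} {n} d (λ i a b → var (toℕ (combine i (combine a b)))))

  ----------------------------------------------------------------------
  -- Linear substitutions

  -- p ∈[ k ] says that p is a polynomial function on K^k, i.e. that only
  -- x₀, …, x_{k-1} occur in it.
  _∈[_] : Poly → ℕ → Set
  p ∈[ k ] = ∀ μ i → i ∈ μ → k ℕ.≤ i → coeff p μ ≈ 0#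

  -- Matrices of linear maps K^k → K^l.
  LinearMap : ℕ → ℕ → Set
  LinearMap k l = Fin l → Fin k → Scalar

  linearForm : ∀ {k} → (Fin k → Scalar) → Poly
  linearForm {k} a = ∑ (map (λ i → const (a i) ⊗ var (toℕ i)) (allFin k))

  coordinate : ∀ {k l} → LinearMap k l → ℕ → Poly
  coordinate {l = l} A j with j ℕ.<? l
  ... | yes j<l = linearForm (A (Fin.fromℕ< j<l))
  ... | no  _   = 0ₚ

  -- q ∘ A, for q ∈[ l ].
  _∘ₗ_ : ∀ {k l} → Poly → LinearMap k l → Poly
  q ∘ₗ A = substitute (coordinate A) q

  -- In _≤homlin[ d ]_ and its closure version below, both sides are meant to be
  -- zero or homogeneous of degree d.  The choice of the coordinate spaces
  -- K^k and K^l is immaterial as long as they carry p and q.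
  _≤homlin[_]_ : Poly → ℕ → Poly → Set
  p ≤homlin[ zero  ] q = ¬ (q ≋ 0ₚ)
  p ≤homlin[ suc _ ] q = ∃[ k ] ∃[ l ] p ∈[ k ] × q ∈[ l ] ×
    (∃ λ (A : LinearMap k l) → p ≋ (q ∘ₗ A))

open Polynomials Complex.commutativeRing public

------------------------------------------------------------------------
-- Limits.  A limit of polynomials is taken coefficientwise, which in every
-- finite dimensional space of polynomials is the Euclidean topology.

_⟶ᵣ_ : (ℕ → ℝ) → ℝ → Set
x ⟶ᵣ y = ∀ ε → 0ℚ ℚ.< ε →
  ∃[ N ] (∀ s → N ℕ.≤ s → Real.∣ x s Real.- y ∣ Real.< Real.fromℚ ε)

_⟶ᶜ_ : (ℕ → ℂ) → ℂ → Set
z ⟶ᶜ w = ((re ∘ z) ⟶ᵣ re w) × ((im ∘ z) ⟶ᵣ im w)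

_⟶_ : (ℕ → Poly) → Poly → Set
g ⟶ p = ∀ μ → (λ s → coeff (g s) μ) ⟶ᶜ coeff p μ

-- The approximants may use variables that do not occur in p, but setting these
-- to zero increases no formula size; the remaining approximants lie in a finite
-- dimensional space, since a formula of size k has degree at most k.
BorderFormulaSize≤ : Poly → ℕ → Set
BorderFormulaSize≤ p k = ∃[ g ] (∀ s → FormulaSize≤ (g s) k) × g ⟶ p

_⊴homlin[_]_ : Poly → ℕ → Poly → Set
p ⊴homlin[ zero  ] q = ¬ (q ≋ 0ₚ)
p ⊴homlin[ suc _ ] q = ∃[ k ] ∃[ l ] p ∈[ k ] × q ∈[ l ] ×
  (∃ λ (A : ℕ → LinearMap k l) → (λ s → q ∘ₗ A s) ⟶ p)

------------------------------------------------------------------------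
-- Growth

-- Value at n of the univariate polynomial with the given coefficients,
-- constant term first.  Natural coefficients suffice for upper bounds.
eval : List ℕ → ℕ → ℕ
eval t n = foldr (λ a v → a ℕ.+ n ℕ.* v) 0 t

PolynomiallyBounded : (ℕ → ℕ) → Set
PolynomiallyBounded m = ∃[ t ] (∀ n → m n ℕ.≤ eval t n)

-- The integer ⌈log₂ n⌉ lies between log₂ n and 1 + log₂ n, so it gives the same
-- notion as the real logarithm, q being arbitrary.
QuasipolynomiallyBounded : (ℕ → ℕ) → Set
QuasipolynomiallyBounded m =
  ∃[ q ] (∀ n → 2 ℕ.≤ n → m n ℕ.≤ n ℕ.^ eval q ⌈log₂ n ⌉)

------------------------------------------------------------------------
-- Families and classes

Family : Set
Family = ℕ → Poly

IsPFamily : Family → Set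
IsPFamily f =
  (∃[ m ] PolynomiallyBounded m × (∀ n → Degree≤ (f n) (m n))) ×
  (∃[ m ] PolynomiallyBounded m × (∀ n → Variables≤ (f n) (m n)))

-- The p-families whose complexity, given by the relation "complexity of p is at
-- most k", is bounded as prescribed.
Class : (Bounded : (ℕ → ℕ) → Set) (Complexity≤ : Poly → ℕ → Set) → Family → Set
Class Bounded Complexity≤ f =
  IsPFamily f × (∃[ m ] Bounded m × (∀ n → Complexity≤ (f n) (m n)))

VF VNP VQP border-VF border-VQP : Family → Set
VF         = Class PolynomiallyBounded      FormulaSize≤
VNP        = Class PolynomiallyBounded      PermanentalComplexity≤
VQP        = Class QuasipolynomiallyBounded FormulaSize≤
border-VF  = Class PolynomiallyBounded      BorderFormulaSize≤
border-VQP = Class QuasipolynomiallyBounded BorderFormulaSize≤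

GradedFamily : Set
GradedFamily = ℕ → ℕ → Poly

graded : Family → GradedFamily
graded g n d = homogeneousPart d (g n)

Reduction : (Bounded : (ℕ → ℕ) → Set) (Reduces : Poly → ℕ → Poly → Set) →
            GradedFamily → GradedFamily → Set
Reduction Bounded Reduces f h =
  ∃[ m ] Bounded m × (∀ n d → Reduces (f n d) d (h (m n) d))

infix 4 _≤p-homlin_ _⊴p-homlin_ _≤qp-homlin_ _⊴qp-homlin_

_≤p-homlin_ _⊴p-homlin_ _≤qp-homlin_ _⊴qp-homlin_ : GradedFamily → GradedFamily → Set
_≤p-homlin_  = Reduction PolynomiallyBounded      _≤homlin[_]_
_⊴p-homlin_  = Reduction PolynomiallyBounded      _⊴homlin[_]_
_≤qp-homlin_ = Reduction QuasipolynomiallyBounded _≤homlin[_]_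
_⊴qp-homlin_ = Reduction QuasipolynomiallyBounded _⊴homlin[_]_

{-# OPTIONS --safe #-}
-- A polynomial of formula size s is, up to its constant term, a projection of
-- nce₃: depth reduction (Brent) balances the formula, a program on three
-- registers (Ben-Or and Cleve) writes it as an entry of a product ∏ (1 + Aᵢ) of
-- poly(s) many elementary 3 × 3 matrices, and the degree d part of that product
-- is nce_d(A₁, …, Aₙ).  Constants never enter the Aᵢ because a product of two
-- formulas f = f₀ + f′ and g = g₀ + g′ is treated as f′ g′ + f₀ g′ + g₀ f′ up to
-- f₀ g₀.  Conversely nce_d(A₁, …, Aₙ) is the coefficient of t^d in ∏ (1 + t Aᵢ);
-- that product has polynomial formula size by divide and conquer, and the
-- coefficient is obtained by interpolation at powers of two.  As the permanent is
-- VNP-complete, this gives all four equivalences; for border complexity, both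
-- directions are applied to each approximant and one uses that substitution is
-- continuous.  VF ⊆ VNP holds because a formula is a skew program, whose value is
-- the permanent of a Hessenberg matrix.

module Submission where

open import Algebra.Bundles using (CommutativeRing)
import Algebra.Properties.Semiring.Mult as SemiringMult
open import Algebra.Structures using (IsCommutativeRing)
open import Data.Bool.Base using (if_then_else_; true; false)
open import Data.Empty using (⊥-elim)
open import Data.Fin.Base as Fin using (Fin; toℕ; fromℕ<; combine; remQuot; punchIn; punchOut)
open import Data.Fin.Patterns using (0F; 1F; 2F)
open import Data.Fin.Permutation using (Permutation′; _⟨$⟩ʳ_; insert)
import Data.Fin.Properties as Fin
open import Data.List.Base using (List; []; _∷_; _++_; length; map; foldr; filter; concatMap; cartesianProductWith; take; drop; allFin; upTo)
open import Data.List.Membership.Propositional using (_∈_)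
open import Data.List.Membership.Propositional.Properties using (∈-upTo⁺; ∈-cartesianProductWith⁺)
open import Data.List.Properties using (++-assoc; ++-identityʳ; map-cong; map-∘; map-++; map-tabulate; map-concatMap; foldr-++; filter-accept; filter-reject; filter-all; take++drop≡id; length-++; length-map; length-filter; length-take; length-drop; length-tabulate; length-upTo)
open import Data.List.Relation.Binary.Permutation.Propositional as ↭ using (_↭_; prep; ↭-refl; ↭-sym; ↭-trans)
open import Data.List.Relation.Binary.Permutation.Propositional.Properties using (++-comm; ++⁺; ↭-length; All-resp-↭)
open import Data.List.Relation.Unary.All as All using (All; []; _∷_)
import Data.List.Relation.Unary.All.Properties as All
open import Data.List.Relation.Unary.Any using (here)
open import Data.Nat.Base as ℕ using (ℕ; zero; suc; _≤ᵇ_; _<ᵇ_; _≡ᵇ_)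
open import Data.Nat.Induction using (<-rec)
open import Data.Nat.Logarithm using (⌈log₂_⌉; ⌈log₂⌉-mono-≤; ⌈log₂2^n⌉≡n; ⌈log₂⌈n/2⌉⌉≡⌈log₂n⌉∸1)
import Data.Nat.Properties as ℕ
open import Data.Nat.Solver using () renaming (module +-*-Solver to ℕ-Solver)
open import Data.Product.Base using (_×_; _,_; proj₁; proj₂; ∃; ∃-syntax)
open import Data.Rational.Base as ℚ using (ℚ; 0ℚ; 1ℚ; ½)
import Data.Rational.Properties as ℚ
open import Data.Rational.Solver using () renaming (module +-*-Solver to ℚ-Solver)
open import Data.Sum.Base using (inj₁; inj₂)
open import Function.Base using (_∘_; id)
open import Function.Bundles using (_⇔_; mk⇔; Equivalence)
open import Level using (0ℓ)
open import Relation.Binary.Definitions using (tri<; tri≈; tri>)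
open import Relation.Binary.PropositionalEquality as ≡ using (_≡_; _≢_)
open import Relation.Nullary.Decidable.Core using (Dec; yes; no; does; ¬?; _×-dec_)
open import Relation.Nullary.Decidable using (does-⇔)
open import Relation.Nullary.Negation.Core using (¬_; contradiction)
open import Relation.Unary using (_⊆_; _≐_)
open import Defs using (module Polynomials; Monomial; _↭?_; permutations; sublists; eval; PolynomiallyBounded; QuasipolynomiallyBounded)

-- The reductions allow only homogeneous linear substitutions, and the number of matrices may depend
-- on n but not on d. Both constraints are met at once: if the Aᵢ have linear forms as entries, the
-- homogeneous components of ∏ (1 + Aᵢ) are the nce_d(A₁, ..., Aₙ), so one list of matrices serves
-- all degrees. The entries of the product add up to 3 + f, where f agrees with the given polynomial
-- only up to a constant; the comparison is therefore made in positive degree. In degree 0 a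
-- reduction merely asserts that `nce₃ m 0`, the constant 3, is nonzero. For limits it matters that
-- the number of matrices depends on the size of the formula alone, so that all approximants are
-- linear substitutions into the same `nce₃ m d`, and that these substitutions keep the degree and a
-- fixed set of variables, so that coefficientwise convergence passes to linear functionals. The
-- functionals `pair φ` have two uses: they make the ring operations well defined on unreduced lists
-- of terms, and they express a coefficient after a substitution linearly in the polynomial before
-- it.

-- Finite sums and products in a commutative ring

module Sums (R : CommutativeRing 0ℓ 0ℓ) where

  open CommutativeRing R hiding (zero)
  open import Algebra.Properties.CommutativeSemigroup +-commutativeSemigroup public
    using () renaming (interchange to +-interchange; x∙yz≈y∙xz to x+yz≈y+xz)
  open import Algebra.Properties.CommutativeSemigroup *-commutativeSemigroup public
    using () renaming (interchange to *-interchange; x∙yz≈y∙xz to x*yz≈y*xz)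
  open import Relation.Binary.Reasoning.Setoid setoid

  sum prod : List Carrier → Carrier
  sum  = foldr _+_ 0#
  prod = foldr _*_ 1#

  module _ {A : Set} where

    sum-cong : ∀ {f g : A → Carrier} → (∀ x → f x ≈ g x) → ∀ xs →
               sum (map f xs) ≈ sum (map g xs)
    sum-cong e []       = refl
    sum-cong e (x ∷ xs) = +-cong (e x) (sum-cong e xs)

    sum-0 : ∀ {f : A → Carrier} → (∀ x → f x ≈ 0#) → ∀ xs → sum (map f xs) ≈ 0#
    sum-0 e []       = refl
    sum-0 e (x ∷ xs) = trans (+-cong (e x) (sum-0 e xs)) (+-identityˡ 0#)

    sum-+ : ∀ (f g : A → Carrier) xs →
            sum (map (λ x → f x + g x) xs) ≈ sum (map f xs) + sum (map g xs)
    sum-+ f g []       = sym (+-identityˡ 0#)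
    sum-+ f g (x ∷ xs) = trans (+-congˡ (sum-+ f g xs)) (+-interchange _ _ _ _)

    sum-*ˡ : ∀ a (f : A → Carrier) xs → sum (map (λ x → a * f x) xs) ≈ a * sum (map f xs)
    sum-*ˡ a f []       = sym (zeroʳ a)
    sum-*ˡ a f (x ∷ xs) = trans (+-congˡ (sum-*ˡ a f xs)) (sym (distribˡ _ _ _))

    sum-*ʳ : ∀ a (f : A → Carrier) xs → sum (map (λ x → f x * a) xs) ≈ sum (map f xs) * a
    sum-*ʳ a f []       = sym (zeroˡ a)
    sum-*ʳ a f (x ∷ xs) = trans (+-congˡ (sum-*ʳ a f xs)) (sym (distribʳ _ _ _))

    prod-cong : ∀ {f g : A → Carrier} → (∀ x → f x ≈ g x) → ∀ xs →
                prod (map f xs) ≈ prod (map g xs)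
    prod-cong e []       = refl
    prod-cong e (x ∷ xs) = *-cong (e x) (prod-cong e xs)

    prod-++ : ∀ (f : A → Carrier) xs ys →
              prod (map f (xs ++ ys)) ≈ prod (map f xs) * prod (map f ys)
    prod-++ f []       ys = sym (*-identityˡ _)
    prod-++ f (x ∷ xs) ys = trans (*-congˡ (prod-++ f xs ys)) (sym (*-assoc _ _ _))

    prod-↭ : ∀ (f : A → Carrier) {xs ys} → xs ↭ ys → prod (map f xs) ≈ prod (map f ys)
    prod-↭ f ↭.refl         = refl
    prod-↭ f (prep x p)     = *-congˡ (prod-↭ f p)
    prod-↭ f (↭.swap x y p) = trans (x*yz≈y*xz _ _ _) (*-congˡ (*-congˡ (prod-↭ f p)))
    prod-↭ f (↭.trans p q)  = trans (prod-↭ f p) (prod-↭ f q)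

  sum-++ : ∀ xs ys → sum (xs ++ ys) ≈ sum xs + sum ys
  sum-++ []       ys = sym (+-identityˡ _)
  sum-++ (x ∷ xs) ys = trans (+-congˡ (sum-++ xs ys)) (sym (+-assoc _ _ _))

  sum-concatMap : ∀ {A : Set} (f : A → List Carrier) xs →
                  sum (concatMap f xs) ≈ sum (map (λ x → sum (f x)) xs)
  sum-concatMap f []       = refl
  sum-concatMap f (x ∷ xs) =
    trans (sum-++ (f x) (concatMap f xs)) (+-congˡ (sum-concatMap f xs))

  sum-swap : ∀ {A B : Set} (f : A → B → Carrier) xs ys →
             sum (map (λ x → sum (map (f x) ys)) xs) ≈
             sum (map (λ y → sum (map (λ x → f x y) xs)) ys)
  sum-swap f []       ys = sym (sum-0 (λ _ → refl) ys)
  sum-swap f (x ∷ xs) ys =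
    trans (+-congˡ (sum-swap f xs ys)) (sym (sum-+ (f x) (λ y → sum (map (λ z → f z y) xs)) ys))

-- The commutative ring of polynomials

module PolynomialRing (K : CommutativeRing 0ℓ 0ℓ) where

  open CommutativeRing K hiding (zero) renaming (Carrier to Scalar)
  open Polynomials K
  open import Algebra.Properties.Ring ring using (-0#≈0#; -‿+-comm; -‿distribˡ-*)
  open import Relation.Binary.Reasoning.Setoid setoid
  private module SK = Sums K

  Invariant : (Monomial → Scalar) → Set
  Invariant φ = ∀ {μ ν} → μ ↭ ν → φ μ ≈ φ ν

  -- The linear functional with value `φ ν` on the monomial ν. Coefficients of sums, products and
  -- substitutions all take this form, so that laws about them become manipulations of finite sums
  -- of scalars.
  pair : (Monomial → Scalar) → Poly → Scalar
  pair φ []            = 0#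
  pair φ ((c , ν) ∷ p) = c * φ ν + pair φ p

  pair-++ : ∀ φ p q → pair φ (p ++ q) ≈ pair φ p + pair φ q
  pair-++ φ []            q = sym (+-identityˡ _)
  pair-++ φ ((c , ν) ∷ p) q = trans (+-congˡ (pair-++ φ p q)) (sym (+-assoc _ _ _))

  pair-congˡ-All : ∀ {φ ψ} {p : Poly} → All (λ t → φ (proj₂ t) ≈ ψ (proj₂ t)) p → pair φ p ≈ pair ψ p
  pair-congˡ-All []       = refl
  pair-congˡ-All (e ∷ es) = +-cong (*-congˡ e) (pair-congˡ-All es)

  pair-congˡ : ∀ {φ ψ} → (∀ ν → φ ν ≈ ψ ν) → ∀ p → pair φ p ≈ pair ψ p
  pair-congˡ e p = pair-congˡ-All (All.universal (λ t → e (proj₂ t)) p)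

  pair-0 : ∀ {φ} → (∀ ν → φ ν ≈ 0#) → ∀ p → pair φ p ≈ 0#
  pair-0 e []            = refl
  pair-0 e ((c , ν) ∷ p) = trans (+-cong (trans (*-congˡ (e ν)) (zeroʳ c)) (pair-0 e p)) (+-identityˡ 0#)

  pair-+ˡ : ∀ φ ψ p → pair (λ ν → φ ν + ψ ν) p ≈ pair φ p + pair ψ p
  pair-+ˡ φ ψ []            = sym (+-identityˡ _)
  pair-+ˡ φ ψ ((c , ν) ∷ p) =
    trans (+-cong (distribˡ c _ _) (pair-+ˡ φ ψ p)) (SK.+-interchange _ _ _ _)

  pair-*ˡ : ∀ a φ p → pair (λ ν → a * φ ν) p ≈ a * pair φ p
  pair-*ˡ a φ []            = sym (zeroʳ a)
  pair-*ˡ a φ ((c , ν) ∷ p) =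
    trans (+-cong (SK.x*yz≈y*xz _ _ _) (pair-*ˡ a φ p)) (sym (distribˡ a _ _))

  pair-swap : ∀ (h : Monomial → Monomial → Scalar) p q →
    pair (λ ν → pair (h ν) q) p ≈ pair (λ ρ → pair (λ ν → h ν ρ) p) q
  pair-swap h []            q = sym (pair-0 (λ _ → refl) q)
  pair-swap h ((c , ν) ∷ p) q = begin
    c * pair (h ν) q + pair (λ ν → pair (h ν) q) p
      ≈⟨ +-cong (sym (pair-*ˡ c (h ν) q)) (pair-swap h p q) ⟩
    pair (λ ρ → c * h ν ρ) q + pair (λ ρ → pair (λ ν → h ν ρ) p) q
      ≈⟨ sym (pair-+ˡ _ _ q) ⟩
    pair (λ ρ → c * h ν ρ + pair (λ ν → h ν ρ) p) q ∎

  δ : Monomial → Monomial → Scalar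
  δ μ ν = if does (ν ↭? μ) then 1# else 0#

  coeff-pair : ∀ p μ → coeff p μ ≈ pair (δ μ) p
  coeff-pair []            μ = refl
  coeff-pair ((c , ν) ∷ p) μ with does (ν ↭? μ)
  ... | true  = +-cong (sym (*-identityʳ c)) (coeff-pair p μ)
  ... | false = trans (coeff-pair p μ) (sym (trans (+-congʳ (zeroʳ c)) (+-identityˡ _)))

  δ-invariant : ∀ μ → Invariant (δ μ)
  δ-invariant μ {ν} {ν′} p = reflexive (≡.cong (if_then 1# else 0#)
    (does-⇔ (mk⇔ (↭-trans (↭-sym p)) (↭-trans p)) (ν ↭? μ) (ν′ ↭? μ)))

  without : Monomial → Poly → Poly
  without μ = filter (λ t → ¬? (proj₂ t ↭? μ))

  pair-without : ∀ {φ} → Invariant φ → ∀ μ p →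
    pair φ p ≈ coeff p μ * φ μ + pair φ (without μ p)
  pair-without inv μ [] = sym (trans (+-congʳ (zeroˡ _)) (+-identityˡ _))
  pair-without {φ} inv μ ((c , ν) ∷ p) with ν ↭? μ
  ... | no ν≉μ  = trans (+-congˡ (pair-without inv μ p)) (SK.x+yz≈y+xz _ _ _)
  ... | yes ν↭μ = begin
    c * φ ν + pair φ p
      ≈⟨ +-cong (*-congˡ (inv ν↭μ)) (pair-without inv μ p) ⟩
    c * φ μ + (coeff p μ * φ μ + pair φ (without μ p))
      ≈⟨ +-assoc _ _ _ ⟨
    (c * φ μ + coeff p μ * φ μ) + pair φ (without μ p)
      ≈⟨ +-congʳ (distribʳ _ _ _) ⟨
    (c + coeff p μ) * φ μ + pair φ (without μ p) ∎

  coeff-without-↭ : ∀ μ {ν} p → ν ↭ μ → coeff (without μ p) ν ≈ 0#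
  coeff-without-↭ μ []                ν↭μ = refl
  coeff-without-↭ μ {ν} ((c , ρ) ∷ p) ν↭μ with ρ ↭? μ
  ... | yes _ = coeff-without-↭ μ p ν↭μ
  ... | no ρ≉μ with ρ ↭? ν
  ...   | yes ρ↭ν = contradiction (↭-trans ρ↭ν ν↭μ) ρ≉μ
  ...   | no _    = coeff-without-↭ μ p ν↭μ

  coeff-without-≁ : ∀ μ {ν} p → ¬ (ν ↭ μ) → coeff (without μ p) ν ≈ coeff p ν
  coeff-without-≁ μ []                ν≁μ = refl
  coeff-without-≁ μ {ν} ((c , ρ) ∷ p) ν≁μ with ρ ↭? μ
  coeff-without-≁ μ {ν} ((c , ρ) ∷ p) ν≁μ | yes ρ↭μ with ρ ↭? ν
  ... | yes ρ↭ν = contradiction (↭-trans (↭-sym ρ↭ν) ρ↭μ) ν≁μ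
  ... | no _    = coeff-without-≁ μ p ν≁μ
  coeff-without-≁ μ {ν} ((c , ρ) ∷ p) ν≁μ | no _ with ρ ↭? ν
  ... | yes _ = +-congˡ (coeff-without-≁ μ p ν≁μ)
  ... | no _  = coeff-without-≁ μ p ν≁μ

  without-≋0 : ∀ μ p → p ≋ 0ₚ → without μ p ≋ 0ₚ
  without-≋0 μ p (mk≋ p≋0) = mk≋ coeffs
    where
    coeffs : ∀ ν → coeff (without μ p) ν ≈ 0#
    coeffs ν with ν ↭? μ
    ... | yes ν↭μ = coeff-without-↭ μ p ν↭μ
    ... | no ν≁μ  = trans (coeff-without-≁ μ p ν≁μ) (p≋0 ν)

  -- Discarding all terms whose word is a permutation of the first one changes the functional by a
  -- zero coefficient times `φ μ`, and shortens the list. The shortened list is not a structural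
  -- part of `p`, hence the recursion on a bound `n` for the length.
  pair-≋0 : ∀ {φ} → Invariant φ → ∀ n p → length p ℕ.≤ n → p ≋ 0ₚ → pair φ p ≈ 0#
  pair-≋0 inv n       []              _          _   = refl
  pair-≋0 {φ} inv (suc n) p@((c , μ) ∷ p′) (ℕ.s≤s le) p≋0 = begin
    pair φ p  ≈⟨ pair-without inv μ p ⟩
    coeff p μ * φ μ + pair φ (without μ p) ≈⟨ +-cong (*-congʳ (coeff-≈ p≋0 μ))
         (pair-≋0 inv n (without μ p) shorter (without-≋0 μ p p≋0)) ⟩
    0# * φ μ + 0#  ≈⟨ trans (+-identityʳ _) (zeroˡ _) ⟩
    0# ∎
    where
    shorter : length (without μ p) ℕ.≤ n
    shorter = ℕ.≤-trans
      (ℕ.≤-reflexive (≡.cong length (filter-reject (λ t → ¬? (proj₂ t ↭? μ)) {x = c , μ} {xs = p′} (λ ¬r → ¬r ↭-refl))))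
      (ℕ.≤-trans (length-filter (λ t → ¬? (proj₂ t ↭? μ)) p′) le)

  ⊖_ : Poly → Poly
  ⊖_ = map (λ t → - proj₁ t , proj₂ t)

  pair-⊖ : ∀ φ p → pair φ (⊖ p) ≈ - pair φ p
  pair-⊖ φ []            = sym -0#≈0#
  pair-⊖ φ ((c , ν) ∷ p) =
    trans (+-cong (sym (-‿distribˡ-* c _)) (pair-⊖ φ p)) (-‿+-comm _ _)

  coeff-⊕ : ∀ p q μ → coeff (p ⊕ q) μ ≈ coeff p μ + coeff q μ
  coeff-⊕ p q μ = trans (coeff-pair (p ⊕ q) μ) (trans (pair-++ (δ μ) p q)
    (sym (+-cong (coeff-pair p μ) (coeff-pair q μ))))

  coeff-⊖ : ∀ p μ → coeff (⊖ p) μ ≈ - coeff p μ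
  coeff-⊖ p μ = trans (coeff-pair (⊖ p) μ) (trans (pair-⊖ (δ μ) p) (sym (-‿cong (coeff-pair p μ))))

  -- A functional that does not distinguish permuted words is well defined on
  -- polynomials; this is what makes multiplication and substitution respect _≋_.
  pair-cong : ∀ {φ} → Invariant φ → ∀ {p q} → p ≋ q → pair φ p ≈ pair φ q
  pair-cong {φ} inv {p} {q} p≋q = begin
    pair φ p  ≈⟨ +-identityʳ _ ⟨
    pair φ p + 0#  ≈⟨ +-congˡ (-‿inverseˡ _) ⟨
    pair φ p + (- pair φ q + pair φ q)    ≈⟨ +-assoc _ _ _ ⟨
    (pair φ p + - pair φ q) + pair φ q    ≈⟨ +-congʳ (+-congˡ (pair-⊖ φ q)) ⟨
    (pair φ p + pair φ (⊖ q)) + pair φ q  ≈⟨ +-congʳ (pair-++ φ p (⊖ q)) ⟨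
    pair φ (p ⊕ ⊖ q) + pair φ q  ≈⟨ +-congʳ (pair-≋0 inv _ (p ⊕ ⊖ q) ℕ.≤-refl difference) ⟩
    0# + pair φ q  ≈⟨ +-identityˡ _ ⟩
    pair φ q ∎
    where
    difference : p ⊕ ⊖ q ≋ 0ₚ
    difference = mk≋ λ μ → trans (coeff-⊕ p (⊖ q) μ)
      (trans (+-cong (coeff-≈ p≋q μ) (coeff-⊖ q μ)) (-‿inverseʳ _))

  scale : Scalar → Monomial → Poly → Poly
  scale c μ = map (λ t → c * proj₁ t , μ ++ proj₂ t)

  term-⊗ : ∀ c μ p q → ((c , μ) ∷ p) ⊗ q ≡ scale c μ q ++ (p ⊗ q)
  term-⊗ c μ p q = ≡.cong (_++ (p ⊗ q)) (map-cong (λ { (d , ν) → ≡.refl }) q)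

  pair-scale : ∀ φ c μ p → pair φ (scale c μ p) ≈ c * pair (λ ν → φ (μ ++ ν)) p
  pair-scale φ c μ []            = sym (zeroʳ c)
  pair-scale φ c μ ((d , ν) ∷ p) =
    trans (+-cong (*-assoc _ _ _) (pair-scale φ c μ p)) (sym (distribˡ _ _ _))

  pair-⊗ : ∀ φ p q → pair φ (p ⊗ q) ≈ pair (λ ν → pair (λ ρ → φ (ν ++ ρ)) q) p
  pair-⊗ φ []            q = refl
  pair-⊗ φ ((c , ν) ∷ p) q rewrite term-⊗ c ν p q =
    trans (pair-++ φ (scale c ν q) (p ⊗ q)) (+-cong (pair-scale φ c ν q) (pair-⊗ φ p q))

  pair-const-⊗ : ∀ φ c p → pair φ (const c ⊗ p) ≈ c * pair φ p
  pair-const-⊗ φ c p = trans (pair-⊗ φ (const c) p) (+-identityʳ _)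

  -- Each coefficient is itself an invariant functional, so identities may be tested on all
  -- invariant functionals at once; the ring laws then need no case distinction on `↭?`.
  pair≈⇒≋ : ∀ {p q} → (∀ φ → Invariant φ → pair φ p ≈ pair φ q) → p ≋ q
  pair≈⇒≋ {p} {q} e = mk≋ λ μ → trans (coeff-pair p μ)
    (trans (e (δ μ) (δ-invariant μ)) (sym (coeff-pair q μ)))

  ≋-refl : ∀ {p} → p ≋ p
  ≋-refl = mk≋ λ _ → refl

  ≋-sym : ∀ {p q} → p ≋ q → q ≋ p
  ≋-sym e = mk≋ λ μ → sym (coeff-≈ e μ)

  ≋-trans : ∀ {p q r} → p ≋ q → q ≋ r → p ≋ r
  ≋-trans e f = mk≋ λ μ → trans (coeff-≈ e μ) (coeff-≈ f μ)

  ≋-reflexive : ∀ {p q} → p ≡ q → p ≋ q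
  ≋-reflexive ≡.refl = ≋-refl

  ++-invariantˡ : ∀ {φ} → Invariant φ → ∀ q → Invariant (λ ν → pair (λ ρ → φ (ν ++ ρ)) q)
  ++-invariantˡ inv q p = pair-congˡ (λ ρ → inv (++⁺ p ↭-refl)) q

  ⊕-cong : ∀ {p q r s} → p ≋ q → r ≋ s → p ⊕ r ≋ q ⊕ s
  ⊕-cong {p} {q} {r} {s} e f = pair≈⇒≋ λ φ inv → trans (pair-++ φ p r)
    (trans (+-cong (pair-cong inv e) (pair-cong inv f)) (sym (pair-++ φ q s)))

  ⊕-comm : ∀ p q → p ⊕ q ≋ q ⊕ p
  ⊕-comm p q = pair≈⇒≋ λ φ _ → trans (pair-++ φ p q) (trans (+-comm _ _) (sym (pair-++ φ q p)))

  ⊗-cong : ∀ {p q r s} → p ≋ q → r ≋ s → p ⊗ r ≋ q ⊗ s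
  ⊗-cong {p} {q} {r} {s} e f = pair≈⇒≋ λ φ inv → begin
    pair φ (p ⊗ r)  ≈⟨ pair-⊗ φ p r ⟩
    pair (λ ν → pair (λ ρ → φ (ν ++ ρ)) r) p  ≈⟨ pair-cong (++-invariantˡ inv r) e ⟩
    pair (λ ν → pair (λ ρ → φ (ν ++ ρ)) r) q  ≈⟨ pair-congˡ (λ ν → pair-cong (λ π → inv (++⁺ ↭-refl π)) f) q ⟩
    pair (λ ν → pair (λ ρ → φ (ν ++ ρ)) s) q  ≈⟨ pair-⊗ φ q s ⟨
    pair φ (q ⊗ s) ∎

  ⊗-comm : ∀ p q → p ⊗ q ≋ q ⊗ p
  ⊗-comm p q = pair≈⇒≋ λ φ inv → begin
    pair φ (p ⊗ q)  ≈⟨ pair-⊗ φ p q ⟩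
    pair (λ ν → pair (λ ρ → φ (ν ++ ρ)) q) p  ≈⟨ pair-swap (λ ν ρ → φ (ν ++ ρ)) p q ⟩
    pair (λ ρ → pair (λ ν → φ (ν ++ ρ)) p) q  ≈⟨ pair-congˡ (λ ρ → pair-congˡ (λ ν → inv (++-comm ν ρ)) p) q ⟩
    pair (λ ρ → pair (λ ν → φ (ρ ++ ν)) p) q  ≈⟨ pair-⊗ φ q p ⟨
    pair φ (q ⊗ p) ∎

  ⊗-assoc : ∀ p q r → (p ⊗ q) ⊗ r ≋ p ⊗ (q ⊗ r)
  ⊗-assoc p q r = pair≈⇒≋ λ φ inv → begin
    pair φ ((p ⊗ q) ⊗ r)  ≈⟨ pair-⊗ φ (p ⊗ q) r ⟩
    pair (λ ν → pair (λ ρ → φ (ν ++ ρ)) r) (p ⊗ q) ≈⟨ pair-⊗ _ p q ⟩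
    pair (λ ν → pair (λ σ → pair (λ ρ → φ ((ν ++ σ) ++ ρ)) r) q) p
      ≈⟨ pair-congˡ (λ ν → pair-congˡ (λ σ → pair-congˡ (λ ρ →
           reflexive (≡.cong φ (++-assoc ν σ ρ))) r) q) p ⟩
    pair (λ ν → pair (λ σ → pair (λ ρ → φ (ν ++ (σ ++ ρ))) r) q) p
      ≈⟨ pair-congˡ (λ ν → pair-⊗ (λ ρ → φ (ν ++ ρ)) q r) p ⟨
    pair (λ ν → pair (λ ρ → φ (ν ++ ρ)) (q ⊗ r)) p ≈⟨ pair-⊗ φ p (q ⊗ r) ⟨
    pair φ (p ⊗ (q ⊗ r)) ∎

  ⊗-identityˡ : ∀ p → 1ₚ ⊗ p ≋ p
  ⊗-identityˡ p = pair≈⇒≋ λ φ _ → trans (pair-const-⊗ φ 1# p) (*-identityˡ _)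

  ⊗-distribʳ : ∀ r p q → (p ⊕ q) ⊗ r ≋ (p ⊗ r) ⊕ (q ⊗ r)
  ⊗-distribʳ r p q = pair≈⇒≋ λ φ _ → begin
    pair φ ((p ⊕ q) ⊗ r)  ≈⟨ pair-⊗ φ (p ⊕ q) r ⟩
    pair _ (p ⊕ q)  ≈⟨ pair-++ _ p q ⟩
    pair _ p + pair _ q  ≈⟨ +-cong (pair-⊗ φ p r) (pair-⊗ φ q r) ⟨
    pair φ (p ⊗ r) + pair φ (q ⊗ r)  ≈⟨ pair-++ φ (p ⊗ r) (q ⊗ r) ⟨
    pair φ ((p ⊗ r) ⊕ (q ⊗ r)) ∎

  ⊖-inverseˡ : ∀ p → ⊖ p ⊕ p ≋ 0ₚ
  ⊖-inverseˡ p = pair≈⇒≋ λ φ _ → trans (pair-++ φ (⊖ p) p)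
    (trans (+-congʳ (pair-⊖ φ p)) (-‿inverseˡ _))

  ⊖-cong : ∀ {p q} → p ≋ q → ⊖ p ≋ ⊖ q
  ⊖-cong {p} {q} e = mk≋ λ μ →
    trans (coeff-⊖ p μ) (trans (-‿cong (coeff-≈ e μ)) (sym (coeff-⊖ q μ)))

  polyIsCommutativeRing : IsCommutativeRing _≋_ _⊕_ _⊗_ ⊖_ 0ₚ 1ₚ
  polyIsCommutativeRing = record
    { isRing = record
      { +-isAbelianGroup = record
        { isGroup = record
          { isMonoid = record
            { isSemigroup = record
              { isMagma = record
                { isEquivalence = record { refl = ≋-refl ; sym = ≋-sym ; trans = ≋-trans }
                ; ∙-cong = ⊕-cong
                }
              ; assoc = λ p q r → ≋-reflexive (++-assoc p q r)
              }
            ; identity = (λ _ → ≋-refl) , λ p → ≋-reflexive (++-identityʳ p)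
            }
          ; inverse = ⊖-inverseˡ , λ p → ≋-trans (⊕-comm p (⊖ p)) (⊖-inverseˡ p)
          ; ⁻¹-cong = ⊖-cong
          }
        ; comm = ⊕-comm
        }
      ; *-cong = ⊗-cong
      ; *-assoc = ⊗-assoc
      ; *-identity = ⊗-identityˡ , λ p → ≋-trans (⊗-comm p 1ₚ) (⊗-identityˡ p)
      ; distrib = (λ p q r → ≋-trans (⊗-comm p (q ⊕ r)) (≋-trans (⊗-distribʳ p q r)
                    (⊕-cong (⊗-comm q p) (⊗-comm r p))))
                , ⊗-distribʳ
      }
    ; *-comm = ⊗-comm
    }

  polyRing : CommutativeRing 0ℓ 0ℓ
  polyRing = record { isCommutativeRing = polyIsCommutativeRing }

  private
    module P = CommutativeRing polyRing
    module SP = Sums polyRing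

  const-cong : ∀ {a b} → a ≈ b → const a ≋ const b
  const-cong e = pair≈⇒≋ λ φ _ → +-congʳ (*-congʳ e)

  const-+ : ∀ a b → const (a + b) ≋ const a ⊕ const b
  const-+ a b = pair≈⇒≋ λ φ _ → trans (+-congʳ (distribʳ _ a b)) (+-assoc _ _ _)

  const-* : ∀ a b → const (a * b) ≋ const a ⊗ const b
  const-* a b = pair≈⇒≋ λ φ _ → refl

  const-0 : const 0# ≋ 0ₚ
  const-0 = pair≈⇒≋ λ φ _ → trans (+-identityʳ _) (zeroˡ _)

  coeff-const-⊗ : ∀ c p μ → coeff (const c ⊗ p) μ ≈ c * coeff p μ
  coeff-const-⊗ c p μ = trans (coeff-pair (const c ⊗ p) μ)
    (trans (pair-const-⊗ (δ μ) c p) (*-congˡ (sym (coeff-pair p μ))))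

  -- Substitution

  monomial : (ℕ → Poly) → Monomial → Poly
  monomial s μ = ∏ (map s μ)

  pair-substitute : ∀ φ s p → pair φ (substitute s p) ≈ pair (λ ν → pair φ (monomial s ν)) p
  pair-substitute φ s []            = refl
  pair-substitute φ s ((c , ν) ∷ p) =
    trans (pair-++ φ (const c ⊗ monomial s ν) (substitute s p))
      (+-cong (pair-const-⊗ φ c (monomial s ν)) (pair-substitute φ s p))

  monomial-invariant : ∀ {φ} → Invariant φ → ∀ s → Invariant (λ ν → pair φ (monomial s ν))
  monomial-invariant inv s π = pair-cong inv (SP.prod-↭ s π)

  coeff-substitute : ∀ s p μ → coeff (substitute s p) μ ≈ pair (λ ν → coeff (monomial s ν) μ) p
  coeff-substitute s p μ = trans (coeff-pair (substitute s p) μ) (trans (pair-substitute (δ μ) s p)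
    (pair-congˡ (λ ν → sym (coeff-pair (monomial s ν) μ)) p))

  substitute-cong : ∀ s {p q} → p ≋ q → substitute s p ≋ substitute s q
  substitute-cong s {p} {q} e = pair≈⇒≋ λ φ inv → trans (pair-substitute φ s p)
    (trans (pair-cong (monomial-invariant inv s) e) (sym (pair-substitute φ s q)))

  substitute-ext-All : ∀ {s t p} → All (λ τ → All (λ i → s i ≋ t i) (proj₂ τ)) p →
    substitute s p ≋ substitute t p
  substitute-ext-All []             = ≋-refl
  substitute-ext-All {s} {t} {(c , ν) ∷ p} (e ∷ es) =
    P.+-cong (P.*-congˡ {const c} (go e)) (substitute-ext-All es)
    where
    go : ∀ {ν} → All (λ i → s i ≋ t i) ν → monomial s ν ≋ monomial t ν
    go []       = ≋-refl
    go (e ∷ es) = P.*-cong e (go es)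

  substitute-⊕ : ∀ s p q → substitute s (p ⊕ q) ≋ substitute s p ⊕ substitute s q
  substitute-⊕ s []            q = ≋-refl
  substitute-⊕ s ((c , ν) ∷ p) q =
    ≋-trans (P.+-congˡ {const c ⊗ monomial s ν} (substitute-⊕ s p q))
      (P.sym (P.+-assoc (const c ⊗ monomial s ν) _ _))

  -- Both sides unfold to the same fourfold sum, over the terms of `p` and `q` and of their
  -- substituted monomials; they differ by one exchange of summations.
  substitute-⊗ : ∀ s p q → substitute s (p ⊗ q) ≋ substitute s p ⊗ substitute s q
  substitute-⊗ s p q = pair≈⇒≋ λ φ inv → begin
    pair φ (substitute s (p ⊗ q))
      ≈⟨ pair-substitute φ s (p ⊗ q) ⟩
    pair (λ ν → pair φ (monomial s ν)) (p ⊗ q)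
      ≈⟨ pair-⊗ _ p q ⟩
    pair (λ ν → pair (λ ρ → pair φ (monomial s (ν ++ ρ))) q) p
      ≈⟨ pair-congˡ (λ ν → pair-congˡ (λ ρ → pair-cong inv (SP.prod-++ s ν ρ)) q) p ⟩
    pair (λ ν → pair (λ ρ → pair φ (monomial s ν ⊗ monomial s ρ)) q) p
      ≈⟨ pair-congˡ (λ ν → pair-congˡ (λ ρ → pair-⊗ φ (monomial s ν) (monomial s ρ)) q) p ⟩
    pair (λ ν → pair (λ ρ → pair (λ α → pair (λ β → φ (α ++ β)) (monomial s ρ)) (monomial s ν)) q) p
      ≈⟨ pair-congˡ (λ ν → pair-swap (λ ρ α → pair (λ β → φ (α ++ β)) (monomial s ρ)) q (monomial s ν)) p ⟩
    pair (λ ν → pair (λ α → pair (λ ρ → pair (λ β → φ (α ++ β)) (monomial s ρ)) q) (monomial s ν)) p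
      ≈⟨ pair-congˡ (λ ν → pair-congˡ (λ α → pair-substitute (λ β → φ (α ++ β)) s q) (monomial s ν)) p ⟨
    pair (λ ν → pair (λ α → pair (λ β → φ (α ++ β)) (substitute s q)) (monomial s ν)) p
      ≈⟨ pair-substitute _ s p ⟨
    pair (λ α → pair (λ β → φ (α ++ β)) (substitute s q)) (substitute s p)
      ≈⟨ pair-⊗ φ (substitute s p) (substitute s q) ⟨
    pair φ (substitute s p ⊗ substitute s q) ∎

  substitute-const : ∀ s c → substitute s (const c) ≋ const c
  substitute-const s c = ≋-trans (≋-reflexive (++-identityʳ _)) (P.*-identityʳ (const c))

  substitute-var : ∀ s i → substitute s (var i) ≋ s i
  substitute-var s i = ≋-trans (≋-reflexive (++-identityʳ _))
    (≋-trans (P.*-identityˡ (s i ⊗ 1ₚ)) (P.*-identityʳ (s i)))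

  substitute-∑ : ∀ {A : Set} s (f : A → Poly) xs →
    substitute s (∑ (map f xs)) ≋ ∑ (map (λ x → substitute s (f x)) xs)
  substitute-∑ s f []       = ≋-refl
  substitute-∑ s f (x ∷ xs) =
    ≋-trans (substitute-⊕ s (f x) _) (P.+-congˡ {substitute s (f x)} (substitute-∑ s f xs))

  substitute-∏ : ∀ {A : Set} s (f : A → Poly) xs →
    substitute s (∏ (map f xs)) ≋ ∏ (map (λ x → substitute s (f x)) xs)
  substitute-∏ s f []       = substitute-const s 1#
  substitute-∏ s f (x ∷ xs) =
    ≋-trans (substitute-⊗ s (f x) _) (P.*-congˡ {substitute s (f x)} (substitute-∏ s f xs))

  -- This is about the listed terms, including those whose coefficients are zero
  -- or cancel.
  Terms : (Monomial → Set) → Poly → Set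
  Terms P = All (λ t → P (proj₂ t))

  terms-coeff : ∀ {P} p {μ} → Terms P p → (∀ {ν} → ν ↭ μ → ¬ P ν) → coeff p μ ≈ 0#
  terms-coeff [] [] ¬P = refl
  terms-coeff ((c , ν) ∷ p) {μ} (h ∷ hs) ¬P with ν ↭? μ
  ... | yes ν↭μ = contradiction h (¬P ν↭μ)
  ... | no _    = terms-coeff p hs ¬P

  terms-⊗ : ∀ {P Q R : Monomial → Set} → (∀ {μ ν} → P μ → Q ν → R (μ ++ ν)) →
            ∀ {p q} → Terms P p → Terms Q q → Terms R (p ⊗ q)
  terms-⊗ h {[]} [] hq = []
  terms-⊗ {P} {Q} {R} h {(c , μ) ∷ p} {q} (hμ ∷ hp) hq rewrite term-⊗ c μ p q =
    All.++⁺ (All.map⁺ (All.map (h hμ) hq)) (terms-⊗ {P} {Q} {R} h hp hq)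

  terms-∑ : ∀ {P ps} → All (Terms P) ps → Terms P (∑ ps)
  terms-∑ []       = []
  terms-∑ (h ∷ hs) = All.++⁺ h (terms-∑ hs)

-- Permanents: row expansion and Hessenberg matrices

module Permanents (R : CommutativeRing 0ℓ 0ℓ) where

  open import Data.Bool.Base using (T)
  open import Data.Fin.Base using (zero; suc)
  open CommutativeRing R hiding (zero)
  open Sums R
  open import Relation.Binary.Reasoning.Setoid setoid

  minor : ∀ {n} → (Fin (suc n) → Fin (suc n) → Carrier) → Fin (suc n) → Fin n → Fin n → Carrier
  minor M j i k = M (suc i) (punchIn j k)

  -- Expansion along the first row. It follows the recursion of `permutations`, since
  -- `insert zero j π` sends `suc i` to `punchIn j (π i)`.
  perm : ∀ {n} → (Fin n → Fin n → Carrier) → Carrier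
  perm {zero}  M = 1#
  perm {suc n} M = sum (map (λ j → M zero j * perm (minor M j)) (allFin (suc n)))

  tabulate-suc : ∀ {A : Set} {n} (f : Fin (suc n) → A) →
    map f (allFin (suc n)) ≡ f zero ∷ map (f ∘ suc) (allFin n)
  tabulate-suc {n = n} f = ≡.cong (f zero ∷_)
    (≡.trans (map-tabulate suc f) (≡.sym (map-tabulate id (f ∘ suc))))

  permanent-perm : ∀ {n} (M : Fin n → Fin n → Carrier) →
    sum (map (λ σ → prod (map (λ i → M i (σ ⟨$⟩ʳ i)) (allFin n))) (permutations n)) ≈ perm M
  permanent-perm {zero}  M = +-identityʳ 1#
  permanent-perm {suc n} M = begin
    sum (map term (concatMap extensions (allFin (suc n))))
      ≡⟨ ≡.cong sum (map-concatMap term extensions (allFin (suc n))) ⟩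
    sum (concatMap (map term ∘ extensions) (allFin (suc n)))
      ≈⟨ sum-concatMap (map term ∘ extensions) (allFin (suc n)) ⟩
    sum (map (λ j → sum (map term (extensions j))) (allFin (suc n)))
      ≈⟨ sum-cong expand (allFin (suc n)) ⟩
    perm M ∎
    where
    term : Permutation′ (suc n) → Carrier
    term σ = prod (map (λ i → M i (σ ⟨$⟩ʳ i)) (allFin (suc n)))
    extensions : Fin (suc n) → List (Permutation′ (suc n))
    extensions j = map (insert zero j) (permutations n)
    expand : ∀ j → sum (map term (extensions j)) ≈ M zero j * perm (minor M j)
    expand j = begin
      sum (map term (map (insert zero j) (permutations n)))
        ≡⟨ ≡.cong sum (map-∘ (permutations n)) ⟨
      sum (map (term ∘ insert zero j) (permutations n))
        ≈⟨ sum-cong (λ π → reflexive (≡.cong prod (tabulate-suc (λ i → M i (insert zero j π ⟨$⟩ʳ i))))) (permutations n) ⟩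
      sum (map (λ π → M zero j * prod (map (λ i → minor M j i (π ⟨$⟩ʳ i)) (allFin n))) (permutations n))
        ≈⟨ sum-*ˡ (M zero j) _ (permutations n) ⟩
      M zero j * sum (map (λ π → prod (map (λ i → minor M j i (π ⟨$⟩ʳ i)) (allFin n))) (permutations n))
        ≈⟨ *-congˡ (permanent-perm (minor M j)) ⟩
      M zero j * perm (minor M j) ∎

  perm-cong : ∀ {n} {M N : Fin n → Fin n → Carrier} → (∀ i j → M i j ≈ N i j) → perm M ≈ perm N
  perm-cong {zero}  e = refl
  perm-cong {suc n} e = sum-cong (λ j → *-cong (e zero j)
    (perm-cong (λ i k → e (suc i) (punchIn j k)))) (allFin (suc n))

  perm-zeroColumn : ∀ {n} (M : Fin n → Fin n → Carrier) c → (∀ i → M i c ≈ 0#) → perm M ≈ 0#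
  perm-zeroColumn {suc n} M c z = sum-0 vanish (allFin (suc n))
    where
    vanish : ∀ j → M zero j * perm (minor M j) ≈ 0#
    vanish j with j Fin.≟ c
    ... | yes ≡.refl = trans (*-congʳ (z zero)) (zeroˡ _)
    ... | no j≢c     = trans (*-congˡ (perm-zeroColumn (minor M j) (punchOut j≢c)
      (λ i → trans (reflexive (≡.cong (M (suc i)) (Fin.punchIn-punchOut j≢c))) (z (suc i))))) (zeroʳ _)

  sum-allFin-suc : ∀ {n} (f : Fin (suc n) → Carrier) →
    sum (map f (allFin (suc n))) ≈ f zero + sum (map (f ∘ suc) (allFin n))
  sum-allFin-suc f = reflexive (≡.cong sum (tabulate-suc f))

  perm-unitColumn : ∀ {n} (M : Fin (suc n) → Fin (suc n) → Carrier) →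
    M zero zero ≈ 1# → (∀ i → M (suc i) zero ≈ 0#) → perm M ≈ perm (λ i k → M (suc i) (suc k))
  perm-unitColumn {zero}  M e z = trans (+-identityʳ _) (trans (*-congʳ e) (*-identityˡ _))
  perm-unitColumn {suc n} M e z = begin
    perm M ≈⟨ sum-allFin-suc (λ j → M zero j * perm (minor M j)) ⟩
    M zero zero * perm (minor M zero) + sum (map (λ j → M zero (suc j) * perm (minor M (suc j))) (allFin (suc n)))
      ≈⟨ +-cong (trans (*-congʳ e) (*-identityˡ _)) (sum-0 (λ j → trans (*-congˡ
           (perm-zeroColumn (minor M (suc j)) zero z)) (zeroʳ _)) (allFin (suc n))) ⟩
    perm (minor M zero) + 0# ≈⟨ +-identityʳ _ ⟩
    perm (minor M zero) ∎

  eliminate : ∀ {n} → (Fin (suc (suc n)) → Fin (suc (suc n)) → Carrier) → Fin (suc n) → Fin (suc n) → Carrier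
  eliminate M zero    k = M zero zero * M (suc zero) (suc k) + M zero (suc k)
  eliminate M (suc i) k = M (suc (suc i)) (suc k)

  -- Column 0 is used either in row 0, leaving row 1 with the factor `M zero zero`, or in row 1,
  -- where it is 1, leaving row 0. The other rows are the same in both cases, so by linearity in a
  -- row the two contributions are one permanent with the two rows merged.
  perm-eliminate : ∀ {n} (M : Fin (suc (suc n)) → Fin (suc (suc n)) → Carrier) →
    M (suc zero) zero ≈ 1# → (∀ i → M (suc (suc i)) zero ≈ 0#) → perm M ≈ perm (eliminate M)
  perm-eliminate {n} M e z = begin
    perm M
      ≈⟨ sum-allFin-suc (λ j → M zero j * perm (minor M j)) ⟩
    M zero zero * perm (minor M zero) + sum (map (λ k → M zero (suc k) * perm (minor M (suc k))) ks)
      ≈⟨ +-cong (sym (sum-*ˡ (M zero zero) _ ks)) (sum-cong (λ k → *-congˡ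
           (perm-unitColumn (minor M (suc k)) e z)) ks) ⟩
    sum (map (λ k → M zero zero * (M (suc zero) (suc k) * rest k)) ks) + sum (map (λ k → M zero (suc k) * rest k) ks)
      ≈⟨ sum-+ _ _ ks ⟨
    sum (map (λ k → M zero zero * (M (suc zero) (suc k) * rest k) + M zero (suc k) * rest k) ks)
      ≈⟨ sum-cong (λ k → trans (+-congʳ (sym (*-assoc _ _ _))) (sym (distribʳ _ _ _))) ks ⟩
    perm (eliminate M) ∎
    where
    ks = allFin (suc n)
    rest : Fin (suc n) → Carrier
    rest k = perm (λ i c → M (suc (suc i)) (suc (punchIn k c)))

  Σ< : ℕ → (ℕ → Carrier) → Carrier
  Σ< zero    f = 0#
  Σ< (suc n) f = f 0 + Σ< n (f ∘ suc)

  Σ<-cong : ∀ n {f g} → (∀ i → i ℕ.< n → f i ≈ g i) → Σ< n f ≈ Σ< n g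
  Σ<-cong zero    e = refl
  Σ<-cong (suc n) e = +-cong (e 0 (ℕ.s≤s ℕ.z≤n)) (Σ<-cong n (λ i lt → e (suc i) (ℕ.s≤s lt)))

  Σ<-0 : ∀ n {f} → (∀ i → f i ≈ 0#) → Σ< n f ≈ 0#
  Σ<-0 zero    e = refl
  Σ<-0 (suc n) e = trans (+-cong (e 0) (Σ<-0 n (λ i → e (suc i)))) (+-identityˡ 0#)

  Σ<-+ : ∀ n f g → Σ< n (λ i → f i + g i) ≈ Σ< n f + Σ< n g
  Σ<-+ zero    f g = sym (+-identityˡ 0#)
  Σ<-+ (suc n) f g = trans (+-congˡ (Σ<-+ n (f ∘ suc) (g ∘ suc))) (+-interchange _ _ _ _)

  Σ<-single : ∀ {n d} f → d ℕ.< n → (∀ e → e ℕ.< n → e ≢ d → f e ≈ 0#) → Σ< n f ≈ f d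
  Σ<-single {suc n} {zero}  f _            h = trans
    (+-congˡ (trans (Σ<-cong n (λ e lt → h (suc e) (ℕ.s≤s lt) λ ())) (Σ<-0 n (λ _ → refl)))) (+-identityʳ _)
  Σ<-single {suc n} {suc d} f (ℕ.s≤s lt) h = trans (+-cong (h 0 (ℕ.s≤s ℕ.z≤n) λ ())
    (Σ<-single (f ∘ suc) lt (λ e lt′ e≢d → h (suc e) (ℕ.s≤s lt′) (e≢d ∘ ℕ.suc-injective)))) (+-identityˡ (f (suc d)))

  only : ℕ → Carrier → ℕ → Carrier
  only a x i = if i ≡ᵇ a then x else 0#

  Σ<-only : ∀ {n} a x (v : ℕ → Carrier) → a ℕ.< n → Σ< n (λ i → only a x i * v i) ≈ x * v a
  Σ<-only {suc n} zero    x v _          =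
    trans (+-congˡ (Σ<-0 n (λ i → zeroˡ _))) (+-identityʳ _)
  Σ<-only {suc n} (suc a) x v (ℕ.s≤s lt) =
    trans (+-cong (zeroˡ _) (Σ<-only a x (v ∘ suc) lt)) (+-identityˡ _)

  -- v is the sequence of vertex values of the skew program in which w i k is the
  -- weight of the edge from vertex i to vertex k + 1.
  Runs : (w : ℕ → ℕ → Carrier) → (v : ℕ → Carrier) → Set
  Runs w v = ∀ k → v (suc k) ≈ Σ< (suc k) (λ i → w i k * v i)

  -- A permanent has no signs, so the subdiagonal carries 1 where a determinant would need -1.
  hessenberg : (ℕ → ℕ → Carrier) → ∀ n → Fin n → Fin n → Carrier
  hessenberg w n i k = entry (toℕ i) (toℕ k)
    where
    entry : ℕ → ℕ → Carrier
    entry i k = if i ≤ᵇ k then w i k else if i ≡ᵇ suc k then 1# else 0#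

  module _ (w : ℕ → ℕ → Carrier) (v : ℕ → Carrier) where

    -- Vertex 1 has only the incoming edge from vertex 0, of weight `w 0 0`, so it can be merged
    -- into vertex 0 by rerouting the edges that leave it. On Hessenberg matrices this is
    -- `eliminate`.
    contractW : ℕ → ℕ → Carrier
    contractW zero    k = w 0 0 * w 1 (suc k) + w 0 (suc k)
    contractW (suc i) k = w (suc (suc i)) (suc k)

    contractV : ℕ → Carrier
    contractV zero    = 1#
    contractV (suc k) = v (suc (suc k))

    contract-runs : v 0 ≈ 1# → Runs w v → Runs contractW contractV
    contract-runs v0 r k = begin
      v (suc (suc k))  ≈⟨ r (suc k) ⟩
      w 0 (suc k) * v 0 + (w 1 (suc k) * v 1 + rest) ≈⟨ +-assoc _ _ _ ⟨
      (w 0 (suc k) * v 0 + w 1 (suc k) * v 1) + rest ≈⟨ +-congʳ first ⟩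
      (w 0 0 * w 1 (suc k) + w 0 (suc k)) * 1# + rest ∎
      where
      rest = Σ< k (λ i → w (suc (suc i)) (suc k) * v (suc (suc i)))
      v1 : v 1 ≈ w 0 0
      v1 = trans (r 0) (trans (+-identityʳ _) (trans (*-congˡ v0) (*-identityʳ _)))
      first : w 0 (suc k) * v 0 + w 1 (suc k) * v 1 ≈ (w 0 0 * w 1 (suc k) + w 0 (suc k)) * 1#
      first = begin
        w 0 (suc k) * v 0 + w 1 (suc k) * v 1 ≈⟨ +-cong (trans (*-congˡ v0) (*-identityʳ _)) (trans (*-congˡ v1) (*-comm _ _)) ⟩
        w 0 (suc k) + w 0 0 * w 1 (suc k)     ≈⟨ +-comm _ _ ⟩
        w 0 0 * w 1 (suc k) + w 0 (suc k)     ≈⟨ *-identityʳ _ ⟨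
        (w 0 0 * w 1 (suc k) + w 0 (suc k)) * 1# ∎

  perm-hessenberg : ∀ n w v → v 0 ≈ 1# → Runs w v → perm (hessenberg w n) ≈ v n
  perm-hessenberg zero          w v v0 r = sym v0
  perm-hessenberg (suc zero)    w v v0 r =
    trans (+-congʳ (*-congˡ (sym v0))) (sym (r 0))
  perm-hessenberg (suc (suc n)) w v v0 r = begin
    perm (hessenberg w (suc (suc n)))  ≈⟨ perm-eliminate (hessenberg w (suc (suc n))) refl (λ _ → refl) ⟩
    perm (eliminate (hessenberg w (suc (suc n)))) ≈⟨ perm-cong {suc n} {eliminate (hessenberg w (suc (suc n)))} {hessenberg (contractW w v) (suc n)} (λ { zero k → refl ; (suc i) k → refl }) ⟩
    perm (hessenberg (contractW w v) (suc n))     ≈⟨ perm-hessenberg (suc n) (contractW w v) (contractV w v) refl (contract-runs w v v0 r) ⟩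
    v (suc (suc n)) ∎

  module Values (w : ℕ → ℕ → Carrier) where

    -- Only the entries `values k i` with i ≤ k are meaningful. Extending the table stage by stage
    -- turns the course-of-values recursion of a program into a structural one.
    values : ℕ → ℕ → Carrier
    values zero    i = 1#
    values (suc k) i = if i ≤ᵇ k then values k i else Σ< (suc k) (λ j → w j k * values k j)

    value : ℕ → Carrier
    value i = values i i

    value-suc : ∀ k → value (suc k) ≡ Σ< (suc k) (λ i → w i k * values k i)
    value-suc k with suc k ≤ᵇ k in eq
    ... | true  = ⊥-elim (ℕ.1+n≰n (ℕ.≤ᵇ⇒≤ (suc k) k (≡.subst T (≡.sym eq) _)))
    ... | false = ≡.refl

    values-value : ∀ k i → i ℕ.≤ k → values k i ≡ value i
    values-value zero    zero ℕ.z≤n = ≡.refl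
    values-value (suc k) i    i≤1+k with i ≤ᵇ k in eq
    ... | true  = values-value k i (ℕ.≤ᵇ⇒≤ i k (≡.subst T (≡.sym eq) _))
    ... | false = ≡.subst (λ j → Σ< (suc k) (λ i → w i k * values k i) ≡ value j) (≡.sym i≡1+k) (≡.sym (value-suc k))
      where
      i≡1+k : i ≡ suc k
      i≡1+k = ℕ.≤-antisym i≤1+k (ℕ.≰⇒> (λ i≤k → ≡.subst T eq (ℕ.≤⇒≤ᵇ i≤k)))

    value-runs : Runs w value
    value-runs k = trans (reflexive (value-suc k))
      (Σ<-cong (suc k) λ { i (ℕ.s≤s i≤k) → *-congˡ {w i k} (reflexive (values-value k i i≤k)) })

-- Formulas as skew programs and as permanents

module SkewPrograms (K : CommutativeRing 0ℓ 0ℓ) where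

  open import Data.Bool.Base using (T)
  open CommutativeRing K using (0#; trans; +-cong; +-identityˡ)
  open Polynomials K
  open PolynomialRing K
  private module R = CommutativeRing polyRing
  open Permanents polyRing
  open import Relation.Binary.Reasoning.Setoid R.setoid

  if-<ᵇ : ∀ {A : Set} {j n} {x y : A} → j ℕ.< n → (if j <ᵇ n then x else y) ≡ x
  if-<ᵇ {j = j} {n} j<n with j <ᵇ n in eq
  ... | true  = ≡.refl
  ... | false = ⊥-elim (≡.subst T eq (ℕ.<⇒<ᵇ j<n))

  if-≮ᵇ : ∀ {A : Set} {j n} {x y : A} → n ℕ.≤ j → (if j <ᵇ n then x else y) ≡ y
  if-≮ᵇ {j = j} {n} n≤j with j <ᵇ n in eq
  ... | true  = ⊥-elim (ℕ.<⇒≱ (ℕ.<ᵇ⇒< j n (≡.subst T (≡.sym eq) _)) n≤j)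
  ... | false = ≡.refl

  affine-0 : Affine 0ₚ
  affine-0 μ _ = CommutativeRing.refl K

  affine-⊕ : ∀ {p q} → Affine p → Affine q → Affine (p ⊕ q)
  affine-⊕ {p} {q} hp hq μ lt =
    trans (coeff-⊕ p q μ) (trans (+-cong (hp μ lt) (hq μ lt)) (+-identityˡ 0#))

  terms-affine : ∀ p → Terms (λ μ → length μ ℕ.≤ 1) p → Affine p
  terms-affine p h μ lt = terms-coeff p h
    (λ ν↭μ le → ℕ.<⇒≱ lt (≡.subst (ℕ._≤ 1) (↭-length ν↭μ) le))

  affine-1 : Affine 1ₚ
  affine-1 = terms-affine 1ₚ (ℕ.z≤n ∷ [])

  affine-if : ∀ b {p q} → Affine p → Affine q → Affine (if b then p else q)
  affine-if true  hp hq = hp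
  affine-if false hp hq = hq

  affine-only : ∀ a {p} i → Affine p → Affine (only a p i)
  affine-only a {p} i hp = affine-if (i ≡ᵇ a) {p} {0ₚ} hp affine-0

  -- The number of vertices of the skew program computing F, and its edge
  -- weights: it starts with vertex k + 1, its input is vertex a ≤ k, and its last
  -- vertex k + width F carries F times the value of vertex a.
  width : Formula → ℕ
  width (leaf _ _) = 1
  width (add F G)  = suc (width F ℕ.+ width G)
  width (mul F G)  = width F ℕ.+ width G

  weights : Formula → (a k : ℕ) → ℕ → ℕ → Poly
  weights (leaf p _) a k i j = only a p i
  weights (add F G)  a k i j =
    if j <ᵇ k ℕ.+ width F then weights F a k i j
    else if j <ᵇ k ℕ.+ width F ℕ.+ width G then weights G a (k ℕ.+ width F) i j
    else only (k ℕ.+ width F) 1ₚ i ⊕ only (k ℕ.+ width F ℕ.+ width G) 1ₚ i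
  weights (mul F G)  a k i j =
    if j <ᵇ k ℕ.+ width F then weights F a k i j
    else weights G (k ℕ.+ width F) (k ℕ.+ width F) i j

  affine-weights : ∀ F a k i j → Affine (weights F a k i j)
  affine-weights (leaf p h) a k i j = affine-only a i h
  affine-weights (add F G)  a k i j with j <ᵇ k ℕ.+ width F | j <ᵇ k ℕ.+ width F ℕ.+ width G
  ... | true  | _     = affine-weights F a k i j
  ... | false | true  = affine-weights G a _ i j
  ... | false | false = affine-⊕ {only (k ℕ.+ width F) 1ₚ i} {only (k ℕ.+ width F ℕ.+ width G) 1ₚ i}
    (affine-only (k ℕ.+ width F) i affine-1) (affine-only (k ℕ.+ width F ℕ.+ width G) i affine-1)
  affine-weights (mul F G)  a k i j with j <ᵇ k ℕ.+ width F
  ... | true  = affine-weights F a k i j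
  ... | false = affine-weights G _ _ i j

  -- The output is linear in the value of the input vertex `a`, so feeding the output of one program
  -- into another multiplies the two formulas, and no two computed values are ever multiplied. Only
  -- the edges into the vertices after `k`, up to `k + width F`, are constrained, so that
  -- subprograms can be run inside a larger program.
  weights-correct : ∀ F {a k w} v → Runs w v → a ℕ.≤ k →
    (∀ i j → k ℕ.≤ j → j ℕ.< k ℕ.+ width F → w i j ≡ weights F a k i j) →
    v (k ℕ.+ width F) ≋ value F ⊗ v a
  weights-correct (leaf p _) {a} {k} {w} v r a≤k e = begin
    v (k ℕ.+ 1)  ≡⟨ ≡.cong v (ℕ.+-comm k 1) ⟩
    v (suc k)  ≈⟨ r k ⟩
    Σ< (suc k) (λ i → w i k ⊗ v i)  ≈⟨ Σ<-cong (suc k) (λ i _ → R.*-congʳ {v i}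
       (R.reflexive (e i k ℕ.≤-refl (ℕ.m<m+n k (ℕ.s≤s ℕ.z≤n))))) ⟩
    Σ< (suc k) (λ i → only a p i ⊗ v i)      ≈⟨ Σ<-only a p v (ℕ.s≤s a≤k) ⟩
    p ⊗ v a ∎
  weights-correct (mul F G) {a} {k} {w} v r a≤k e = begin
    v (k ℕ.+ (width F ℕ.+ width G)) ≡⟨ ≡.cong v (ℕ.+-assoc k (width F) (width G)) ⟨
    v (m ℕ.+ width G)  ≈⟨ weights-correct G v r ℕ.≤-refl (λ i j le lt →
       ≡.trans (e i j (ℕ.≤-trans (ℕ.m≤m+n k _) le) (ℕ.<-≤-trans lt (ℕ.≤-reflexive (ℕ.+-assoc k _ _)))) (if-≮ᵇ le)) ⟩
    value G ⊗ v m  ≈⟨ R.*-congˡ {value G} (weights-correct F v r a≤k (λ i j le lt →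
       ≡.trans (e i j le (ℕ.<-≤-trans lt (ℕ.+-monoʳ-≤ k (ℕ.m≤m+n _ _)))) (if-<ᵇ lt))) ⟩
    value G ⊗ (value F ⊗ v a)       ≈⟨ R.*-assoc (value G) (value F) (v a) ⟨
    (value G ⊗ value F) ⊗ v a       ≈⟨ R.*-congʳ {v a} (R.*-comm (value G) (value F)) ⟩
    (value F ⊗ value G) ⊗ v a ∎
    where m = k ℕ.+ width F
  weights-correct (add F G) {a} {k} {w} v r a≤k e = begin
    v (k ℕ.+ suc (width F ℕ.+ width G))
      ≡⟨ ≡.cong v (≡.trans (ℕ.+-suc k _) (≡.cong suc (≡.sym (ℕ.+-assoc k _ _)))) ⟩
    v (suc n)
      ≈⟨ r n ⟩
    Σ< (suc n) (λ i → w i n ⊗ v i)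
      ≈⟨ Σ<-cong (suc n) (λ i _ → R.trans (R.*-congʳ {v i} (R.reflexive (last i)))
           (R.distribʳ (v i) (only m 1ₚ i) (only n 1ₚ i))) ⟩
    Σ< (suc n) (λ i → only m 1ₚ i ⊗ v i ⊕ only n 1ₚ i ⊗ v i)
      ≈⟨ Σ<-+ (suc n) (λ i → only m 1ₚ i ⊗ v i) (λ i → only n 1ₚ i ⊗ v i) ⟩
    Σ< (suc n) (λ i → only m 1ₚ i ⊗ v i) ⊕ Σ< (suc n) (λ i → only n 1ₚ i ⊗ v i)
      ≈⟨ R.+-cong (Σ<-only m 1ₚ v (ℕ.s≤s (ℕ.m≤m+n m (width G)))) (Σ<-only n 1ₚ v ℕ.≤-refl) ⟩
    1ₚ ⊗ v m ⊕ 1ₚ ⊗ v n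
      ≈⟨ R.+-cong (R.*-identityˡ (v m)) (R.*-identityˡ (v n)) ⟩
    v m ⊕ v n
      ≈⟨ R.+-cong
           (weights-correct F v r a≤k (λ i j le lt →
             ≡.trans (e i j le (ℕ.<-trans lt (ℕ.+-monoʳ-< k (ℕ.s≤s (ℕ.m≤m+n _ _))))) (if-<ᵇ lt)))
           (weights-correct G v r (ℕ.≤-trans a≤k (ℕ.m≤m+n k _)) (λ i j le lt →
             ≡.trans (e i j (ℕ.≤-trans (ℕ.m≤m+n k _) le) (ℕ.<-trans lt n<))
               (≡.trans (if-≮ᵇ le) (if-<ᵇ lt)))) ⟩
    value F ⊗ v a ⊕ value G ⊗ v a
      ≈⟨ R.distribʳ (v a) (value F) (value G) ⟨
    (value F ⊕ value G) ⊗ v a ∎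
    where
    m = k ℕ.+ width F
    n = m ℕ.+ width G
    n< : n ℕ.< k ℕ.+ suc (width F ℕ.+ width G)
    n< = ℕ.≤-reflexive (≡.trans (≡.cong suc (ℕ.+-assoc k _ _)) (≡.sym (ℕ.+-suc k _)))
    last : ∀ i → w i n ≡ only m 1ₚ i ⊕ only n 1ₚ i
    last i = ≡.trans (e i n (ℕ.≤-trans (ℕ.m≤m+n k _) (ℕ.m≤m+n m _)) n<)
      (≡.trans (if-≮ᵇ (ℕ.m≤m+n m (width G))) (if-≮ᵇ (ℕ.≤-refl {n})))

  width≤size : ∀ F → width F ℕ.≤ size F
  width≤size (leaf _ _) = ℕ.≤-refl
  width≤size (add F G)  = ℕ.s≤s (ℕ.+-mono-≤ (width≤size F) (width≤size G))
  width≤size (mul F G)  = ℕ.m≤n⇒m≤1+n (ℕ.+-mono-≤ (width≤size F) (width≤size G))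

  formula⇒permanent : ∀ {p k} → FormulaSize≤ p k → PermanentalComplexity≤ p k
  formula⇒permanent {p} (F , size≤k , value≋p) =
    width F , ℕ.≤-trans (width≤size F) size≤k , M , affine , R.sym (begin
      permanent M    ≈⟨ permanent-perm M ⟩
      perm M  ≈⟨ perm-hessenberg (width F) w (Values.value w) R.refl (Values.value-runs w) ⟩
      Values.value w (width F) ≈⟨ weights-correct F (Values.value w) (Values.value-runs w) ℕ.z≤n (λ _ _ _ _ → ≡.refl) ⟩
      value F ⊗ 1ₚ   ≈⟨ R.*-identityʳ (value F) ⟩
      value F        ≈⟨ value≋p ⟩
      p ∎)
    where
    w = weights F 0 0
    M : Matrix (width F)
    M = hessenberg w (width F)
    affine : ∀ i j → Affine (M i j)
    affine i j = affine-if (toℕ i ≤ᵇ toℕ j) {w (toℕ i) (toℕ j)} (affine-weights F 0 0 (toℕ i) (toℕ j))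
      (affine-if (toℕ i ≡ᵇ suc (toℕ j)) {1ₚ} {0ₚ} affine-1 affine-0)

-- The generating function of nce_d

module ElementarySymmetric (R : CommutativeRing 0ℓ 0ℓ) where

  open import Data.Fin.Base using (zero; suc)
  open CommutativeRing R hiding (zero)
  open Sums R
  open Permanents R using (sum-allFin-suc; Σ<; Σ<-cong; Σ<-0; Σ<-+)
  open import Algebra.Properties.Semiring.Exp semiring public using () renaming (_^_ to _↑_)
  open import Relation.Binary.Reasoning.Setoid setoid

  Mat Column : ℕ → Set
  Mat r    = Fin r → Fin r → Carrier
  Column r = Fin r → Carrier

  _⊞_ _⊠_ : ∀ {r} → Mat r → Mat r → Mat r
  (A ⊞ B) i j = A i j + B i j
  _⊠_ {r} A B i j = sum (map (λ k → A i k * B k j) (allFin r))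

  𝟘 𝟙 : ∀ {r} → Mat r
  𝟘 i j = 0#
  𝟙 i j = if does (i Fin.≟ j) then 1# else 0#

  entrySum : ∀ {r} → Mat r → Carrier
  entrySum {r} A = sum (concatMap (λ i → map (A i) (allFin r)) (allFin r))

  nceMat : ∀ {r} {I : Set} → ℕ → (I → Mat r) → List I → Mat r
  nceMat d X is = foldr _⊞_ 𝟘 (map (λ js → foldr _⊠_ 𝟙 (map X js)) (sublists d is))

  -- The sum of the entries of a matrix is that of its product with the column of ones. Following
  -- columns instead of matrices replaces associativity of the matrix product by composition of
  -- actions.
  act : ∀ {r} → Mat r → Column r → Column r
  act {r} A u i = sum (map (λ k → A i k * u k) (allFin r))

  ones : ∀ {r} → Column r
  ones _ = 1#

  module _ {r : ℕ} where

    act-cong : ∀ (A : Mat r) {u v : Column r} → (∀ k → u k ≈ v k) → ∀ i → act A u i ≈ act A v i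
    act-cong A e i = sum-cong (λ k → *-congˡ (e k)) (allFin r)

    act-⊞ : ∀ (A B : Mat r) u i → act (A ⊞ B) u i ≈ act A u i + act B u i
    act-⊞ A B u i = trans (sum-cong (λ k → distribʳ _ _ _) (allFin r)) (sum-+ _ _ (allFin r))

    act-+ : ∀ (A : Mat r) u v i → act A (λ k → u k + v k) i ≈ act A u i + act A v i
    act-+ A u v i = trans (sum-cong (λ k → distribˡ _ _ _) (allFin r)) (sum-+ _ _ (allFin r))

    act-*ˡ : ∀ a (A : Mat r) u i → act A (λ k → a * u k) i ≈ a * act A u i
    act-*ˡ a A u i = trans (sum-cong (λ k → x*yz≈y*xz _ _ _) (allFin r)) (sum-*ˡ a _ (allFin r))

    act-0 : ∀ (A : Mat r) i → act A (λ _ → 0#) i ≈ 0#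
    act-0 A i = sum-0 (λ k → zeroʳ _) (allFin r)

    act-sum : ∀ {I : Set} (A : Mat r) (u : I → Column r) js i →
      act A (λ k → sum (map (λ j → u j k) js)) i ≈ sum (map (λ j → act A (u j) i) js)
    act-sum A u []       i = act-0 A i
    act-sum A u (j ∷ js) i = trans (act-+ A (u j) _ i) (+-congˡ (act-sum A u js i))

    act-⊠ : ∀ (A B : Mat r) u i → act (A ⊠ B) u i ≈ act A (act B u) i
    act-⊠ A B u i = begin
      sum (map (λ k → sum (map (λ l → A i l * B l k) (allFin r)) * u k) (allFin r))
        ≈⟨ sum-cong (λ k → trans (sym (sum-*ʳ (u k) _ (allFin r)))
             (sum-cong (λ l → *-assoc _ _ _) (allFin r))) (allFin r) ⟩
      sum (map (λ k → sum (map (λ l → A i l * (B l k * u k)) (allFin r))) (allFin r))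
        ≈⟨ sum-swap (λ k l → A i l * (B l k * u k)) (allFin r) (allFin r) ⟩
      sum (map (λ l → sum (map (λ k → A i l * (B l k * u k)) (allFin r))) (allFin r))
        ≈⟨ sum-cong (λ l → sum-*ˡ (A i l) _ (allFin r)) (allFin r) ⟩
      act A (act B u) i ∎

  sum-diagonal : ∀ {r} (u : Column r) i →
    sum (map (λ k → 𝟙 i k * u k) (allFin r)) ≈ u i
  sum-diagonal {suc r} u zero = trans (sum-allFin-suc (λ k → 𝟙 zero k * u k))
    (trans (+-cong (*-identityˡ _) (sum-0 (λ k → zeroˡ _) (allFin r))) (+-identityʳ _))
  sum-diagonal {suc r} u (suc i) = trans (sum-allFin-suc (λ k → 𝟙 (suc i) k * u k))
    (trans (+-cong (zeroˡ _) (sum-diagonal (u ∘ suc) i)) (+-identityˡ _))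

  acts : ∀ {r} → List (Mat r) → Column r → Column r
  acts As u = foldr act u As

  act-prod : ∀ {r} (As : List (Mat r)) u i → act (foldr _⊠_ 𝟙 As) u i ≈ acts As u i
  act-prod []       u i = sum-diagonal u i
  act-prod (A ∷ As) u i = trans (act-⊠ A _ u i) (act-cong A (act-prod As u) i)

  entrySum-act : ∀ {r} (A : Mat r) → entrySum A ≈ sum (map (act A ones) (allFin r))
  entrySum-act {r} A = trans (sum-concatMap (λ i → map (A i) (allFin r)) (allFin r))
    (sum-cong (λ i → sum-cong (λ k → sym (*-identityʳ _)) (allFin r)) (allFin r))

  -- nceColumn d As = nce_d(As) · (1, …, 1)ᵀ
  nceColumn : ∀ {r} → ℕ → List (Mat r) → Column r
  nceColumn zero    As       i = 1#
  nceColumn (suc d) []       i = 0#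
  nceColumn (suc d) (A ∷ As) i = act A (nceColumn d As) i + nceColumn (suc d) As i

  esum : ∀ {r} → ℕ → List (Mat r) → Carrier
  esum {r} d As = sum (map (nceColumn d As) (allFin r))

  module _ {r : ℕ} {I : Set} (X : I → Mat r) where

    act-⊞s : ∀ (Bs : List (Mat r)) u i → act (foldr _⊞_ 𝟘 Bs) u i ≈ sum (map (λ B → act B u i) Bs)
    act-⊞s []       u i = sum-0 (λ k → zeroˡ _) (allFin r)
    act-⊞s (B ∷ Bs) u i = trans (act-⊞ B (foldr _⊞_ 𝟘 Bs) u i) (+-congˡ (act-⊞s Bs u i))

    sublists-column : ∀ d is i →
      sum (map (λ js → acts (map X js) ones i) (sublists d is)) ≈ nceColumn d (map X is) i
    sublists-column zero    is       i = +-identityʳ 1#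
    sublists-column (suc d) []       i = refl
    sublists-column (suc d) (x ∷ is) i = begin
      sum (map f (map (x ∷_) (sublists d is) ++ sublists (suc d) is))
        ≡⟨ ≡.cong sum (map-++ f (map (x ∷_) (sublists d is)) _) ⟩
      sum (map f (map (x ∷_) (sublists d is)) ++ map f (sublists (suc d) is))
        ≈⟨ sum-++ (map f (map (x ∷_) (sublists d is))) _ ⟩
      sum (map f (map (x ∷_) (sublists d is))) + sum (map f (sublists (suc d) is))
        ≈⟨ +-cong first (sublists-column (suc d) is i) ⟩
      act (X x) (nceColumn d (map X is)) i + nceColumn (suc d) (map X is) i ∎
      where
      f : List I → Carrier
      f js = acts (map X js) ones i
      first : sum (map f (map (x ∷_) (sublists d is))) ≈ act (X x) (nceColumn d (map X is)) i
      first = begin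
        sum (map f (map (x ∷_) (sublists d is)))
          ≡⟨ ≡.cong sum (map-∘ (sublists d is)) ⟨
        sum (map (λ js → act (X x) (acts (map X js) ones) i) (sublists d is))
          ≈⟨ act-sum (X x) (λ js → acts (map X js) ones) (sublists d is) i ⟨
        act (X x) (λ k → sum (map (λ js → acts (map X js) ones k) (sublists d is))) i
          ≈⟨ act-cong (X x) (sublists-column d is) i ⟩
        act (X x) (nceColumn d (map X is)) i ∎

    entrySum-nceMat : ∀ d is → entrySum (nceMat d X is) ≈ esum d (map X is)
    entrySum-nceMat d is = trans (entrySum-act (nceMat d X is)) (sum-cong (λ i → begin
      act (nceMat d X is) ones i
        ≈⟨ act-⊞s (map P (sublists d is)) ones i ⟩
      sum (map (λ B → act B ones i) (map P (sublists d is)))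
        ≡⟨ ≡.cong sum (map-∘ (sublists d is)) ⟨
      sum (map (λ js → act (P js) ones i) (sublists d is))
        ≈⟨ sum-cong (λ js → act-prod (map X js) ones i) (sublists d is) ⟩
      sum (map (λ js → acts (map X js) ones i) (sublists d is))
        ≈⟨ sublists-column d is i ⟩
      nceColumn d (map X is) i ∎) (allFin r))
      where
      P : List I → Mat r
      P js = foldr _⊠_ 𝟙 (map X js)

  -- The generating function  ∏ᵢ (1 + t Aᵢ) = Σ_d t^d nce_d(A₁, …, Aₙ)

  shift : ∀ {r} → Carrier → Mat r → Mat r
  shift t A i j = 𝟙 i j + t * A i j

  act-shift : ∀ {r} t (A : Mat r) u i → act (shift t A) u i ≈ u i + t * act A u i
  act-shift {r} t A u i = begin
    act (shift t A) u i ≈⟨ act-⊞ 𝟙 (λ i j → t * A i j) u i ⟩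
    act 𝟙 u i + act (λ i j → t * A i j) u i
      ≈⟨ +-cong (sum-diagonal u i) (trans (sum-cong (λ k → *-assoc _ _ _) (allFin r)) (sum-*ˡ t _ (allFin r))) ⟩
    u i + t * act A u i ∎

  nceColumn-vanishes : ∀ {r} d (As : List (Mat r)) i → length As ℕ.< d → nceColumn d As i ≈ 0#
  nceColumn-vanishes (suc d) []       i _            = refl
  nceColumn-vanishes (suc d) (A ∷ As) i (ℕ.s≤s lt) =
    trans (+-cong (trans (act-cong A (λ k → nceColumn-vanishes d As k lt) i) (act-0 A i))
                  (nceColumn-vanishes (suc d) As i (ℕ.m<n⇒m<1+n lt)))
          (+-identityˡ 0#)

  Σ<-*ˡ : ∀ n a f → Σ< n (λ i → a * f i) ≈ a * Σ< n f
  Σ<-*ˡ zero    a f = sym (zeroʳ a)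
  Σ<-*ˡ (suc n) a f = trans (+-congˡ (Σ<-*ˡ n a (f ∘ suc))) (sym (distribˡ _ _ _))

  act-Σ< : ∀ {r} n (A : Mat r) (u : ℕ → Column r) i →
    act A (λ k → Σ< n (λ e → u e k)) i ≈ Σ< n (λ e → act A (u e) i)
  act-Σ< zero    A u i = act-0 A i
  act-Σ< (suc n) A u i = trans (act-+ A (u 0) _ i) (+-congˡ (act-Σ< n A (u ∘ suc) i))

  Σ<-snoc : ∀ n f → f n ≈ 0# → Σ< (suc n) f ≈ Σ< n f
  Σ<-snoc zero    f e = trans (+-identityʳ _) e
  Σ<-snoc (suc n) f e = +-congˡ (Σ<-snoc n (f ∘ suc) e)

  -- The factor 1 + t A adds to the coefficient of t^(e+1) the image under A of the previous
  -- coefficient of t^e, which is the recursion of `nceColumn`. The range may exceed the number of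
  -- matrices, so that any degree d can be made to occur in the sum.
  generating : ∀ {r} t (As : List (Mat r)) n i → length As ℕ.≤ n →
    acts (map (shift t) As) ones i ≈ Σ< (suc n) (λ e → t ↑ e * nceColumn e As i)
  generating t [] n i _ =
    sym (trans (+-cong (*-identityʳ 1#) (Σ<-0 n (λ e → zeroʳ _))) (+-identityʳ 1#))
  generating {r} t (A ∷ As) (suc n) i (ℕ.s≤s le) = begin
    act (shift t A) (acts (map (shift t) As) ones) i
      ≈⟨ act-shift t A _ i ⟩
    acts (map (shift t) As) ones i + t * act A (acts (map (shift t) As) ones) i
      ≈⟨ +-cong
           -- A vanishing term of degree `suc n` is appended to the first sum; once its degree 0
           -- term is split off, both sums have `suc n` terms and can be added degree by degree.
           (trans (generating t As n i le) (sym (Σ<-snoc (suc n) (λ e → t ↑ e * nceColumn e As i)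
             (trans (*-congˡ (nceColumn-vanishes (suc n) As i (ℕ.s≤s le))) (zeroʳ _)))))
           (*-congˡ (trans (act-cong A (λ k → generating t As n k le) i)
             (act-Σ< (suc n) A (λ e k → t ↑ e * nceColumn e As k) i))) ⟩
    (1# * 1# + Σ< (suc n) lower) + t * Σ< (suc n) upper
      ≈⟨ +-assoc _ _ _ ⟩
    1# * 1# + (Σ< (suc n) lower + t * Σ< (suc n) upper)
      ≈⟨ +-congˡ (+-congˡ (sym (Σ<-*ˡ (suc n) t upper))) ⟩
    1# * 1# + (Σ< (suc n) lower + Σ< (suc n) (λ e → t * upper e))
      ≈⟨ +-congˡ (sym (Σ<-+ (suc n) lower (λ e → t * upper e))) ⟩
    1# * 1# + Σ< (suc n) (λ e → lower e + t * upper e)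
      ≈⟨ +-congˡ (Σ<-cong (suc n) (λ e _ → collect e)) ⟩
    1# * 1# + Σ< (suc n) (λ e → t ↑ suc e * nceColumn (suc e) (A ∷ As) i) ∎
    where
    lower : ℕ → Carrier
    lower e = t ↑ suc e * nceColumn (suc e) As i
    upper : ℕ → Carrier
    upper e = act A (λ k → t ↑ e * nceColumn e As k) i
    collect : ∀ e → lower e + t * upper e
                  ≈ t ↑ suc e * nceColumn (suc e) (A ∷ As) i
    collect e = begin
      lower e + t * upper e
        ≈⟨ +-congˡ (trans (*-congˡ (act-*ˡ (t ↑ e) A (nceColumn e As) i)) (sym (*-assoc _ _ _))) ⟩
      t ↑ suc e * nceColumn (suc e) As i + t ↑ suc e * act A (nceColumn e As) i
        ≈⟨ trans (+-comm _ _) (sym (distribˡ _ _ _)) ⟩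
      t ↑ suc e * nceColumn (suc e) (A ∷ As) i ∎

  sum-Σ< : ∀ {I : Set} n (f : I → ℕ → Carrier) is →
    sum (map (λ i → Σ< n (f i)) is) ≈ Σ< n (λ e → sum (map (λ i → f i e) is))
  sum-Σ< zero    f is = sum-0 (λ _ → refl) is
  sum-Σ< (suc n) f is = trans (sum-+ (λ i → f i 0) _ is) (+-congˡ (sum-Σ< n (λ i → f i ∘ suc) is))

  generating-sum : ∀ {r} t (As : List (Mat r)) n → length As ℕ.≤ n →
    sum (map (acts (map (shift t) As) ones) (allFin r)) ≈ Σ< (suc n) (λ e → t ↑ e * esum e As)
  generating-sum {r} t As n le = begin
    sum (map (acts (map (shift t) As) ones) (allFin r))
      ≈⟨ sum-cong (λ i → generating t As n i le) (allFin r) ⟩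
    sum (map (λ i → Σ< (suc n) (λ e → t ↑ e * nceColumn e As i)) (allFin r))
      ≈⟨ sum-Σ< (suc n) (λ i e → t ↑ e * nceColumn e As i) (allFin r) ⟩
    Σ< (suc n) (λ e → sum (map (λ i → t ↑ e * nceColumn e As i) (allFin r)))
      ≈⟨ Σ<-cong (suc n) (λ e _ → sum-*ˡ (t ↑ e) (nceColumn e As) (allFin r)) ⟩
    Σ< (suc n) (λ e → t ↑ e * esum e As) ∎

-- Interpolation at powers of two

module Interpolation (K : CommutativeRing 0ℓ 0ℓ) where

  open CommutativeRing K hiding (zero) renaming (Carrier to Scalar)
  open import Algebra.Properties.Ring ring using (-‿distribˡ-*; -‿distribʳ-*; -‿involutive; -‿+-comm)
  open Sums K using (x*yz≈y*xz)
  open ElementarySymmetric K using (_↑_)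
  private module M = SemiringMult semiring
  open import Relation.Binary.Reasoning.Setoid setoid

  -- The ring contains ℚ.
  Divisible : Set
  Divisible = ∀ n → ∃[ u ] u * (suc n M.× 1#) ≈ 1#

  two : Scalar
  two = 1# + 1#

  two↑ : ∀ e → (2 ℕ.^ e) M.× 1# ≈ two ↑ e
  two↑ zero    = +-identityʳ 1#
  two↑ (suc e) = begin
    (2 ℕ.* 2 ℕ.^ e) M.× 1#  ≈⟨ M.×1-homo-* 2 (2 ℕ.^ e) ⟩
    (2 M.× 1#) * ((2 ℕ.^ e) M.× 1#)   ≈⟨ *-cong (+-congˡ (+-identityʳ 1#)) (two↑ e) ⟩
    two ↑ suc e ∎

  module _ (divisible : Divisible) where

    difference-invertible-< : ∀ {e d} → e ℕ.< d → ∃[ u ] u * (two ↑ d + - two ↑ e) ≈ 1#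
    difference-invertible-< {e} {d} e<d = u , (begin
      u * (two ↑ d + - two ↑ e)
        ≈⟨ *-congˡ (+-cong (two↑ d) (-‿cong (two↑ e))) ⟨
      u * (((2 ℕ.^ d) M.× 1#) + - ((2 ℕ.^ e) M.× 1#))
        ≡⟨ ≡.cong (λ m → u * ((m M.× 1#) + - ((2 ℕ.^ e) M.× 1#))) 2^d ⟩
      u * (((suc r ℕ.+ 2 ℕ.^ e) M.× 1#) + - ((2 ℕ.^ e) M.× 1#))
        ≈⟨ *-congˡ (+-congʳ (M.×-homo-+ 1# (suc r) (2 ℕ.^ e))) ⟩
      u * ((suc r M.× 1#) + ((2 ℕ.^ e) M.× 1#) + - ((2 ℕ.^ e) M.× 1#))
        ≈⟨ *-congˡ (trans (+-assoc _ _ _) (trans (+-congˡ (-‿inverseʳ _)) (+-identityʳ _))) ⟩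
      u * (suc r M.× 1#)
        ≈⟨ proj₂ (divisible r) ⟩
      1# ∎)
      where
      r = 2 ℕ.^ d ℕ.∸ suc (2 ℕ.^ e)
      u = proj₁ (divisible r)
      2^d : 2 ℕ.^ d ≡ suc r ℕ.+ 2 ℕ.^ e
      2^d = ≡.trans (≡.sym (ℕ.m∸n+n≡m (ℕ.^-monoʳ-< 2 (ℕ.s≤s (ℕ.s≤s ℕ.z≤n)) e<d))) (ℕ.+-suc r (2 ℕ.^ e))

    difference-invertible : ∀ {e d} → e ≢ d → ∃[ u ] u * (two ↑ d + - two ↑ e) ≈ 1#
    difference-invertible {e} {d} e≢d with ℕ.<-cmp e d
    ... | tri< e<d _ _ = difference-invertible-< e<d
    ... | tri≈ _ e≡d _ = contradiction e≡d e≢d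
    ... | tri> _ _ d<e with difference-invertible-< d<e
    ...   | u , p = - u , trans (trans (sym (-‿distribˡ-* u _)) (-‿distribʳ-* u _))
              (trans (*-congˡ (trans (sym (-‿+-comm _ _))
                (trans (+-congˡ (-‿involutive _)) (+-comm _ _)))) p)

  horner : List Scalar → Scalar → Scalar
  horner []       x = 0#
  horner (c ∷ cs) x = c + x * horner cs x

  module _ (u v : Scalar) where

    -- The coefficient list of a + (u x + v) c(x), where c has the coefficients `cs`: each
    -- coefficient contributes v times itself to its own degree and hands u times itself on to the
    -- next as the new `a`.
    carry : Scalar → List Scalar → List Scalar
    carry a []       = a ∷ []
    carry a (c ∷ cs) = (a + v * c) ∷ carry (u * c) cs

    length-carry : ∀ a cs → length (carry a cs) ≡ suc (length cs)
    length-carry a []       = ≡.refl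
    length-carry a (c ∷ cs) = ≡.cong suc (length-carry (u * c) cs)

    horner-carry : ∀ a cs x → horner (carry a cs) x ≈ a + (u * x + v) * horner cs x
    horner-carry a []       x = +-congˡ (trans (zeroʳ x) (sym (zeroʳ _)))
    horner-carry a (c ∷ cs) x = begin
      (a + v * c) + x * horner (carry (u * c) cs) x
        ≈⟨ +-congˡ (*-congˡ (horner-carry (u * c) cs x)) ⟩
      (a + v * c) + x * (u * c + m * h)
        ≈⟨ +-assoc _ _ _ ⟩
      a + (v * c + x * (u * c + m * h))
        ≈⟨ +-congˡ (+-congˡ (trans (distribˡ _ _ _) (+-cong xuc (x*yz≈y*xz x m h)))) ⟩
      a + (v * c + (u * x * c + m * (x * h)))
        ≈⟨ +-congˡ (+-assoc _ _ _) ⟨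
      a + ((v * c + u * x * c) + m * (x * h))
        ≈⟨ +-congˡ (+-congʳ (trans (+-comm _ _) (sym (distribʳ _ _ _)))) ⟩
      a + (m * c + m * (x * h))
        ≈⟨ +-congˡ (distribˡ _ _ _) ⟨
      a + m * (c + x * h) ∎
      where
      m = u * x + v
      h = horner cs x
      xuc : x * (u * c) ≈ u * x * c
      xuc = trans (x*yz≈y*xz x u c) (sym (*-assoc u x c))

  -- Interpolation is used in transposed form. Evaluating Σ_e t^e a_e at t = 2^j and combining the
  -- values with weights c_j gives Σ_e c(2^e) a_e, where c(x) = Σ_j c_j x^j. So weights that isolate
  -- a_d are the coefficients of the polynomial that is 1 at 2^d and 0 at the other nodes 2^e.
  record Lagrange (d n : ℕ) : Set where
    field
      coeffs   : List Scalar
      length≤  : length coeffs ℕ.≤ suc n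
      vanishes : ∀ e → e ℕ.< n → e ≢ d → horner coeffs (two ↑ e) ≈ 0#
      unit     : horner coeffs (two ↑ d) ≈ 1#

  -- The Lagrange polynomial with nodes 2^e, built one node at a time.
  lagrange : Divisible → ∀ d n → Lagrange d n
  lagrange divisible d zero = record
    { coeffs   = 1# ∷ []
    ; length≤  = ℕ.≤-refl
    ; vanishes = λ _ ()
    ; unit     = trans (+-congˡ (zeroʳ _)) (+-identityʳ 1#)
    }
  lagrange divisible d (suc n) with n ℕ.≟ d
  ... | yes ≡.refl = let open Lagrange (lagrange divisible d n) in record
    { coeffs   = coeffs
    ; length≤  = ℕ.m≤n⇒m≤1+n length≤
    ; vanishes = λ { e (ℕ.s≤s e≤n) e≢d → vanishes e (ℕ.≤∧≢⇒< e≤n e≢d) e≢d }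
    ; unit     = unit
    }
  ... | no n≢d = record
    { coeffs   = carry u v 0# L.coeffs
    ; length≤  = ℕ.≤-trans (ℕ.≤-reflexive (length-carry u v 0# L.coeffs)) (ℕ.s≤s L.length≤)
    ; vanishes = vanish
    ; unit     = begin
        horner (carry u v 0# L.coeffs) (two ↑ d)  ≈⟨ horner-L d ⟩
        (u * two ↑ d + v) * horner L.coeffs (two ↑ d)    ≈⟨ *-cong unit-factor L.unit ⟩
        1# * 1#  ≈⟨ *-identityʳ 1# ⟩
        1# ∎
    }
    where
    module L = Lagrange (lagrange divisible d n)
    invert = difference-invertible divisible n≢d
    -- The new factor u x + v is (x - 2^n) / (2^d - 2^n): it is 0 at the new node and 1 at 2^d.
    u = proj₁ invert
    v = u * - two ↑ n
    horner-L : ∀ e → horner (carry u v 0# L.coeffs) (two ↑ e) ≈ (u * two ↑ e + v) * horner L.coeffs (two ↑ e)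
    horner-L e = trans (horner-carry u v 0# L.coeffs (two ↑ e)) (+-identityˡ _)
    unit-factor : u * two ↑ d + v ≈ 1#
    unit-factor = trans (sym (distribˡ u _ _)) (proj₂ invert)
    vanish : ∀ e → e ℕ.< suc n → e ≢ d → horner (carry u v 0# L.coeffs) (two ↑ e) ≈ 0#
    vanish e (ℕ.s≤s e≤n) e≢d with ℕ.m≤n⇒m<n∨m≡n e≤n
    ... | inj₁ e<n    = trans (horner-L e) (trans (*-congˡ (L.vanishes e e<n e≢d)) (zeroʳ _))
    ... | inj₂ ≡.refl = trans (horner-L e) (trans (*-congʳ (trans (sym (distribˡ u _ _))
                          (trans (*-congˡ (-‿inverseʳ _)) (zeroʳ u)))) (zeroˡ _))

-- Small formulas for nce_d of affine matrices

module SmallFormulas (K : CommutativeRing 0ℓ 0ℓ) where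

  open CommutativeRing K hiding (zero) renaming (Carrier to Scalar)
  open Polynomials K
  open PolynomialRing K
  open SkewPrograms K using (affine-⊕; affine-if; affine-0; affine-1; terms-affine)
  open Interpolation K
  private
    module R = CommutativeRing polyRing
    module N = ElementarySymmetric polyRing
    module S = Sums polyRing
  open ElementarySymmetric K using (_↑_)
  open Permanents polyRing using (Σ<; Σ<-cong; Σ<-0; Σ<-+; Σ<-single)
  open import Relation.Binary.Reasoning.Setoid R.setoid

  affine-const : ∀ c → Affine (const c)
  affine-const c = terms-affine (const c) (ℕ.z≤n ∷ [])

  affine-const-⊗ : ∀ c p → Affine p → Affine (const c ⊗ p)
  affine-const-⊗ c p h μ lt = trans (coeff-const-⊗ c p μ) (trans (*-congˡ (h μ lt)) (zeroʳ c))

  constF : Scalar → Formula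
  constF c = leaf (const c) (affine-const c)

  sumF : List Formula → Formula
  sumF = foldr add (leaf 0ₚ affine-0)

  value-sumF : ∀ {I : Set} (F : I → Formula) is → value (sumF (map F is)) ≡ ∑ (map (λ i → value (F i)) is)
  value-sumF F []       = ≡.refl
  value-sumF F (i ∷ is) = ≡.cong (value (F i) ⊕_) (value-sumF F is)

  size-sumF : ∀ {I : Set} (F : I → Formula) is {s} → (∀ i → size (F i) ℕ.≤ s) →
    size (sumF (map F is)) ℕ.≤ suc (length is ℕ.* suc s)
  size-sumF F []           h = ℕ.≤-refl
  size-sumF F (i ∷ is) {s} h = ℕ.s≤s (ℕ.≤-trans (ℕ.+-mono-≤ (h i) (size-sumF F is h))
    (ℕ.≤-reflexive (ℕ.+-suc s _)))

  FMat : Set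
  FMat = Fin 3 → Fin 3 → Formula

  valueₘ : FMat → Matrix 3
  valueₘ F i j = value (F i j)

  mulₘ : FMat → FMat → FMat
  mulₘ F G i j = sumF (map (λ k → mul (F i k) (G k j)) (allFin 3))

  idₘ : FMat
  idₘ i j = leaf (N.𝟙 i j) (affine-if (does (i Fin.≟ j)) {1ₚ} {0ₚ} affine-1 affine-0)

  -- A balanced product of at most 2^k factors. An entry of a product of two matrices uses six
  -- entries of the factors, and a formula has to copy them; this stays polynomial in the number of
  -- factors because there are only k levels.
  prodₘ : ℕ → List FMat → FMat
  prodₘ zero    []       = idₘ
  prodₘ zero    (F ∷ _)  = F
  prodₘ (suc k) Fs       = mulₘ (prodₘ k (take (2 ℕ.^ k) Fs)) (prodₘ k (drop (2 ℕ.^ k) Fs))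

  act-≡ : ∀ {A B : Matrix 3} → (∀ i j → A i j ≡ B i j) → ∀ u i → N.act A u i ≋ N.act B u i
  act-≡ e u i = S.sum-cong (λ k → R.*-congʳ {u k} (R.reflexive (e i k))) (allFin 3)

  -- Compared as actions on columns, the balanced product and the iterated one differ only by a
  -- splitting of the list, which `foldr-++` absorbs. The bound on the length ensures that nothing
  -- is dropped at level 0.
  act-prodₘ : ∀ k Fs u i → length Fs ℕ.≤ 2 ℕ.^ k →
    N.act (valueₘ (prodₘ k Fs)) u i ≋ N.acts (map valueₘ Fs) u i
  act-prodₘ zero    []           u i _ = N.sum-diagonal u i
  act-prodₘ zero    (F ∷ [])     u i _ = R.refl
  act-prodₘ zero    (F ∷ G ∷ Fs) u i (ℕ.s≤s ())
  act-prodₘ (suc k) Fs           u i le = begin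
    N.act (valueₘ (mulₘ (prodₘ k Gs) (prodₘ k Hs))) u i
      ≈⟨ act-≡ {B = valueₘ (prodₘ k Gs) N.⊠ valueₘ (prodₘ k Hs)}
           (λ i j → value-sumF (λ l → mul (prodₘ k Gs i l) (prodₘ k Hs l j)) (allFin 3)) u i ⟩
    N.act (valueₘ (prodₘ k Gs) N.⊠ valueₘ (prodₘ k Hs)) u i
      ≈⟨ N.act-⊠ (valueₘ (prodₘ k Gs)) (valueₘ (prodₘ k Hs)) u i ⟩
    N.act (valueₘ (prodₘ k Gs)) (N.act (valueₘ (prodₘ k Hs)) u) i
      ≈⟨ N.act-cong (valueₘ (prodₘ k Gs)) (λ l → act-prodₘ k Hs u l lengthH) i ⟩
    N.act (valueₘ (prodₘ k Gs)) (N.acts (map valueₘ Hs) u) i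
      ≈⟨ act-prodₘ k Gs (N.acts (map valueₘ Hs) u) i lengthG ⟩
    N.acts (map valueₘ Gs) (N.acts (map valueₘ Hs) u) i
      ≡⟨ ≡.cong (λ f → f i) (foldr-++ N.act u (map valueₘ Gs) (map valueₘ Hs)) ⟨
    N.acts (map valueₘ Gs ++ map valueₘ Hs) u i
      ≡⟨ ≡.cong (λ As → N.acts As u i) (≡.trans (≡.sym (map-++ valueₘ Gs Hs))
           (≡.cong (map valueₘ) (take++drop≡id (2 ℕ.^ k) Fs))) ⟩
    N.acts (map valueₘ Fs) u i ∎
    where
    Gs = take (2 ℕ.^ k) Fs
    Hs = drop (2 ℕ.^ k) Fs
    lengthG : length Gs ℕ.≤ 2 ℕ.^ k
    lengthG = ℕ.≤-trans (ℕ.≤-reflexive (length-take (2 ℕ.^ k) Fs)) (ℕ.m⊓n≤m _ _)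
    lengthH : length Hs ℕ.≤ 2 ℕ.^ k
    lengthH = ℕ.≤-trans (ℕ.≤-reflexive (length-drop (2 ℕ.^ k) Fs))
      (ℕ.m≤n+o⇒m∸n≤o _ (2 ℕ.^ k) (ℕ.≤-trans le (ℕ.≤-reflexive (≡.cong (2 ℕ.^ k ℕ.+_) (ℕ.+-identityʳ _)))))

  -- One level turns entries of size s into entries of size at most 6 s + 7. The summand 2 makes the
  -- recursion multiplicative: 2 + (6 s + 7) ≤ 6 (2 + s). The factor 3 is the case of a single leaf.
  size-prodₘ : ∀ k Fs → All (λ F → ∀ i j → size (F i j) ≡ 1) Fs →
    ∀ i j → 2 ℕ.+ size (prodₘ k Fs i j) ℕ.≤ 3 ℕ.* 6 ℕ.^ k
  size-prodₘ zero    []       []       i j = ℕ.≤-refl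
  size-prodₘ zero    (F ∷ Fs) (h ∷ _)  i j = ℕ.≤-reflexive (≡.cong (2 ℕ.+_) (h i j))
  size-prodₘ (suc k) Fs       hs       i j = ℕ.≤-trans
    (ℕ.+-monoʳ-≤ 2 (size-sumF (λ l → mul (prodₘ k (take (2 ℕ.^ k) Fs) i l) (prodₘ k (drop (2 ℕ.^ k) Fs) l j)) (allFin 3)
      (λ l → ℕ.s≤s (ℕ.+-mono-≤ (bound _ (All.take⁺ (2 ℕ.^ k) hs) i l) (bound _ (All.drop⁺ (2 ℕ.^ k) hs) l j)))))
    (ℕ.≤-trans (ℕ.m≤n+m _ 3) (ℕ.≤-reflexive
      (≡.trans (solve 1 (λ s → con 3 :+ (con 2 :+ (con 1 :+ con 3 :* (con 1 :+ (con 1 :+ (s :+ s))))) := con 6 :* (con 2 :+ s)) ≡.refl S)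
        (≡.trans (≡.cong (6 ℕ.*_) 2+S)
          (solve 1 (λ x → con 6 :* (con 3 :* x) := con 3 :* (con 6 :* x)) ≡.refl (6 ℕ.^ k))))))
    where
    open ℕ-Solver using (solve; _:+_; _:*_; _:=_; con)
    S = 3 ℕ.* 6 ℕ.^ k ℕ.∸ 2
    2+S : 2 ℕ.+ S ≡ 3 ℕ.* 6 ℕ.^ k
    2+S = ℕ.m+[n∸m]≡n (ℕ.≤-trans (ℕ.s≤s (ℕ.s≤s ℕ.z≤n)) (ℕ.*-monoʳ-≤ 3 (ℕ.m^n>0 6 k)))
    bound : ∀ Gs → All (λ F → ∀ i j → size (F i j) ≡ 1) Gs → ∀ i j → size (prodₘ k Gs i j) ℕ.≤ S
    bound Gs h i j = ℕ.+-cancelˡ-≤ 2 _ _ (ℕ.≤-trans (size-prodₘ k Gs h i j) (ℕ.≤-reflexive (≡.sym 2+S)))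

  AffineMatrix : Set
  AffineMatrix = ∃ λ (A : Matrix 3) → ∀ i j → Affine (A i j)

  module _ (As : List AffineMatrix) (k : ℕ) (length≤ : length As ℕ.≤ 2 ℕ.^ k) where

    private
      mats : List (Matrix 3)
      mats = map proj₁ As

    shiftF : Scalar → AffineMatrix → FMat
    shiftF t (A , h) i j = leaf (N.shift (const t) A i j)
      (affine-⊕ {N.𝟙 i j} {const t ⊗ A i j} (affine-if (does (i Fin.≟ j)) {1ₚ} {0ₚ} affine-1 affine-0)
        (affine-const-⊗ t (A i j) (h i j)))

    productF : Scalar → Formula
    productF t = sumF (map (λ i → sumF (map (prodₘ k (map (shiftF t) As) i) (allFin 3))) (allFin 3))

    value-productF : ∀ t n → length As ℕ.≤ n →
      value (productF t) ≋ Σ< (suc n) (λ e → const t N.↑ e ⊗ N.esum e mats)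
    value-productF t n le = begin
      value (productF t)
        ≡⟨ value-sumF (λ i → sumF (map (M i) (allFin 3))) (allFin 3) ⟩
      ∑ (map (λ i → value (sumF (map (M i) (allFin 3)))) (allFin 3))
        ≈⟨ S.sum-cong (λ i → R.trans (R.reflexive (value-sumF (M i) (allFin 3)))
             (S.sum-cong (λ j → R.sym (R.*-identityʳ (value (M i j)))) (allFin 3))) (allFin 3) ⟩
      ∑ (map (N.act (valueₘ M) N.ones) (allFin 3))
        ≈⟨ S.sum-cong (λ i → act-prodₘ k (map (shiftF t) As) N.ones i
             (ℕ.≤-trans (ℕ.≤-reflexive (length-map _ As)) length≤)) (allFin 3) ⟩
      ∑ (map (N.acts (map valueₘ (map (shiftF t) As)) N.ones) (allFin 3))
        ≡⟨ ≡.cong (λ Bs → ∑ (map (N.acts Bs N.ones) (allFin 3)))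
             (≡.trans (≡.sym (map-∘ As)) (map-∘ As)) ⟩
      ∑ (map (N.acts (map (N.shift (const t)) mats) N.ones) (allFin 3))
        ≈⟨ N.generating-sum (const t) mats n (ℕ.≤-trans (ℕ.≤-reflexive (length-map _ As)) le) ⟩
      Σ< (suc n) (λ e → const t N.↑ e ⊗ N.esum e mats) ∎
      where M = prodₘ k (map (shiftF t) As)

    productSize : ℕ
    productSize = suc (3 ℕ.* suc (suc (3 ℕ.* suc (3 ℕ.* 6 ℕ.^ k))))

    size-productF : ∀ t → size (productF t) ℕ.≤ productSize
    size-productF t = size-sumF (λ i → sumF (map (M i) (allFin 3))) (allFin 3)
      (λ i → size-sumF (M i) (allFin 3) (λ j → ℕ.≤-trans (ℕ.m≤n+m _ 2)
        (size-prodₘ k (map (shiftF t) As) (All.map⁺ (All.universal (λ _ _ _ → ≡.refl) As)) i j)))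
      where M = prodₘ k (map (shiftF t) As)

    -- This is Σ_j c_j P(2^j t) with P(t) the entry sum of ∏ (1 + t Aᵢ); the argument doubles from
    -- one coefficient to the next. The component of degree e is thereby multiplied by Σ_j c_j 2^(j
    -- e), the value of `horner cs` at 2^e.
    hornerF : List Scalar → Scalar → Formula
    hornerF []       t = leaf 0ₚ affine-0
    hornerF (c ∷ cs) t = add (mul (constF c) (productF t)) (hornerF cs (two * t))

    size-hornerF : ∀ cs t → size (hornerF cs t) ℕ.≤ suc (length cs ℕ.* (3 ℕ.+ productSize))
    size-hornerF []       t = ℕ.≤-refl
    size-hornerF (c ∷ cs) t = ℕ.≤-trans
      (ℕ.+-mono-≤ (ℕ.+-monoʳ-≤ 3 (size-productF t)) (size-hornerF cs (two * t)))
      (ℕ.≤-reflexive (ℕ.+-suc (3 ℕ.+ productSize) _))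

    value-hornerF : ∀ n → length As ℕ.≤ n → ∀ cs t → value (hornerF cs t) ≋
      Σ< (suc n) (λ e → const t N.↑ e ⊗ (const (horner cs (two ↑ e)) ⊗ N.esum e mats))
    value-hornerF n le []       t = R.sym (Σ<-0 (suc n) (λ e → R.trans
      (R.*-congˡ {const t N.↑ e} (R.trans (R.*-congʳ {N.esum e mats} const-0) (R.zeroˡ (N.esum e mats))))
      (R.zeroʳ (const t N.↑ e))))
    value-hornerF n le (c ∷ cs) t = begin
      const c ⊗ value (productF t) ⊕ value (hornerF cs (two * t))
        ≈⟨ R.+-cong (R.*-congˡ {const c} (value-productF t n le)) (value-hornerF n le cs (two * t)) ⟩
      const c ⊗ Σ< (suc n) (λ e → const t N.↑ e ⊗ a e) ⊕ Σ< (suc n) (λ e → const (two * t) N.↑ e ⊗ (h e ⊗ a e))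
        ≈⟨ R.+-congʳ (N.Σ<-*ˡ (suc n) (const c) (λ e → const t N.↑ e ⊗ a e)) ⟨
      Σ< (suc n) (λ e → const c ⊗ (const t N.↑ e ⊗ a e)) ⊕ Σ< (suc n) (λ e → const (two * t) N.↑ e ⊗ (h e ⊗ a e))
        ≈⟨ Σ<-+ (suc n) (λ e → const c ⊗ (const t N.↑ e ⊗ a e)) (λ e → const (two * t) N.↑ e ⊗ (h e ⊗ a e)) ⟨
      Σ< (suc n) (λ e → const c ⊗ (const t N.↑ e ⊗ a e) ⊕ const (two * t) N.↑ e ⊗ (h e ⊗ a e))
        ≈⟨ Σ<-cong (suc n) (λ e _ → collect e) ⟩
      Σ< (suc n) (λ e → const t N.↑ e ⊗ (const (horner (c ∷ cs) (two ↑ e)) ⊗ a e)) ∎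
      where
      a h : ℕ → Poly
      a e = N.esum e mats
      h e = const (horner cs (two ↑ e))
      scaled : ∀ e → const (two * t) N.↑ e ≋ const t N.↑ e ⊗ const (two ↑ e)
      scaled zero    = R.sym (R.*-identityʳ 1ₚ)
      scaled (suc e) = begin
        const (two * t) ⊗ const (two * t) N.↑ e
          ≈⟨ R.*-cong (R.trans (const-* two t) (R.*-comm (const two) (const t))) (scaled e) ⟩
        (const t ⊗ const two) ⊗ (const t N.↑ e ⊗ const (two ↑ e))
          ≈⟨ S.*-interchange (const t) (const two) (const t N.↑ e) (const (two ↑ e)) ⟩
        (const t ⊗ const t N.↑ e) ⊗ (const two ⊗ const (two ↑ e)) ∎
      collect : ∀ e → const c ⊗ (const t N.↑ e ⊗ a e) ⊕ const (two * t) N.↑ e ⊗ (h e ⊗ a e)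
                    ≋ const t N.↑ e ⊗ (const (horner (c ∷ cs) (two ↑ e)) ⊗ a e)
      collect e = begin
        const c ⊗ (T ⊗ a e) ⊕ const (two * t) N.↑ e ⊗ (h e ⊗ a e)
          ≈⟨ R.+-cong (S.x*yz≈y*xz (const c) T (a e)) (R.*-congʳ {h e ⊗ a e} (scaled e)) ⟩
        T ⊗ (const c ⊗ a e) ⊕ (T ⊗ const (two ↑ e)) ⊗ (h e ⊗ a e)
          ≈⟨ R.+-congˡ {T ⊗ (const c ⊗ a e)} (R.*-assoc T (const (two ↑ e)) (h e ⊗ a e)) ⟩
        T ⊗ (const c ⊗ a e) ⊕ T ⊗ (const (two ↑ e) ⊗ (h e ⊗ a e))
          ≈⟨ R.distribˡ T (const c ⊗ a e) (const (two ↑ e) ⊗ (h e ⊗ a e)) ⟨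
        T ⊗ (const c ⊗ a e ⊕ const (two ↑ e) ⊗ (h e ⊗ a e))
          ≈⟨ R.*-congˡ {T} (R.+-congˡ {const c ⊗ a e} (R.trans (R.sym (R.*-assoc (const (two ↑ e)) (h e) (a e)))
               (R.*-congʳ {a e} (R.sym (const-* (two ↑ e) (horner cs (two ↑ e))))))) ⟩
        T ⊗ (const c ⊗ a e ⊕ const (two ↑ e * horner cs (two ↑ e)) ⊗ a e)
          ≈⟨ R.*-congˡ {T} (R.distribʳ (a e) (const c) (const (two ↑ e * horner cs (two ↑ e)))) ⟨
        T ⊗ ((const c ⊕ const (two ↑ e * horner cs (two ↑ e))) ⊗ a e)
          ≈⟨ R.*-congˡ {T} (R.*-congʳ {a e} (const-+ c (two ↑ e * horner cs (two ↑ e)))) ⟨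
        T ⊗ (const (horner (c ∷ cs) (two ↑ e)) ⊗ a e) ∎
        where T = const t N.↑ e

    esum-formula : Divisible → ∀ d → FormulaSize≤ (N.esum d mats)
      (suc ((3 ℕ.+ (length As ℕ.+ d)) ℕ.* (3 ℕ.+ productSize)))
    esum-formula divisible d = hornerF L.coeffs 1# ,
      ℕ.≤-trans (size-hornerF L.coeffs 1#) (ℕ.s≤s (ℕ.*-monoˡ-≤ (3 ℕ.+ productSize)
        (ℕ.≤-trans L.length≤ (ℕ.n≤1+n _)))) ,
      (begin
        value (hornerF L.coeffs 1#)
          ≈⟨ value-hornerF n (ℕ.m≤m+n _ d) L.coeffs 1# ⟩
        Σ< (suc n) (λ e → 1ₚ N.↑ e ⊗ (const (horner L.coeffs (two ↑ e)) ⊗ N.esum e mats))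
          ≈⟨ Σ<-cong (suc n) (λ e _ → R.trans (R.*-congʳ {const (horner L.coeffs (two ↑ e)) ⊗ N.esum e mats} (one-↑ e))
               (R.*-identityˡ (const (horner L.coeffs (two ↑ e)) ⊗ N.esum e mats))) ⟩
        Σ< (suc n) (λ e → const (horner L.coeffs (two ↑ e)) ⊗ N.esum e mats)
          ≈⟨ Σ<-single (λ e → const (horner L.coeffs (two ↑ e)) ⊗ N.esum e mats) (ℕ.s≤s (ℕ.m≤n+m d _))
               (λ e lt e≢d → R.trans (R.*-congʳ {N.esum e mats} (R.trans (const-cong (L.vanishes e lt e≢d)) const-0))
                               (R.zeroˡ (N.esum e mats))) ⟩
        const (horner L.coeffs (two ↑ d)) ⊗ N.esum d mats
          ≈⟨ R.trans (R.*-congʳ {N.esum d mats} (const-cong L.unit)) (R.*-identityˡ (N.esum d mats)) ⟩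
        N.esum d mats ∎)
      where
      -- Adding `d` puts 2^d among the nodes and degree d into the range of the sum, even if d
      -- exceeds the number of matrices.
      n = length As ℕ.+ d
      module L = Lagrange (lagrange divisible d (suc n))
      one-↑ : ∀ e → 1ₚ N.↑ e ≋ 1ₚ
      one-↑ zero    = R.refl
      one-↑ (suc e) = R.trans (R.*-congˡ {1ₚ} (one-↑ e)) (R.*-identityˡ 1ₚ)

-- Homogeneity, and substitutions into `per` and `nce₃`

module Projections (K : CommutativeRing 0ℓ 0ℓ) where

  open CommutativeRing K hiding (zero) renaming (Carrier to Scalar)
  open Polynomials K
  open PolynomialRing K
  open SkewPrograms K using (affine-⊕; affine-0)
  open SmallFormulas K
  open Interpolation K using (Divisible)
  private
    module R = CommutativeRing polyRing
    module N = ElementarySymmetric polyRing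
    module S = Sums polyRing
  open import Relation.Binary.Reasoning.Setoid R.setoid

  -- Homogeneous polynomials in x₀, …, x_{k-1}

  Word : (d k : ℕ) → Monomial → Set
  Word d k μ = length μ ≡ d × All (ℕ._< k) μ

  word-++ : ∀ {d e k μ ν} → Word d k μ → Word e k ν → Word (d ℕ.+ e) k (μ ++ ν)
  word-++ {μ = μ} (p , h) (q , g) = ≡.trans (length-++ μ) (≡.cong₂ ℕ._+_ p q) , All.++⁺ h g

  word-↭ : ∀ {d k μ ν} → μ ↭ ν → Word d k μ → Word d k ν
  word-↭ π (p , h) = ≡.trans (≡.sym (↭-length π)) p , All-resp-↭ π h

  word-coeff : ∀ {d k} p {μ} → Terms (Word d k) p → ¬ Word d k μ → coeff p μ ≈ 0#
  word-coeff p h ¬w = terms-coeff p h (λ ν↭μ w → ¬w (word-↭ ν↭μ w))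

  word-∈ : ∀ {d k} p → Terms (Word d k) p → p ∈[ k ]
  word-∈ p h μ i i∈μ k≤i = word-coeff p h (λ w → ℕ.<⇒≱ (All.lookup (proj₂ w) i∈μ) k≤i)

  word-∏ : ∀ {k} {I : Set} {f : I → Poly} {is} → All (λ i → Terms (Word 1 k) (f i)) is →
    Terms (Word (length is) k) (∏ (map f is))
  word-∏ []       = (≡.refl , []) ∷ []
  word-∏ {k} {f = f} {i ∷ is} (h ∷ hs) =
    terms-⊗ {Word 1 k} {Word (length is) k} {Word (suc (length is)) k} word-++ h (word-∏ hs)

  word-var : ∀ {k i} → i ℕ.< k → Terms (Word 1 k) (var i)
  word-var i<k = (≡.refl , i<k ∷ []) ∷ []

  word-const-⊗ : ∀ {d k} c {p} → Terms (Word d k) p → Terms (Word d k) (const c ⊗ p)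
  word-const-⊗ {d} {k} c = terms-⊗ {Word 0 k} {Word d k} {Word d k} word-++ ((≡.refl , []) ∷ [])

  word-substitute : ∀ {d k l s} {p : Poly} → (∀ i → i ℕ.< l → Terms (Word 1 k) (s i)) →
    Terms (Word d l) p → Terms (Word d k) (substitute s p)
  word-substitute {p = []} h [] = []
  word-substitute {d} {k} {l} {s} {(c , μ) ∷ p} h ((≡.refl , hμ) ∷ hp) =
    All.++⁺ (word-const-⊗ c (word-∏ (All.map (h _) hμ))) (word-substitute {s = s} h hp)

  word-linearForm : ∀ {k} (a : Fin k → Scalar) → Terms (Word 1 k) (linearForm a)
  word-linearForm {k} a = terms-∑ (All.map⁺ (All.universal
    (λ i → word-const-⊗ (a i) (word-var (Fin.toℕ<n i))) (allFin k)))

  word-coordinate : ∀ {k l} (A : LinearMap k l) j → Terms (Word 1 k) (coordinate A j)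
  word-coordinate {l = l} A j with j ℕ.<? l
  ... | yes j<l = word-linearForm (A (fromℕ< j<l))
  ... | no  _   = []

  word-∘ₗ : ∀ {d k l m} (A : LinearMap k l) {p} → Terms (Word d m) p → Terms (Word d k) (p ∘ₗ A)
  word-∘ₗ {m = m} A = word-substitute {l = m} {s = coordinate A} (λ i _ → word-coordinate A i)

  word-permanent : ∀ n → Terms (Word n (n ℕ.* n)) (per n)
  word-permanent n = terms-∑ (All.map⁺ (All.universal (λ σ →
    ≡.subst (λ m → Terms (Word m (n ℕ.* n)) (∏ (map (λ i → var (toℕ (combine i (σ ⟨$⟩ʳ i)))) (allFin n))))
      (length-tabulate {n = n} (λ i → i))
      (word-∏ (All.universal (λ i → word-var (Fin.toℕ<n (combine i (σ ⟨$⟩ʳ i)))) (allFin n)))) (permutations n)))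

  word-homogeneousPart : ∀ {d k} e {p} → Terms (Word d k) p → Terms (Word d k) (homogeneousPart e p)
  word-homogeneousPart e = All.filter⁺ (λ t → length (proj₂ t) ℕ.≟ e)

  coeff-∷-cong : ∀ {c ν p q μ} → coeff p μ ≈ coeff q μ → coeff ((c , ν) ∷ p) μ ≈ coeff ((c , ν) ∷ q) μ
  coeff-∷-cong {ν = ν} {μ = μ} e with does (ν ↭? μ)
  ... | true  = +-congˡ e
  ... | false = e

  coeff-∷-≁ : ∀ {c ν p μ} → ¬ (ν ↭ μ) → coeff ((c , ν) ∷ p) μ ≈ coeff p μ
  coeff-∷-≁ {ν = ν} {μ = μ} ν≁μ with ν ↭? μ
  ... | yes ν↭μ = contradiction ν↭μ ν≁μ
  ... | no  _   = refl

  coeff-homogeneousPart : ∀ {d μ} p → length μ ≡ d → coeff (homogeneousPart d p) μ ≈ coeff p μ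
  coeff-homogeneousPart []            e = refl
  coeff-homogeneousPart {d} {μ} ((c , ν) ∷ p) e = go (length ν ℕ.≟ d)
    where
    ofDegree : ∀ (t : Scalar × Monomial) → Dec (length (proj₂ t) ≡ d)
    ofDegree t = length (proj₂ t) ℕ.≟ d
    go : Dec (length ν ≡ d) → coeff (homogeneousPart d ((c , ν) ∷ p)) μ ≈ coeff ((c , ν) ∷ p) μ
    go (yes eq) = trans (reflexive (≡.cong (λ q → coeff q μ) (filter-accept ofDegree {c , ν} {p} eq)))
      (coeff-∷-cong {c} {ν} {homogeneousPart d p} {p} (coeff-homogeneousPart p e))
    go (no ¬eq) = trans (reflexive (≡.cong (λ q → coeff q μ) (filter-reject ofDegree {c , ν} {p} ¬eq)))
      (trans (coeff-homogeneousPart p e) (sym (coeff-∷-≁ {c} {ν} {p} (λ ν↭μ → ¬eq (≡.trans (↭-length ν↭μ) e)))))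

  word-∏ₘ : ∀ {k r} {I : Set} {X : I → Matrix r} → (∀ i a b → Terms (Word 1 k) (X i a b)) →
    ∀ is a b → Terms (Word (length is) k) (∏ₘ (map X is) a b)
  word-∏ₘ h [] a b with does (a Fin.≟ b)
  ... | true  = (≡.refl , []) ∷ []
  ... | false = []
  word-∏ₘ {k} {r} h (i ∷ is) a b = terms-∑ (All.map⁺ (All.universal (λ c →
    terms-⊗ {Word 1 k} {Word (length is) k} {Word (suc (length is)) k} word-++ (h i a c) (word-∏ₘ h is c b)) (allFin r)))

  sublists-length : ∀ {A : Set} d (xs : List A) → All (λ ys → length ys ≡ d) (sublists d xs)
  sublists-length zero    xs       = ≡.refl ∷ []
  sublists-length (suc d) []       = []
  sublists-length (suc d) (x ∷ xs) =
    All.++⁺ (All.map⁺ (All.map (≡.cong suc) (sublists-length d xs))) (sublists-length (suc d) xs)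

  word-∑ₘ : ∀ {d k r} {Ms : List (Matrix r)} → All (λ M → ∀ a b → Terms (Word d k) (M a b)) Ms →
    ∀ a b → Terms (Word d k) (∑ₘ Ms a b)
  word-∑ₘ []       a b = []
  word-∑ₘ (h ∷ hs) a b = All.++⁺ (h a b) (word-∑ₘ hs a b)

  word-nce₃ : ∀ n d → Terms (Word d (n ℕ.* 9)) (nce₃ n d)
  word-nce₃ n d = terms-∑ (All.concat⁺ (All.map⁺ (All.universal (λ a → All.map⁺ (All.universal (λ b →
    word-∑ₘ (All.map⁺ (All.map (λ {is} eq a b → ≡.subst (λ e → Terms (Word e (n ℕ.* 9)) (∏ₘ (map X is) a b)) eq
      (word-∏ₘ (λ i a b → word-var (Fin.toℕ<n (combine i (combine a b)))) is a b))
        (sublists-length d (allFin n)))) a b) (allFin 3))) (allFin 3))))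
    where
    X : Fin n → Matrix 3
    X i a b = var (toℕ (combine i (combine a b)))

  projection : ∀ {n} → Matrix n → ℕ → Poly
  projection {n} M i with i ℕ.<? n ℕ.* n
  ... | yes i<n² = M (proj₁ (remQuot n (fromℕ< i<n²))) (proj₂ (remQuot {n} n (fromℕ< i<n²)))
  ... | no  _    = 0ₚ

  projection-combine : ∀ {n} (M : Matrix n) i j → projection M (toℕ (combine i j)) ≡ M i j
  projection-combine {n} M i j with toℕ (combine i j) ℕ.<? n ℕ.* n
  ... | no ≮     = contradiction (Fin.toℕ<n (combine i j)) ≮
  ... | yes i<n² = ≡.cong (λ q → M (proj₁ q) (proj₂ q))
    (≡.trans (≡.cong (remQuot n) (Fin.fromℕ<-toℕ (combine i j) i<n²)) (Fin.remQuot-combine i j))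

  permanent-projection : ∀ {n} (M : Matrix n) → substitute (projection M) (per n) ≋ permanent M
  permanent-projection {n} M = R.trans
    (substitute-∑ s (λ σ → ∏ (map (λ i → var (toℕ (combine i (σ ⟨$⟩ʳ i)))) (allFin n))) (permutations n))
    (S.sum-cong (λ σ → R.trans (substitute-∏ s (λ i → var (toℕ (combine i (σ ⟨$⟩ʳ i)))) (allFin n))
      (S.prod-cong (λ i → R.trans (substitute-var s (toℕ (combine i (σ ⟨$⟩ʳ i))))
        (R.reflexive (projection-combine M i (σ ⟨$⟩ʳ i)))) (allFin n))) (permutations n))
    where s = projection M

  affine-projection : ∀ {n} (M : Matrix n) → (∀ i j → Affine (M i j)) → ∀ i → Affine (projection M i)
  affine-projection {n} M h i with i ℕ.<? n ℕ.* n
  ... | yes _ = h _ _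
  ... | no  _ = affine-0

  affine-≋ : ∀ {p q} → p ≋ q → Affine q → Affine p
  affine-≋ e h μ lt = trans (coeff-≈ e μ) (h μ lt)

  affine-∑ : ∀ {I : Set} (f : I → Poly) is → (∀ i → Affine (f i)) → Affine (∑ (map f is))
  affine-∑ f []       h = affine-0
  affine-∑ f (i ∷ is) h = affine-⊕ {f i} {∑ (map f is)} (h i) (affine-∑ f is h)

  affine-substitute-coordinate : ∀ {k l s} → (∀ i → Affine (s i)) → ∀ (A : LinearMap k l) j →
    Affine (substitute s (coordinate A j))
  affine-substitute-coordinate {k} {l} {s} h A j with j ℕ.<? l
  ... | no  _   = affine-0
  ... | yes j<l = affine-≋
    {q = ∑ (map (λ i → const (a i) ⊗ s (toℕ i)) (allFin k))}
    (R.trans (substitute-∑ s (λ i → const (a i) ⊗ var (toℕ i)) (allFin k))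
      (S.sum-cong (λ i → R.trans (substitute-⊗ s (const (a i)) (var (toℕ i)))
        (R.*-cong (substitute-const s (a i)) (substitute-var s (toℕ i)))) (allFin k)))
    (affine-∑ (λ i → const (a i) ⊗ s (toℕ i)) (allFin k) (λ i → affine-const-⊗ (a i) (s (toℕ i)) (h (toℕ i))))
    where a = A (fromℕ< j<l)

  substituteₘ : ∀ {r} → (ℕ → Poly) → Matrix r → Matrix r
  substituteₘ s A i j = substitute s (A i j)

  substitute-nceColumn : ∀ {r} s d (As : List (Matrix r)) i →
    substitute s (N.nceColumn d As i) ≋ N.nceColumn d (map (substituteₘ s) As) i
  substitute-nceColumn s zero    As       i = substitute-const s 1#
  substitute-nceColumn s (suc d) []       i = R.refl
  substitute-nceColumn {r} s (suc d) (A ∷ As) i = R.trans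
    (substitute-⊕ s (N.act A (N.nceColumn d As) i) (N.nceColumn (suc d) As i))
    (R.+-cong (R.trans (substitute-∑ s (λ k → A i k ⊗ N.nceColumn d As k) (allFin r))
        (S.sum-cong (λ k → R.trans (substitute-⊗ s (A i k) (N.nceColumn d As k))
          (R.*-congˡ {substitute s (A i k)} (substitute-nceColumn s d As k))) (allFin r)))
      (substitute-nceColumn s (suc d) As i))

  substitute-esum : ∀ {r} s d (As : List (Matrix r)) →
    substitute s (N.esum d As) ≋ N.esum d (map (substituteₘ s) As)
  substitute-esum {r} s d As = R.trans (substitute-∑ s (N.nceColumn d As) (allFin r))
    (S.sum-cong (substitute-nceColumn s d As) (allFin r))

  generic : ∀ n → Fin n → Matrix 3
  generic n i a b = var (toℕ (combine i (combine a b)))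

  generics : ∀ n → List (Matrix 3)
  generics n = map (generic n) (allFin n)

  nce₃-esum : ∀ n d → nce₃ n d ≋ N.esum d (generics n)
  nce₃-esum n d = N.entrySum-nceMat (generic n) d (allFin n)

  substitute-nce₃ : ∀ s n d →
    substitute s (nce₃ n d) ≋ N.esum d (map (λ i → substituteₘ s (generic n i)) (allFin n))
  substitute-nce₃ s n d = begin
    substitute s (nce₃ n d)  ≈⟨ substitute-cong s (nce₃-esum n d) ⟩
    substitute s (N.esum d (generics n))  ≈⟨ substitute-esum s d (generics n) ⟩
    N.esum d (map (substituteₘ s) (generics n))     ≡⟨ ≡.cong (N.esum d) (map-∘ (allFin n)) ⟨
    N.esum d (map (λ i → substituteₘ s (generic n i)) (allFin n)) ∎

  nce₃-size : (k n d : ℕ) → ℕ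
  nce₃-size k n d = suc ((3 ℕ.+ (n ℕ.+ d)) ℕ.* (3 ℕ.+ suc (3 ℕ.* suc (suc (3 ℕ.* suc (3 ℕ.* 6 ℕ.^ k))))))

  -- Affine polynomials substituted into linear forms are affine again, so the result is nce_d of
  -- matrices with affine entries. The size depends neither on `A` nor on the number of variables,
  -- hence is the same for all members of a sequence of linear maps.
  nce₃-formula : Divisible → ∀ {k l s} → (∀ i → Affine (s i)) → ∀ (A : LinearMap k l) {h n} d →
    n ℕ.≤ 2 ℕ.^ h → FormulaSize≤ (substitute s (nce₃ n d ∘ₗ A)) (nce₃-size h n d)
  nce₃-formula divisible {s = s} affine A {h} {n} d n≤2^h =
    let F , size≤ , value≋ = esum-formula Bs h (ℕ.≤-trans (ℕ.≤-reflexive length-Bs) n≤2^h) divisible d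
    in F , ≡.subst (λ m → size F ℕ.≤ nce₃-size h m d) length-Bs size≤ , R.trans value≋ (R.sym (begin
      substitute s (substitute t (nce₃ n d))
        ≈⟨ substitute-cong s (substitute-nce₃ t n d) ⟩
      substitute s (N.esum d Xs)
        ≈⟨ substitute-esum s d Xs ⟩
      N.esum d (map (substituteₘ s) Xs)
        ≡⟨ ≡.cong (N.esum d) (≡.trans (≡.sym (map-∘ (allFin n))) (map-∘ (allFin n))) ⟩
      N.esum d (map proj₁ Bs) ∎))
    where
    t = coordinate A
    Xs : List (Matrix 3)
    Xs = map (λ i → substituteₘ t (generic n i)) (allFin n)
    B : Fin n → AffineMatrix
    B i = substituteₘ s (substituteₘ t (generic n i)) , λ a b →
      affine-≋ (substitute-cong s (substitute-var t (toℕ (combine i (combine a b)))))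
        (affine-substitute-coordinate affine A (toℕ (combine i (combine a b))))
    Bs = map B (allFin n)
    length-Bs : length Bs ≡ n
    length-Bs = ≡.trans (length-map B (allFin n)) (length-tabulate {n = n} (λ i → i))

-- Programs on three registers

module RegisterPrograms (R : CommutativeRing 0ℓ 0ℓ) where

  open CommutativeRing R hiding (zero)
  open import Algebra.Properties.Ring ring using (-‿distribˡ-*)
  open Sums R
  open ElementarySymmetric R
  open Permanents R using (tabulate-suc)
  open import Relation.Binary.Reasoning.Setoid setoid

  -- The instruction u_i ← u_i + p u_j on three registers.
  Instruction : Set
  Instruction = Fin 3 × Fin 3 × Carrier

  addTo : Fin 3 → Carrier → Column 3 → Column 3
  addTo i q u x = if does (x Fin.≟ i) then u x + q else u x

  execute : Instruction → Column 3 → Column 3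
  execute (i , j , p) u = addTo i (p * u j) u

  -- The last instruction of the list is executed first, in accordance with a product of matrices
  -- acting on a column.
  run : List Instruction → Column 3 → Column 3
  run is u = foldr execute u is

  addTo-hit : ∀ i q u → addTo i q u i ≈ u i + q
  addTo-hit i q u with i Fin.≟ i
  ... | yes _  = refl
  ... | no i≢i = contradiction ≡.refl i≢i

  addTo-miss : ∀ {i x} q u → x ≢ i → addTo i q u x ≈ u x
  addTo-miss {i} {x} q u x≢i with x Fin.≟ i
  ... | yes x≡i = contradiction x≡i x≢i
  ... | no _    = refl

  addTo-cong : ∀ i {p q u v} → p ≈ q → (∀ x → u x ≈ v x) → ∀ x → addTo i p u x ≈ addTo i q v x
  addTo-cong i e h x with does (x Fin.≟ i)
  ... | true  = +-cong (h x) e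
  ... | false = h x

  addTo-0 : ∀ i {q} u → q ≈ 0# → ∀ x → addTo i q u x ≈ u x
  addTo-0 i u e x with does (x Fin.≟ i)
  ... | true  = trans (+-congˡ e) (+-identityʳ _)
  ... | false = refl

  Adds : List Instruction → Fin 3 → Fin 3 → Carrier → Set
  Adds is i j f = ∀ u x → run is u x ≈ addTo i (f * u j) u x

  adds-≈ : ∀ {is i j f g} → f ≈ g → Adds is i j f → Adds is i j g
  adds-≈ {i = i} e h u x = trans (h u x) (addTo-cong i {u = u} {v = u} (*-congʳ e) (λ _ → refl) x)

  run-cong : ∀ is {u v} → (∀ x → u x ≈ v x) → ∀ x → run is u x ≈ run is v x
  run-cong []                h = h
  run-cong ((i , j , p) ∷ is) h =
    addTo-cong i (*-congˡ (run-cong is h j)) (run-cong is h)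

  run-++ : ∀ is js u x → run (is ++ js) u x ≡ run is (run js u) x
  run-++ is js u x = ≡.cong (λ f → f x) (foldr-++ execute u is js)

  adds-++ : ∀ {is js i j f g} → i ≢ j → Adds is i j f → Adds js i j g → Adds (is ++ js) i j (f + g)
  adds-++ {is} {js} {i} {j} {f} {g} i≢j hf hg u x = begin
    run (is ++ js) u x
      ≡⟨ run-++ is js u x ⟩
    run is (run js u) x
      ≈⟨ hf (run js u) x ⟩
    addTo i (f * run js u j) (run js u) x
      ≈⟨ addTo-cong i (*-congˡ (trans (hg u j) (addTo-miss _ u (i≢j ∘ ≡.sym)))) (hg u) x ⟩
    addTo i (f * u j) (addTo i (g * u j) u) x
      ≈⟨ collect ⟩
    addTo i ((f + g) * u j) u x ∎
    where
    collect : addTo i (f * u j) (addTo i (g * u j) u) x ≈ addTo i ((f + g) * u j) u x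
    collect with does (x Fin.≟ i)
    ... | true  = trans (+-assoc _ _ _) (+-congˡ (trans (+-comm _ _) (sym (distribʳ _ _ _))))
    ... | false = refl

  -- The group commutator of elementary matrices: (1 + f E_ik)(1 + g E_kj)(1 - f E_ik)(1 - g E_kj) =
  -- 1 + f g E_ij for distinct i, j, k.
  adds-commutator : ∀ {F⁺ F⁻ G⁺ G⁻ i j k f g} → i ≢ j → i ≢ k → k ≢ j →
    Adds F⁺ i k f → Adds F⁻ i k (- f) → Adds G⁺ k j g → Adds G⁻ k j (- g) →
    Adds (F⁺ ++ G⁺ ++ F⁻ ++ G⁻) i j (f * g)
  adds-commutator {F⁺} {F⁻} {G⁺} {G⁻} {i} {j} {k} {f} {g} i≢j i≢k k≢j f⁺ f⁻ g⁺ g⁻ u x = begin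
    run (F⁺ ++ G⁺ ++ F⁻ ++ G⁻) u x
      ≡⟨ run-++ F⁺ (G⁺ ++ F⁻ ++ G⁻) u x ⟩
    run F⁺ (run (G⁺ ++ F⁻ ++ G⁻) u) x
      ≈⟨ run-cong F⁺ (λ y → reflexive (run-++ G⁺ (F⁻ ++ G⁻) u y)) x ⟩
    run F⁺ (run G⁺ (run (F⁻ ++ G⁻) u)) x
      ≈⟨ run-cong F⁺ (run-cong G⁺ (λ y → reflexive (run-++ F⁻ G⁻ u y))) x ⟩
    run F⁺ (run G⁺ (run F⁻ (run G⁻ u))) x
      ≈⟨ run-cong F⁺ (run-cong G⁺ (run-cong F⁻ (g⁻ u))) x ⟩
    run F⁺ (run G⁺ (run F⁻ u₁)) x
      ≈⟨ run-cong F⁺ (run-cong G⁺ (f⁻ u₁)) x ⟩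
    run F⁺ (run G⁺ u₂) x
      ≈⟨ run-cong F⁺ (g⁺ u₂) x ⟩
    run F⁺ u₃ x
      ≈⟨ f⁺ u₃ x ⟩
    addTo i (f * u₃ k) u₃ x
      ≈⟨ addTo-cong i {u = u₃} {v = u₃} (*-congˡ u₃k) (λ _ → refl) x ⟩
    addTo i (f * u k) u₃ x
      ≈⟨ final (x Fin.≟ i) (x Fin.≟ k) ⟩
    addTo i (f * g * u j) u x ∎
    where
    -- The contents after `G⁻`, `F⁻` and `G⁺`: register k loses g u_j, then register i loses f (u_k
    -- - g u_j), then k is restored. The final `F⁺` adds f u_k to i, which leaves f g u_j.
    u₁ u₂ u₃ : Column 3
    u₁ = addTo k (- g * u j) u
    u₂ = addTo i (- f * u₁ k) u₁
    u₃ = addTo k (g * u₂ j) u₂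
    j≢k = k≢j ∘ ≡.sym
    k≢i = i≢k ∘ ≡.sym
    cancel : ∀ a b → a + - b + b ≈ a
    cancel a b = trans (+-assoc _ _ _) (trans (+-congˡ (-‿inverseˡ b)) (+-identityʳ a))
    u₁k : u₁ k ≈ u k + - (g * u j)
    u₁k = trans (addTo-hit k _ u) (+-congˡ (sym (-‿distribˡ-* _ _)))
    u₂j : u₂ j ≈ u j
    u₂j = trans (addTo-miss _ u₁ (i≢j ∘ ≡.sym)) (addTo-miss _ u j≢k)
    u₃k : u₃ k ≈ u k
    u₃k = begin
      u₃ k  ≈⟨ addTo-hit k _ u₂ ⟩
      u₂ k + g * u₂ j  ≈⟨ +-cong (trans (addTo-miss _ u₁ k≢i) u₁k) (*-congˡ u₂j) ⟩
      u k + - (g * u j) + g * u j       ≈⟨ cancel _ _ ⟩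
      u k ∎
    u₃i : u₃ i ≈ u i + - (f * u₁ k)
    u₃i = begin
      u₃ i  ≈⟨ addTo-miss _ u₂ i≢k ⟩
      u₂ i  ≈⟨ addTo-hit i _ u₁ ⟩
      u₁ i + - f * u₁ k    ≈⟨ +-cong (addTo-miss _ u i≢k) (sym (-‿distribˡ-* _ _)) ⟩
      u i + - (f * u₁ k) ∎
    fuk : f * u k ≈ f * u₁ k + f * g * u j
    fuk = sym (begin
      f * u₁ k + f * g * u j  ≈⟨ +-cong (*-congˡ u₁k) (*-assoc _ _ _) ⟩
      f * (u k + - (g * u j)) + f * (g * u j) ≈⟨ distribˡ _ _ _ ⟨
      f * (u k + - (g * u j) + g * u j)     ≈⟨ *-congˡ (cancel _ _) ⟩
      f * u k ∎)
    final : Dec (x ≡ i) → Dec (x ≡ k) → addTo i (f * u k) u₃ x ≈ addTo i (f * g * u j) u x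
    final (yes ≡.refl) _ = begin
      addTo i (f * u k) u₃ i  ≈⟨ addTo-hit i _ u₃ ⟩
      u₃ i + f * u k  ≈⟨ +-cong u₃i fuk ⟩
      u i + - (f * u₁ k) + (f * u₁ k + f * g * u j)       ≈⟨ +-assoc _ _ _ ⟨
      u i + - (f * u₁ k) + f * u₁ k + f * g * u j  ≈⟨ +-congʳ (cancel _ _) ⟩
      u i + f * g * u j  ≈⟨ addTo-hit i _ u ⟨
      addTo i (f * g * u j) u i ∎
    final (no x≢i) x≟k = trans (addTo-miss _ u₃ x≢i) (trans (rest x≟k) (sym (addTo-miss _ u x≢i)))
      where
      rest : Dec (x ≡ k) → u₃ x ≈ u x
      rest (yes ≡.refl) = u₃k
      rest (no x≢k)     = trans (addTo-miss _ u₂ x≢k) (trans (addTo-miss _ u₁ x≢i) (addTo-miss _ u x≢k))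

  -- Only the part p E_ij of the elementary matrix 1 + p E_ij; `shift 1#` supplies the identity.
  -- These are the matrices to be substituted into `nce₃`.
  instructionMatrix : Instruction → Mat 3
  instructionMatrix (i , j , p) x y = if does (x Fin.≟ i) then (if does (y Fin.≟ j) then p else 0#) else 0#

  act-instruction : ∀ i j p u x →
    act (instructionMatrix (i , j , p)) u x ≈ (if does (x Fin.≟ i) then p * u j else 0#)
  act-instruction i j p u x with does (x Fin.≟ i)
  ... | false = sum-0 (λ y → zeroˡ (u y)) (allFin 3)
  ... | true  = begin
    sum (map (λ y → (if does (y Fin.≟ j) then p else 0#) * u y) (allFin 3))
      ≈⟨ sum-cong entry (allFin 3) ⟩
    sum (map (λ y → p * (𝟙 j y * u y)) (allFin 3))
      ≈⟨ sum-*ˡ p (λ y → 𝟙 j y * u y) (allFin 3) ⟩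
    p * sum (map (λ y → 𝟙 j y * u y) (allFin 3))
      ≈⟨ *-congˡ (sum-diagonal u j) ⟩
    p * u j ∎
    where
    entry : ∀ y → (if does (y Fin.≟ j) then p else 0#) * u y ≈ p * (𝟙 j y * u y)
    entry y with y Fin.≟ j | j Fin.≟ y
    ... | yes _   | yes _   = *-congˡ (sym (*-identityˡ (u y)))
    ... | no _    | no _    = trans (zeroˡ _) (sym (trans (*-congˡ (zeroˡ _)) (zeroʳ p)))
    ... | yes y≡j | no j≢y  = contradiction (≡.sym y≡j) j≢y
    ... | no y≢j  | yes j≡y = contradiction (≡.sym j≡y) y≢j

  acts-run : ∀ is u x → acts (map (shift 1#) (map instructionMatrix is)) u x ≈ run is u x
  acts-run []                  u x = refl
  acts-run ((i , j , p) ∷ is) u x = begin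
    act (shift 1# E) v x  ≈⟨ act-shift 1# E v x ⟩
    v x + 1# * act E v x  ≈⟨ +-cong (acts-run is u x) (trans (*-identityˡ _)
                                         (trans (act-cong E (acts-run is u) x) (act-instruction i j p (run is u) x))) ⟩
    run is u x + (if does (x Fin.≟ i) then p * run is u j else 0#) ≈⟨ collect ⟩
    run ((i , j , p) ∷ is) u x ∎
    where
    E = instructionMatrix (i , j , p)
    v = acts (map (shift 1#) (map instructionMatrix is)) u
    collect : run is u x + (if does (x Fin.≟ i) then p * run is u j else 0#) ≈ run ((i , j , p) ∷ is) u x
    collect with does (x Fin.≟ i)
    ... | true  = refl
    ... | false = +-identityʳ _

  nth : ∀ {A : Set} → A → List A → ℕ → A
  nth a []       n       = a
  nth a (x ∷ xs) zero    = x
  nth a (x ∷ xs) (suc n) = nth a xs n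

  -- `nce₃ n` takes exactly n matrices whereas program lengths are only bounded, so programs are
  -- filled up with an instruction that has no effect.
  run-padded : ∀ {A : Set} (⟦_⟧ : A → Instruction) a → (∀ u x → execute ⟦ a ⟧ u x ≈ u x) →
    ∀ n as u x → length as ℕ.≤ n →
    run (map (λ i → ⟦ nth a as (toℕ i) ⟧) (allFin n)) u x ≈ run (map ⟦_⟧ as) u x
  run-padded ⟦_⟧ a h zero    []       u x _ = refl
  run-padded ⟦_⟧ a h (suc n) []       u x _ = begin
    run (map (λ i → ⟦ nth a [] (toℕ i) ⟧) (allFin (suc n))) u x
      ≡⟨ ≡.cong (λ is → run is u x) (tabulate-suc {n = n} (λ i → ⟦ nth a [] (toℕ i) ⟧)) ⟩
    execute ⟦ a ⟧ (run (map (λ i → ⟦ nth a [] (toℕ i) ⟧) (allFin n)) u) x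
      ≈⟨ h _ x ⟩
    run (map (λ i → ⟦ nth a [] (toℕ i) ⟧) (allFin n)) u x
      ≈⟨ run-padded ⟦_⟧ a h n [] u x ℕ.z≤n ⟩
    u x ∎
  run-padded ⟦_⟧ a h (suc n) (b ∷ bs) u x (ℕ.s≤s le) = begin
    run (map (λ i → ⟦ nth a (b ∷ bs) (toℕ i) ⟧) (allFin (suc n))) u x
      ≡⟨ ≡.cong (λ is → run is u x) (tabulate-suc {n = n} (λ i → ⟦ nth a (b ∷ bs) (toℕ i) ⟧)) ⟩
    run (⟦ b ⟧ ∷ map (λ i → ⟦ nth a bs (toℕ i) ⟧) (allFin n)) u x
      ≈⟨ run-cong (⟦ b ⟧ ∷ []) (λ y → run-padded ⟦_⟧ a h n bs u y le) x ⟩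
    run (⟦ b ⟧ ∷ map ⟦_⟧ bs) u x ∎

  nceColumn-cong : ∀ {r d} {I : Set} {X Y : I → Mat r} → (∀ i a b → X i a b ≈ Y i a b) →
    ∀ is x → nceColumn d (map X is) x ≈ nceColumn d (map Y is) x
  nceColumn-cong {d = zero}  e is       x = refl
  nceColumn-cong {d = suc d} e []       x = refl
  nceColumn-cong {r} {suc d} e (i ∷ is) x =
    +-cong (sum-cong (λ k → *-cong (e i x k) (nceColumn-cong {d = d} e is k)) (allFin r))
           (nceColumn-cong {d = suc d} e is x)

  esum-cong : ∀ {r d} {I : Set} {X Y : I → Mat r} → (∀ i a b → X i a b ≈ Y i a b) →
    ∀ is → esum d (map X is) ≈ esum d (map Y is)
  esum-cong {r} {d} e is = sum-cong (nceColumn-cong {d = d} e is) (allFin r)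

-- Balancing formulas and writing them as substitutions into `nce₃`

module DepthReduction (K : CommutativeRing 0ℓ 0ℓ) (k : ℕ) where

  open import Algebra.Properties.CommutativeSemigroup ℕ.+-commutativeSemigroup using (xy∙z≈xz∙y)
  open ℕ-Solver using (solve; _:+_; _:*_; _:=_; con)
  open CommutativeRing K hiding (zero) renaming (Carrier to Scalar)
  open Polynomials K
  open PolynomialRing K
  open Projections K
  open import Algebra.Properties.Ring ring using (-‿distribˡ-*)
  private
    module R = CommutativeRing polyRing
    module N = ElementarySymmetric polyRing
    module S = Sums polyRing
    module SK = Sums K
    module NK = ElementarySymmetric K
  open RegisterPrograms polyRing
  open Permanents polyRing using (Σ<; Σ<-cong)
  open import Relation.Binary.Reasoning.Setoid R.setoid

  third : ∀ {i j : Fin 3} → i ≢ j → ∃[ m ] i ≢ m × m ≢ j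
  third {0F} {0F} i≢j = contradiction ≡.refl i≢j
  third {0F} {1F} _   = 2F , (λ ()) , λ ()
  third {0F} {2F} _   = 1F , (λ ()) , λ ()
  third {1F} {0F} _   = 2F , (λ ()) , λ ()
  third {1F} {1F} i≢j = contradiction ≡.refl i≢j
  third {1F} {2F} _   = 0F , (λ ()) , λ ()
  third {2F} {0F} _   = 1F , (λ ()) , λ ()
  third {2F} {1F} _   = 0F , (λ ()) , λ ()
  third {2F} {2F} i≢j = contradiction ≡.refl i≢j

  Form : Set
  Form = Fin k → Scalar

  linearForm-* : ∀ c (a : Form) → linearForm (λ i → c * a i) ≋ const c ⊗ linearForm a
  linearForm-* c a = R.trans
    (S.sum-cong (λ i → R.trans (R.*-congʳ {var (toℕ i)} (const-* c (a i)))
      (R.*-assoc (const c) (const (a i)) (var (toℕ i)))) (allFin k))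
    (S.sum-*ˡ (const c) (λ i → const (a i) ⊗ var (toℕ i)) (allFin k))

  linearForm-0 : linearForm {k} (λ _ → 0#) ≋ 0ₚ
  linearForm-0 = S.sum-0 (λ i → R.trans (R.*-congʳ {var (toℕ i)} const-0) (R.zeroˡ (var (toℕ i)))) (allFin k)

  -- Straight-line programs on three registers, after Ben-Or and Cleve

  Step : Set
  Step = Fin 3 × Fin 3 × Form

  ⟦_⟧ : Step → Instruction
  ⟦ i , j , a ⟧ = i , j , linearForm a

  -- f can be added to a register in n steps, together with all its multiples:
  -- the scalar takes care of both inverses and constant coefficients.
  Addable : ℕ → Poly → Set
  Addable n f = ∀ c {i j} → i ≢ j →
    ∃[ ss ] length ss ℕ.≤ n × Adds (map ⟦_⟧ ss) i j (const c ⊗ f)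

  addable-linear : ∀ a → Addable 1 (linearForm a)
  addable-linear a c {i} {j} _ = (i , j , λ x → c * a x) ∷ [] , ℕ.≤-refl , λ u x →
    addTo-cong i {u = u} {v = u} (R.*-congʳ {u j} (linearForm-* c a)) (λ _ → R.refl) x

  addable-≤ : ∀ {m n f} → m ℕ.≤ n → Addable m f → Addable n f
  addable-≤ m≤n h c i≢j = let ss , le , p = h c i≢j in ss , ℕ.≤-trans le m≤n , p

  addable-scale : ∀ {n f} d → Addable n f → Addable n (const d ⊗ f)
  addable-scale {f = f} d h c {i} {j} i≢j = let ss , le , p = h (c * d) i≢j in
    ss , le , adds-≈ {map ⟦_⟧ ss} {i} {j}
      (R.trans (R.*-congʳ {f} (const-* c d)) (R.*-assoc (const c) (const d) f)) p

  addable-⊕ : ∀ {m n f g} → Addable m f → Addable n g → Addable (m ℕ.+ n) (f ⊕ g)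
  addable-⊕ {f = f} {g} hf hg c {i} {j} i≢j =
    let ss , le , p = hf c i≢j
        ts , le′ , q = hg c i≢j
    in ss ++ ts
     , ℕ.≤-trans (ℕ.≤-reflexive (length-++ ss)) (ℕ.+-mono-≤ le le′)
     , ≡.subst (λ is → Adds is i j (const c ⊗ (f ⊕ g))) (≡.sym (map-++ ⟦_⟧ ss ts))
         (adds-≈ {map ⟦_⟧ ss ++ map ⟦_⟧ ts} {i} {j} (R.sym (R.distribˡ (const c) f g))
           (adds-++ {map ⟦_⟧ ss} {map ⟦_⟧ ts} {f = const c ⊗ f} {const c ⊗ g} i≢j p q))

  const-neg-⊗ : ∀ c f → const (- c) ⊗ f ≋ ⊖ (const c ⊗ f)
  const-neg-⊗ c f = pair≈⇒≋ λ φ _ → trans (pair-const-⊗ φ (- c) f)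
    (trans (sym (-‿distribˡ-* c _)) (trans (-‿cong (sym (pair-const-⊗ φ c f))) (sym (pair-⊖ φ (const c ⊗ f)))))

  addable-⊗ : ∀ {m n f g} → Addable m f → Addable n g → Addable (2 ℕ.* (m ℕ.+ n)) (f ⊗ g)
  addable-⊗ {m} {n} {f} {g} hf hg c {i} {j} i≢j =
    let l , i≢l , l≢j = third i≢j
        -- The scalar c travels with f alone. The inverse programs of the commutator are programs
        -- for the same polynomials with the scalars -c and -1.
        F⁺ , F⁺≤ , f⁺ = hf c i≢l
        F⁻ , F⁻≤ , f⁻ = hf (- c) i≢l
        G⁺ , G⁺≤ , g⁺ = hg 1# l≢j
        G⁻ , G⁻≤ , g⁻ = hg (- 1#) l≢j
    in F⁺ ++ G⁺ ++ F⁻ ++ G⁻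
     , ℕ.≤-trans (ℕ.≤-reflexive (lengths F⁺ G⁺ F⁻ G⁻))
         (ℕ.≤-trans (ℕ.+-mono-≤ F⁺≤ (ℕ.+-mono-≤ G⁺≤ (ℕ.+-mono-≤ F⁻≤ G⁻≤)))
           (ℕ.≤-reflexive (solve 2 (λ m n → m :+ (n :+ (m :+ n)) := con 2 :* (m :+ n)) ≡.refl m n)))
     , ≡.subst (λ is → Adds is i j (const c ⊗ (f ⊗ g))) (≡.sym (maps F⁺ G⁺ F⁻ G⁻))
         (adds-≈ {map ⟦_⟧ F⁺ ++ map ⟦_⟧ G⁺ ++ map ⟦_⟧ F⁻ ++ map ⟦_⟧ G⁻} {i} {j} (R.*-assoc (const c) f g)
           (adds-commutator {map ⟦_⟧ F⁺} {map ⟦_⟧ F⁻} {map ⟦_⟧ G⁺} {map ⟦_⟧ G⁻} {f = const c ⊗ f} {g} i≢j i≢l l≢j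
             f⁺ (adds-≈ {map ⟦_⟧ F⁻} {i} {l} (const-neg-⊗ c f) f⁻)
             (adds-≈ {map ⟦_⟧ G⁺} {l} {j} (R.*-identityˡ g) g⁺)
             (adds-≈ {map ⟦_⟧ G⁻} {l} {j} (R.trans (const-neg-⊗ 1# g) (R.-‿cong (R.*-identityˡ g))) g⁻)))
    where

    lengths : ∀ (A B C D : List Step) → length (A ++ B ++ C ++ D) ≡ length A ℕ.+ (length B ℕ.+ (length C ℕ.+ length D))
    lengths A B C D = ≡.trans (length-++ A) (≡.cong (length A ℕ.+_)
      (≡.trans (length-++ B) (≡.cong (length B ℕ.+_) (length-++ C))))
    maps : ∀ (A B C D : List Step) → map ⟦_⟧ (A ++ B ++ C ++ D) ≡ map ⟦_⟧ A ++ map ⟦_⟧ B ++ map ⟦_⟧ C ++ map ⟦_⟧ D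
    maps A B C D = ≡.trans (map-++ ⟦_⟧ A _) (≡.cong (map ⟦_⟧ A ++_)
      (≡.trans (map-++ ⟦_⟧ B _) (≡.cong (map ⟦_⟧ B ++_) (map-++ ⟦_⟧ C D))))

  record Computable (n : ℕ) (p : Poly) : Set where
    constructor computable
    field
      constant : Scalar
      rest     : Poly
      splits   : p ≋ const constant ⊕ rest
      addable  : Addable n rest

  computable-≋ : ∀ {n p q} → p ≋ q → Computable n p → Computable n q
  computable-≋ e (computable c f s h) = computable c f (R.trans (R.sym e) s) h

  computable-≤ : ∀ {m n p} → m ℕ.≤ n → Computable m p → Computable n p
  computable-≤ le (computable c f s h) = computable c f s (addable-≤ {f = f} le h)

  computable-⊕ : ∀ {m n p q} → Computable m p → Computable n q → Computable (m ℕ.+ n) (p ⊕ q)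
  computable-⊕ {p = p} {q} (computable c f s h) (computable d g t h′) = computable (c + d) (f ⊕ g)
    (R.trans (R.+-cong s t) (R.trans (S.+-interchange (const c) f (const d) g)
      (R.+-congʳ {f ⊕ g} (R.sym (const-+ c d)))))
    (addable-⊕ {f = f} {g} h h′)

  computable-⊗ : ∀ {m n p q} → Computable m p → Computable n q → Computable (3 ℕ.* (m ℕ.+ n)) (p ⊗ q)
  computable-⊗ {m} {n} {p} {q} (computable c f s h) (computable d g t h′) =
    computable (c * d) (const c ⊗ g ⊕ (const d ⊗ f ⊕ f ⊗ g))
      (begin
        p ⊗ q  ≈⟨ R.*-cong s t ⟩
        (C ⊕ f) ⊗ (D ⊕ g)  ≈⟨ R.distribʳ (D ⊕ g) C f ⟩
        C ⊗ (D ⊕ g) ⊕ f ⊗ (D ⊕ g)  ≈⟨ R.+-cong (R.distribˡ C D g) (R.distribˡ f D g) ⟩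
        (C ⊗ D ⊕ C ⊗ g) ⊕ (f ⊗ D ⊕ f ⊗ g)  ≈⟨ R.+-assoc (C ⊗ D) (C ⊗ g) (f ⊗ D ⊕ f ⊗ g) ⟩
        C ⊗ D ⊕ (C ⊗ g ⊕ (f ⊗ D ⊕ f ⊗ g))  ≈⟨ R.+-cong (R.sym (const-* c d)) (R.+-congˡ {C ⊗ g} (R.+-congʳ {f ⊗ g} (R.*-comm f D))) ⟩
        const (c * d) ⊕ (C ⊗ g ⊕ (D ⊗ f ⊕ f ⊗ g)) ∎)
      (addable-≤ {f = C ⊗ g ⊕ (D ⊗ f ⊕ f ⊗ g)}
        (ℕ.≤-reflexive (solve 2 (λ m n → n :+ (m :+ con 2 :* (m :+ n)) := con 3 :* (m :+ n)) ≡.refl m n))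
        (addable-⊕ {f = C ⊗ g} {D ⊗ f ⊕ f ⊗ g} (addable-scale {f = g} c h′)
          (addable-⊕ {f = D ⊗ f} {f ⊗ g} (addable-scale {f = f} d h) (addable-⊗ {f = f} {g} h h′))))
    where
    C = const c
    D = const d

  computable-⊖ : ∀ {n p} → Computable n p → Computable n (⊖ p)
  computable-⊖ {n} {p} h = computable-≋ (R.trans (const-neg-⊗ 1# p) (R.-‿cong (R.*-identityˡ p)))
    (scaled h)
    where
    scaled : Computable n p → Computable n (const (- 1#) ⊗ p)
    scaled (computable c f s a) = computable (- 1# * c) (const (- 1#) ⊗ f)
      (R.trans (R.*-congˡ {const (- 1#)} s) (R.trans (R.distribˡ (const (- 1#)) (const c) f)
        (R.+-congʳ {const (- 1#) ⊗ f} (R.sym (const-* (- 1#) c)))))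
      (addable-scale {f = f} (- 1#) a)

  -- Depth reduction, after Brent

  data Tree : Set where
    leaf    : Scalar → Form → Tree
    add mul : Tree → Tree → Tree

  valueᵗ : Tree → Poly
  valueᵗ (leaf c a) = const c ⊕ linearForm a
  valueᵗ (add S T)  = valueᵗ S ⊕ valueᵗ T
  valueᵗ (mul S T)  = valueᵗ S ⊗ valueᵗ T

  leaves : Tree → ℕ
  leaves (leaf _ _) = 1
  leaves (add S T)  = leaves S ℕ.+ leaves T
  leaves (mul S T)  = leaves S ℕ.+ leaves T

  data Context : Set where
    hole      : Context
    addˡ mulˡ : Context → Tree → Context
    addʳ mulʳ : Tree → Context → Context

  plug : Context → Tree → Tree
  plug hole       T = T
  plug (addˡ C S) T = add (plug C T) S
  plug (mulˡ C S) T = mul (plug C T) S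
  plug (addʳ S C) T = add S (plug C T)
  plug (mulʳ S C) T = mul S (plug C T)

  leavesᶜ : Context → ℕ
  leavesᶜ hole       = 0
  leavesᶜ (addˡ C S) = leavesᶜ C ℕ.+ leaves S
  leavesᶜ (mulˡ C S) = leavesᶜ C ℕ.+ leaves S
  leavesᶜ (addʳ S C) = leaves S ℕ.+ leavesᶜ C
  leavesᶜ (mulʳ S C) = leaves S ℕ.+ leavesᶜ C

  leaves-plug : ∀ C T → leaves (plug C T) ≡ leavesᶜ C ℕ.+ leaves T
  leaves-plug hole       T = ≡.refl
  leaves-plug (addˡ C S) T = ≡.trans (≡.cong (ℕ._+ leaves S) (leaves-plug C T)) (xy∙z≈xz∙y (leavesᶜ C) _ _)
  leaves-plug (mulˡ C S) T = ≡.trans (≡.cong (ℕ._+ leaves S) (leaves-plug C T)) (xy∙z≈xz∙y (leavesᶜ C) _ _)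
  leaves-plug (addʳ S C) T = ≡.trans (≡.cong (leaves S ℕ.+_) (leaves-plug C T)) (≡.sym (ℕ.+-assoc (leaves S) _ _))
  leaves-plug (mulʳ S C) T = ≡.trans (≡.cong (leaves S ℕ.+_) (leaves-plug C T)) (≡.sym (ℕ.+-assoc (leaves S) _ _))

  slope intercept : Context → Poly
  slope hole       = 1ₚ
  slope (addˡ C S) = slope C
  slope (mulˡ C S) = slope C ⊗ valueᵗ S
  slope (addʳ S C) = slope C
  slope (mulʳ S C) = slope C ⊗ valueᵗ S
  intercept hole       = 0ₚ
  intercept (addˡ C S) = intercept C ⊕ valueᵗ S
  intercept (mulˡ C S) = intercept C ⊗ valueᵗ S
  intercept (addʳ S C) = intercept C ⊕ valueᵗ S
  intercept (mulʳ S C) = intercept C ⊗ valueᵗ S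

  value-plug-mul : ∀ C S T → valueᵗ (plug C T) ≋ slope C ⊗ valueᵗ T ⊕ intercept C →
    valueᵗ (plug C T) ⊗ valueᵗ S ≋ slope C ⊗ valueᵗ S ⊗ valueᵗ T ⊕ intercept C ⊗ valueᵗ S
  value-plug-mul C S T h = begin
    valueᵗ (plug C T) ⊗ s  ≈⟨ R.*-congʳ {s} h ⟩
    (slope C ⊗ t ⊕ intercept C) ⊗ s  ≈⟨ R.distribʳ s (slope C ⊗ t) (intercept C) ⟩
    slope C ⊗ t ⊗ s ⊕ intercept C ⊗ s  ≈⟨ R.+-congʳ {intercept C ⊗ s} (R.trans (R.*-assoc (slope C) t s)
       (R.trans (R.*-congˡ {slope C} (R.*-comm t s)) (R.sym (R.*-assoc (slope C) s t)))) ⟩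
    slope C ⊗ s ⊗ t ⊕ intercept C ⊗ s ∎
    where
    s = valueᵗ S
    t = valueᵗ T

  value-plug : ∀ C T → valueᵗ (plug C T) ≋ slope C ⊗ valueᵗ T ⊕ intercept C
  value-plug hole       T = R.sym (R.trans (R.+-identityʳ (1ₚ ⊗ valueᵗ T)) (R.*-identityˡ (valueᵗ T)))
  value-plug (addˡ C S) T = R.trans (R.+-congʳ {valueᵗ S} (value-plug C T))
    (R.+-assoc (slope C ⊗ valueᵗ T) (intercept C) (valueᵗ S))
  value-plug (mulˡ C S) T = value-plug-mul C S T (value-plug C T)
  value-plug (addʳ S C) T = R.trans (R.+-comm (valueᵗ S) (valueᵗ (plug C T)))
    (R.trans (R.+-congʳ {valueᵗ S} (value-plug C T))
      (R.+-assoc (slope C ⊗ valueᵗ T) (intercept C) (valueᵗ S)))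
  value-plug (mulʳ S C) T = R.trans (R.*-comm (valueᵗ S) (valueᵗ (plug C T))) (value-plug-mul C S T (value-plug C T))

  constᵗ : Scalar → Tree
  constᵗ c = leaf c (λ _ → 0#)

  value-constᵗ : ∀ c → valueᵗ (constᵗ c) ≋ const c
  value-constᵗ c = R.trans (R.+-congˡ {const c} linearForm-0) (R.+-identityʳ (const c))

  -- Computing the slope as it is defined would multiply along the whole path to the hole. As the
  -- value is affine in the hole, the slope is the difference of the values with 1 and with 0
  -- plugged in, and these are trees with one leaf more than the context.
  value-plug-split : ∀ C T → valueᵗ (plug C T) ≋
    (valueᵗ (plug C (constᵗ 1#)) ⊕ ⊖ valueᵗ (plug C (constᵗ 0#))) ⊗ valueᵗ T ⊕ valueᵗ (plug C (constᵗ 0#))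
  value-plug-split C T = R.trans (value-plug C T)
    (R.+-cong (R.*-congʳ {valueᵗ T} (R.sym difference)) (R.sym at0))
    where
    at0 : valueᵗ (plug C (constᵗ 0#)) ≋ intercept C
    at0 = R.trans (value-plug C (constᵗ 0#)) (R.+-congʳ {intercept C}
      (R.trans (R.*-congˡ {slope C} (R.trans (value-constᵗ 0#) const-0)) (R.zeroʳ (slope C))))
    at1 : valueᵗ (plug C (constᵗ 1#)) ≋ slope C ⊕ intercept C
    at1 = R.trans (value-plug C (constᵗ 1#)) (R.+-congʳ {intercept C}
      (R.trans (R.*-congˡ {slope C} (value-constᵗ 1#)) (R.*-identityʳ (slope C))))
    difference : valueᵗ (plug C (constᵗ 1#)) ⊕ ⊖ valueᵗ (plug C (constᵗ 0#)) ≋ slope C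
    difference = R.trans (R.+-cong at1 (R.-‿cong at0)) (R.trans (R.+-assoc (slope C) (intercept C) (⊖ intercept C))
      (R.trans (R.+-congˡ {slope C} (R.-‿inverseʳ (intercept C))) (R.+-identityʳ (slope C))))

  record Split (u : ℕ) (T : Tree) : Set where
    constructor split-at
    field
      context : Context
      subtree : Tree
      plugged : T ≡ plug context subtree
      lower   : u ℕ.< leaves subtree
      upper   : leaves subtree ℕ.≤ u ℕ.+ u

  -- Descend into a child with more than u leaves until at most 2u are left.
  mutual
    split : ∀ {u} → 1 ℕ.≤ u → ∀ T → u ℕ.+ u ℕ.< leaves T → Split u T
    split 1≤u (leaf c a) (ℕ.s≤s u+u≤0) = contradiction (ℕ.≤-trans (ℕ.m≤m+n _ _) u+u≤0) (ℕ.<⇒≱ 1≤u)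
    split 1≤u (add S T) lt = split-children 1≤u S T addˡ addʳ (≡.cong (λ S′ → add S′ T)) (≡.cong (add S)) lt
    split 1≤u (mul S T) lt = split-children 1≤u S T mulˡ mulʳ (≡.cong (λ S′ → mul S′ T)) (≡.cong (mul S)) lt

    split-children : ∀ {u T₀} → 1 ℕ.≤ u → ∀ S T
      (left : Context → Tree → Context) (right : Tree → Context → Context) →
      (∀ {C S′} → S ≡ plug C S′ → T₀ ≡ plug (left C T) S′) →
      (∀ {C T′} → T ≡ plug C T′ → T₀ ≡ plug (right S C) T′) →
      u ℕ.+ u ℕ.< leaves S ℕ.+ leaves T → Split u T₀
    split-children {u} 1≤u S T left right l r lt with u ℕ.<? leaves S
    split-children {u} 1≤u S T left right l r lt | yes u<S with leaves S ℕ.≤? u ℕ.+ u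
    ... | yes S≤2u = split-at (left hole T) S (l ≡.refl) u<S S≤2u
    ... | no  S≰2u = let split-at C S′ e lo up = split 1≤u S (ℕ.≰⇒> S≰2u) in split-at (left C T) S′ (l e) lo up
    split-children {u} 1≤u S T left right l r lt | no u≮S with leaves T ℕ.≤? u ℕ.+ u
    ... | yes T≤2u = split-at (right S hole) T (r ≡.refl)
      -- Of more than 2u leaves at most u are in the left child, so more than u are in the right
      -- one.
      (ℕ.+-cancelˡ-< u u (leaves T) (ℕ.<-≤-trans lt (ℕ.+-monoˡ-≤ (leaves T) (ℕ.≮⇒≥ u≮S)))) T≤2u
    ... | no  T≰2u = let split-at C T′ e lo up = split 1≤u T (ℕ.≰⇒> T≰2u) in split-at (right S C) T′ (r e) lo up

  Bounded : ℕ → ℕ → Set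
  Bounded N ℓ = ∀ T → leaves T ℕ.≤ N → Computable ℓ (valueᵗ T)

  -- Cutting out a subtree S with more than u and at most 2u leaves writes the value as (C[1] -
  -- C[0]) S + C[0], in which every piece has at most 2u leaves. By the costs of sums and products
  -- this takes 3 ((ℓ + ℓ) + ℓ) + ℓ = 10 ℓ steps.
  bounded-brent : ∀ {u ℓ} → 1 ℕ.≤ u → Bounded (u ℕ.+ u) ℓ → Bounded (u ℕ.+ u ℕ.+ u) (10 ℕ.* ℓ)
  bounded-brent {u} {ℓ} 1≤u h T T≤3u with leaves T ℕ.≤? u ℕ.+ u
  ... | yes T≤2u = computable-≤ (ℕ.m≤m+n ℓ _) (h T T≤2u)
  ... | no T≰2u with split 1≤u T (ℕ.≰⇒> T≰2u)
  ...   | split-at C S ≡.refl u<S S≤2u = computable-≋ (R.sym (value-plug-split C S))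
    (computable-≤ (ℕ.≤-reflexive (solve 1 (λ l → con 3 :* (l :+ l :+ l) :+ l := con 10 :* l) ≡.refl ℓ))
      (computable-⊕ (computable-⊗ (computable-⊕ (piece 1#) (computable-⊖ (piece 0#))) (h S S≤2u)) (piece 0#)))
    where
    -- The strict bound u < leaves S pays for the constant leaf that replaces S.
    C≤ : leavesᶜ C ℕ.+ 1 ℕ.≤ u ℕ.+ u
    C≤ = ℕ.+-cancelʳ-≤ u _ _ (ℕ.≤-trans (ℕ.≤-reflexive (ℕ.+-assoc (leavesᶜ C) 1 u))
      (ℕ.≤-trans (ℕ.+-monoʳ-≤ (leavesᶜ C) u<S)
        (ℕ.≤-trans (ℕ.≤-reflexive (≡.sym (leaves-plug C S))) T≤3u)))
    piece : ∀ c → Computable ℓ (valueᵗ (plug C (constᵗ c)))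
    piece c = h (plug C (constᵗ c)) (ℕ.≤-trans (ℕ.≤-reflexive (leaves-plug C (constᵗ c))) C≤)

  leaves-positive : ∀ T → 1 ℕ.≤ leaves T
  leaves-positive (leaf _ _) = ℕ.≤-refl
  leaves-positive (add S T)  = ℕ.≤-trans (leaves-positive S) (ℕ.m≤m+n _ _)
  leaves-positive (mul S T)  = ℕ.≤-trans (leaves-positive S) (ℕ.m≤m+n _ _)

  -- An equality at m = n = 6. Given the factor 3 in `computable-⊗`, this is the origin of the base
  -- 6 in the bound for unbalanced trees.
  3[m+n]≤m*n : ∀ {m n} → 6 ℕ.≤ m → 6 ℕ.≤ n → 3 ℕ.* (m ℕ.+ n) ℕ.≤ m ℕ.* n
  3[m+n]≤m*n {m} {n} 6≤m 6≤n = ℕ.*-cancelˡ-≤ 2 (ℕ.≤-trans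
    (ℕ.≤-reflexive (solve 2 (λ m n → con 2 :* (con 3 :* (m :+ n)) := m :* con 6 :+ con 6 :* n) ≡.refl m n))
    (ℕ.≤-trans (ℕ.+-mono-≤ (ℕ.*-monoʳ-≤ m 6≤n) (ℕ.*-monoˡ-≤ n 6≤m))
      (ℕ.≤-reflexive (solve 2 (λ m n → m :* n :+ m :* n := con 2 :* (m :* n)) ≡.refl m n))))

  6^leaves-bound : ∀ S T → 3 ℕ.* (6 ℕ.^ leaves S ℕ.+ 6 ℕ.^ leaves T) ℕ.≤ 6 ℕ.^ (leaves S ℕ.+ leaves T)
  6^leaves-bound S T = ℕ.≤-trans
    (3[m+n]≤m*n (ℕ.^-monoʳ-≤ 6 (leaves-positive S)) (ℕ.^-monoʳ-≤ 6 (leaves-positive T)))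
    (ℕ.≤-reflexive (≡.sym (ℕ.^-distribˡ-+-* 6 (leaves S) (leaves T))))

  computable-naive : ∀ T → Computable (6 ℕ.^ leaves T) (valueᵗ T)
  computable-naive (leaf c a) = computable-≤ (ℕ.s≤s ℕ.z≤n) (computable c (linearForm a) R.refl (addable-linear a))
  computable-naive (add S T)  = computable-≤ (ℕ.≤-trans (ℕ.m≤m+n _ _) (6^leaves-bound S T))
    (computable-⊕ (computable-naive S) (computable-naive T))
  computable-naive (mul S T)  = computable-≤ (6^leaves-bound S T) (computable-⊗ (computable-naive S) (computable-naive T))

  -- Each doubling of the number of leaves takes two rounds of `bounded-brent`, hence the factor 10
  -- · 10; the recursion starts with the unbalanced bound for four leaves. For h logarithmic in the
  -- size this is polynomial.
  programLength : ℕ → ℕ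
  programLength h = 100 ℕ.^ h ℕ.* 6 ℕ.^ 4

  -- Two rounds gain a factor (3/2)² ≥ 2 in the number of leaves.
  bounded : ∀ h → Bounded (4 ℕ.* 2 ℕ.^ h) (programLength h)
  bounded zero    T le = computable-≤ (ℕ.≤-trans (ℕ.^-monoʳ-≤ 6 le) (ℕ.m≤m+n (6 ℕ.^ 4) 0)) (computable-naive T)
  bounded (suc h) T le = computable-≤
    (ℕ.≤-reflexive (≡.trans (≡.sym (ℕ.*-assoc 10 10 (programLength h))) (≡.sym (ℕ.*-assoc 100 (100 ℕ.^ h) (6 ℕ.^ 4)))))
    (second T (ℕ.≤-trans le (ℕ.≤-trans (ℕ.m≤m+n _ v)
      (ℕ.≤-reflexive (solve 1 (λ v → con 4 :* (con 2 :* v) :+ v := con 3 :* v :+ con 3 :* v :+ con 3 :* v) ≡.refl v)))))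
    where
    v = 2 ℕ.^ h
    1≤v : 1 ℕ.≤ v
    1≤v = ℕ.m^n>0 2 h
    -- The rounds pass from 4v to 6v and from 6v to 9v ≥ 8v leaves, with u = 2v and u = 3v. Starting
    -- from four leaves keeps both values of u integral for every h.
    first : Bounded (2 ℕ.* v ℕ.+ 2 ℕ.* v ℕ.+ 2 ℕ.* v) (10 ℕ.* programLength h)
    first = bounded-brent {2 ℕ.* v} (ℕ.≤-trans 1≤v (ℕ.m≤m+n v _)) (λ S le →
      bounded h S (ℕ.≤-trans le (ℕ.≤-reflexive (solve 1 (λ v → con 2 :* v :+ con 2 :* v := con 4 :* v) ≡.refl v))))
    second : Bounded (3 ℕ.* v ℕ.+ 3 ℕ.* v ℕ.+ 3 ℕ.* v) (10 ℕ.* (10 ℕ.* programLength h))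
    second = bounded-brent {3 ℕ.* v} (ℕ.≤-trans 1≤v (ℕ.m≤m+n v _)) (λ S le →
      first S (ℕ.≤-trans le (ℕ.≤-reflexive (solve 1 (λ v → con 3 :* v :+ con 3 :* v := con 2 :* v :+ con 2 :* v :+ con 2 :* v) ≡.refl v))))

  coeff-Σ< : ∀ n (f : ℕ → Poly) μ → coeff (Σ< n f) μ ≈ Permanents.Σ< K n (λ e → coeff (f e) μ)
  coeff-Σ< zero    f μ = refl
  coeff-Σ< (suc n) f μ = trans (coeff-⊕ (f 0) _ μ) (+-congˡ (coeff-Σ< n (f ∘ suc) μ))

  module _ (ss : List Step) (n : ℕ) where

    private
      padding : Step
      padding = 0F , 1F , λ _ → 0#

      step : Fin n → Step
      step i = nth padding ss (toℕ i)

      stepMatrix : Fin n → Matrix 3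
      stepMatrix i = instructionMatrix ⟦ step i ⟧

      stepMatrices : List (Matrix 3)
      stepMatrices = map stepMatrix (allFin n)

    stepEntry : Step → Fin 3 → Fin 3 → Form
    stepEntry (i , j , a) x y c = if does (x Fin.≟ i) then (if does (y Fin.≟ j) then a c else 0#) else 0#

    stepForm : Fin n → Fin 3 × Fin 3 → Form
    stepForm i (x , y) = stepEntry (step i) x y

    -- Row l holds the linear form that replaces the variable with index l = 9 i + 3 x + y, that is,
    -- the entry (x , y) of the i-th matrix.
    stepMap : LinearMap k (n ℕ.* 9)
    stepMap l = stepForm (proj₁ (remQuot {n} 9 l)) (remQuot {3} 3 (proj₂ (remQuot {n} 9 l)))

    stepMap-combine : ∀ i (x y : Fin 3) → stepMap (combine i (combine x y)) ≡ stepEntry (step i) x y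
    stepMap-combine i x y = ≡.trans
      (≡.cong (λ q → stepForm (proj₁ q) (remQuot {3} 3 (proj₂ q))) (Fin.remQuot-combine {n} {9} i (combine x y)))
      (≡.cong (stepForm i) (Fin.remQuot-combine {3} {3} x y))

    linearForm-stepEntry : ∀ s x y → linearForm (stepEntry s x y) ≋ instructionMatrix ⟦ s ⟧ x y
    linearForm-stepEntry (i , j , a) x y with does (x Fin.≟ i) | does (y Fin.≟ j)
    ... | true  | true  = R.refl
    ... | true  | false = linearForm-0
    ... | false | _     = linearForm-0

    coordinate-stepMap : ∀ i x y → coordinate stepMap (toℕ (combine i (combine x y))) ≋ stepMatrix i x y
    coordinate-stepMap i x y with toℕ (combine i (combine x y)) ℕ.<? n ℕ.* 9
    ... | no ≮  = contradiction (Fin.toℕ<n (combine i (combine x y))) ≮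
    ... | yes l = R.trans (R.reflexive (≡.cong linearForm
        (≡.trans (≡.cong stepMap (Fin.fromℕ<-toℕ (combine i (combine x y)) l)) (stepMap-combine i x y))))
      (linearForm-stepEntry (step i) x y)

    nce₃-stepMap : ∀ d → nce₃ n d ∘ₗ stepMap ≋ N.esum d stepMatrices
    nce₃-stepMap d = begin
      substitute t (nce₃ n d)
        ≈⟨ substitute-nce₃ t n d ⟩
      N.esum d (map (λ i → substituteₘ t (generic n i)) (allFin n))
        ≈⟨ esum-cong {d = d} (λ i x y → R.trans (substitute-var t (toℕ (combine i (combine x y)))) (coordinate-stepMap i x y)) (allFin n) ⟩
      N.esum d stepMatrices ∎
      where t = coordinate stepMap

    module _ {f : Poly} (adds : Adds (map ⟦_⟧ ss) 0F 1F f) (length≤ : length ss ℕ.≤ n) where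

      -- All entries of 1 + f E₁₂ add up to 3 + f.
      run-ones : ∑ (map (run (map ⟦_⟧ ss) N.ones) (allFin 3)) ≋ const (1# + (1# + 1#)) ⊕ f
      run-ones = begin
        ∑ (map (run (map ⟦_⟧ ss) N.ones) (allFin 3))
          ≈⟨ S.sum-cong (adds N.ones) (allFin 3) ⟩
        (1ₚ ⊕ f ⊗ 1ₚ) ⊕ (1ₚ ⊕ (1ₚ ⊕ 0ₚ))
          ≈⟨ R.+-cong (R.trans (R.+-congˡ {1ₚ} (R.*-identityʳ f)) (R.+-comm 1ₚ f)) (R.+-congˡ {1ₚ} (R.+-identityʳ 1ₚ)) ⟩
        (f ⊕ 1ₚ) ⊕ (1ₚ ⊕ 1ₚ)
          ≈⟨ R.trans (R.+-assoc f 1ₚ (1ₚ ⊕ 1ₚ)) (R.+-comm f (1ₚ ⊕ (1ₚ ⊕ 1ₚ))) ⟩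
        (1ₚ ⊕ (1ₚ ⊕ 1ₚ)) ⊕ f
          ≈⟨ R.+-congʳ {f} (R.trans (R.+-congˡ {1ₚ} (R.sym (const-+ 1# 1#))) (R.sym (const-+ 1# (1# + 1#)))) ⟩
        const (1# + (1# + 1#)) ⊕ f ∎

      -- The generating function at t = 1, where its factors 1 + Aᵢ are the elementary matrices of
      -- the padded program.
      generating-run : ∀ m → n ℕ.≤ m →
        const (1# + (1# + 1#)) ⊕ f ≋ Σ< (suc m) (λ e → nce₃ n e ∘ₗ stepMap)
      generating-run m n≤m = begin
        const (1# + (1# + 1#)) ⊕ f
          ≈⟨ run-ones ⟨
        ∑ (map (run (map ⟦_⟧ ss) N.ones) (allFin 3))
          ≈⟨ S.sum-cong (λ x → R.sym (run-padded ⟦_⟧ padding noop n ss N.ones x length≤)) (allFin 3) ⟩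
        ∑ (map (run (map (λ i → ⟦ step i ⟧) (allFin n)) N.ones) (allFin 3))
          ≈⟨ S.sum-cong (λ x → R.sym (acts-run (map (λ i → ⟦ step i ⟧) (allFin n)) N.ones x)) (allFin 3) ⟩
        ∑ (map (N.acts (map (N.shift 1ₚ) (map instructionMatrix (map (λ i → ⟦ step i ⟧) (allFin n)))) N.ones) (allFin 3))
          ≡⟨ ≡.cong (λ As → ∑ (map (N.acts (map (N.shift 1ₚ) As) N.ones) (allFin 3))) (map-∘ (allFin n)) ⟨
        ∑ (map (N.acts (map (N.shift 1ₚ) stepMatrices) N.ones) (allFin 3))
          ≈⟨ N.generating-sum 1ₚ stepMatrices m
               (ℕ.≤-trans (ℕ.≤-reflexive (≡.trans (length-map stepMatrix (allFin n)) (length-tabulate {n = n} (λ i → i)))) n≤m) ⟩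
        Σ< (suc m) (λ e → 1ₚ N.↑ e ⊗ N.esum e stepMatrices)
          ≈⟨ Σ<-cong (suc m) (λ e _ → R.trans
               (R.*-congʳ {N.esum e stepMatrices} (one-↑ e))
               (R.trans (R.*-identityˡ (N.esum e stepMatrices)) (R.sym (nce₃-stepMap e)))) ⟩
        Σ< (suc m) (λ e → nce₃ n e ∘ₗ stepMap) ∎
        where
        one-↑ : ∀ e → 1ₚ N.↑ e ≋ 1ₚ
        one-↑ zero    = R.refl
        one-↑ (suc e) = R.trans (R.*-congˡ {1ₚ} (one-↑ e)) (R.*-identityˡ 1ₚ)
        noop : ∀ u x → execute ⟦ padding ⟧ u x ≋ u x
        noop u x = addTo-0 0F u (R.trans (R.*-congʳ {u 1F} linearForm-0) (R.zeroˡ (u 1F))) x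

      -- The summands of `generating-run` are homogeneous of distinct degrees, so at a word of
      -- length d only the summand e = d contributes; the upper limit n + d makes it occur.
      coeff-nce₃-stepMap : ∀ {μ d} → length μ ≡ d → coeff (nce₃ n d ∘ₗ stepMap) μ ≈ coeff (const (1# + (1# + 1#)) ⊕ f) μ
      coeff-nce₃-stepMap {μ} {d} |μ|≡d = sym (trans
        (trans (coeff-≈ (generating-run (n ℕ.+ d) (ℕ.m≤m+n n d)) μ)
          (coeff-Σ< (suc (n ℕ.+ d)) (λ e → nce₃ n e ∘ₗ stepMap) μ))
        (Permanents.Σ<-single K (λ e → coeff (nce₃ n e ∘ₗ stepMap) μ) (ℕ.s≤s (ℕ.m≤n+m d n)) (λ e _ e≢d →
          word-coeff {e} (nce₃ n e ∘ₗ stepMap) (word-∘ₗ stepMap {nce₃ n e} (word-nce₃ n e))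
            (λ w → e≢d (≡.trans (≡.sym (proj₁ w)) |μ|≡d)))))

  coeff-const : ∀ c μ → 1 ℕ.≤ length μ → coeff (const c) μ ≈ 0#
  coeff-const c μ 1≤|μ| = word-coeff {0} {0} (const c) {μ} ((≡.refl , []) ∷ []) (λ w → ℕ.<⇒≢ 1≤|μ| (≡.sym (proj₁ w)))

  -- In positive degree neither the 3 contributed by the identity matrix nor the constant split off
  -- from the value of the tree is visible.
  tree-nce₃ : ∀ {h n} T → leaves T ℕ.≤ 4 ℕ.* 2 ℕ.^ h → programLength h ℕ.≤ n →
    ∃ λ (A : LinearMap k (n ℕ.* 9)) → ∀ μ d → length μ ≡ suc d → coeff (nce₃ n (suc d) ∘ₗ A) μ ≈ coeff (valueᵗ T) μ
  tree-nce₃ {h} {n} T T≤ ≤n =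
    let computable c f value≋ addable = bounded h T T≤
        ss , ss≤ , adds = addable 1# {0F} {1F} (λ ())
    in stepMap ss n , λ μ d |μ|≡ →
    trans (coeff-nce₃-stepMap ss n {const 1# ⊗ f} adds (ℕ.≤-trans ss≤ ≤n) |μ|≡)
      (trans (lemma (1# + (1# + 1#)) (const 1# ⊗ f) μ d |μ|≡)
        (trans (coeff-≈ (R.*-identityˡ f) μ) (sym (trans (coeff-≈ value≋ μ) (lemma c f μ d |μ|≡)))))
    where
    lemma : ∀ c f μ d → length μ ≡ suc d → coeff (const c ⊕ f) μ ≈ coeff f μ
    lemma c f μ d eq = trans (coeff-⊕ (const c) f μ)
      (trans (+-congʳ (coeff-const c μ (ℕ.≤-trans (ℕ.s≤s ℕ.z≤n) (ℕ.≤-reflexive (≡.sym eq))))) (+-identityˡ _))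

  -- Formulas with the variables from x_k on set to zero

  restriction : ℕ → Poly
  restriction i with i ℕ.<? k
  ... | yes _ = var i
  ... | no  _ = 0ₚ

  Inside : Monomial → Set
  Inside = All (ℕ._< k)

  inside? : ∀ μ → Dec (Inside μ)
  inside? = All.all? (ℕ._<? k)

  restriction-inside : ∀ {i} → i ℕ.< k → restriction i ≡ var i
  restriction-inside {i} i<k with i ℕ.<? k
  ... | yes _   = ≡.refl
  ... | no  i≮k = contradiction i<k i≮k

  restriction-outside : ∀ {i} → ¬ (i ℕ.< k) → restriction i ≡ 0ₚ
  restriction-outside {i} i≮k with i ℕ.<? k
  ... | yes i<k = contradiction i<k i≮k
  ... | no  _   = ≡.refl

  monomial-inside : ∀ {ν} → Inside ν → monomial restriction ν ≋ (1# , ν) ∷ []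
  monomial-inside []                = R.refl
  monomial-inside {i ∷ ν} (h ∷ hs) = R.trans
    (R.*-cong (R.reflexive (restriction-inside h)) (monomial-inside hs))
    (pair≈⇒≋ λ φ _ → +-congʳ (*-congʳ (*-identityˡ 1#)))

  monomial-outside : ∀ {ν} → ¬ Inside ν → monomial restriction ν ≋ 0ₚ
  monomial-outside {[]}    h = contradiction [] h
  monomial-outside {i ∷ ν} h = go (i ℕ.<? k)
    where
    go : Dec (i ℕ.< k) → restriction i ⊗ monomial restriction ν ≋ 0ₚ
    go (no i≮k)  = R.trans (R.*-congʳ {monomial restriction ν} (R.reflexive (restriction-outside i≮k))) (R.zeroˡ (monomial restriction ν))
    go (yes i<k) = R.trans (R.*-congˡ {restriction i} (monomial-outside (λ hν → h (i<k ∷ hν)))) (R.zeroʳ (restriction i))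

  coeff-restrict-inside : ∀ p {μ} → Inside μ → coeff (substitute restriction p) μ ≈ coeff p μ
  coeff-restrict-inside p {μ} hμ = trans (coeff-substitute restriction p μ)
    (trans (pair-congˡ entry p) (sym (coeff-pair p μ)))
    where
    entry : ∀ ν → coeff (monomial restriction ν) μ ≈ δ μ ν
    entry ν with inside? ν
    ... | yes hν = trans (coeff-≈ (monomial-inside hν) μ)
      (trans (coeff-pair ((1# , ν) ∷ []) μ) (trans (+-identityʳ _) (*-identityˡ _)))
    ... | no ¬hν = trans (coeff-≈ (monomial-outside ¬hν) μ) (sym (δ-outside ν ¬hν))
      where
      δ-outside : ∀ ν → ¬ Inside ν → δ μ ν ≈ 0#
      δ-outside ν ¬hν with ν ↭? μ
      ... | yes ν↭μ = contradiction (All-resp-↭ (↭-sym ν↭μ) hμ) ¬hν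
      ... | no _    = refl

  coeff-restrict-outside : ∀ p {μ} → ¬ Inside μ → coeff (substitute restriction p) μ ≈ 0#
  coeff-restrict-outside p {μ} ¬hμ = trans (coeff-substitute restriction p μ) (pair-0 entry p)
    where
    entry : ∀ ν → coeff (monomial restriction ν) μ ≈ 0#
    entry ν with inside? ν
    ... | no ¬hν = coeff-≈ (monomial-outside ¬hν) μ
    ... | yes hν = trans (coeff-≈ (monomial-inside hν) μ)
      (terms-coeff {Inside} ((1# , ν) ∷ []) (hν ∷ []) (λ ρ↭μ hρ → ¬hμ (All-resp-↭ ρ↭μ hρ)))

  coeff-linearForm : ∀ (a : Form) i → coeff (linearForm a) (toℕ i ∷ []) ≈ a i
  coeff-linearForm a i = trans (coeff-∑ (λ j → const (a j) ⊗ var (toℕ j)) (allFin k))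
    (trans (SK.sum-cong term (allFin k)) (NK.sum-diagonal a i))
    where
    μ = toℕ i ∷ []
    coeff-∑ : ∀ (f : Fin k → Poly) is → coeff (∑ (map f is)) μ ≈ SK.sum (map (λ j → coeff (f j) μ) is)
    coeff-∑ f []       = refl
    coeff-∑ f (j ∷ is) = trans (coeff-⊕ (f j) (∑ (map f is)) μ) (+-congˡ (coeff-∑ f is))
    term : ∀ j → coeff (const (a j) ⊗ var (toℕ j)) μ ≈ NK.𝟙 i j * a j
    term j = trans (coeff-const-⊗ (a j) (var (toℕ j)) μ) (trans (*-comm _ _) (*-congʳ
      (trans (coeff-pair (var (toℕ j)) μ) (trans (+-identityʳ _) (trans (*-identityˡ _)
        (reflexive (≡.cong (if_then 1# else 0#) (does-⇔ (mk⇔ singleton λ { ≡.refl → ↭-refl }) ((toℕ j ∷ []) ↭? μ) (i Fin.≟ j)))))))))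
      where
      singleton : (toℕ j ∷ []) ↭ (toℕ i ∷ []) → i ≡ j
      singleton π with All-resp-↭ {P = toℕ j ≡_} π (≡.refl ∷ [])
      ... | e ∷ [] = Fin.toℕ-injective (≡.sym e)

  -- Affinity is a condition on coefficients, and the list `p` may contain long words that cancel.
  -- The leaf is therefore rebuilt from the coefficients at the words of length 0 and 1.
  restrict-affine : ∀ p → Affine p →
    const (coeff p []) ⊕ linearForm {k} (λ i → coeff p (toℕ i ∷ [])) ≋ substitute restriction p
  restrict-affine p affine = mk≋ λ μ → trans (coeff-⊕ (const c) (linearForm a) μ) (go μ (inside? μ))
    where
    c : Scalar
    c = coeff p []
    a : Form
    a i = coeff p (toℕ i ∷ [])
    not-linear : ∀ {μ} → ¬ Word 1 k μ → coeff (linearForm a) μ ≈ 0#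
    not-linear = word-coeff {1} {k} (linearForm a) (word-linearForm a)
    go : ∀ μ → Dec (Inside μ) → coeff (const c) μ + coeff (linearForm a) μ ≈ coeff (substitute restriction p) μ
    go [] _ = trans (+-cong (trans (coeff-pair (const c) []) (trans (+-identityʳ _) (*-identityʳ c)))
        (not-linear (λ ())))
      (trans (+-identityʳ c) (sym (coeff-restrict-inside p {[]} [])))
    go (i ∷ []) (yes (i<k ∷ [])) = trans (+-cong (coeff-const c (i ∷ []) ℕ.≤-refl)
        (trans (reflexive (≡.cong (λ j → coeff (linearForm a) (j ∷ [])) (≡.sym (Fin.toℕ-fromℕ< i<k))))
          (coeff-linearForm a (fromℕ< i<k))))
      (trans (+-identityˡ _) (trans (reflexive (≡.cong (λ j → coeff p (j ∷ [])) (Fin.toℕ-fromℕ< i<k)))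
        (sym (coeff-restrict-inside p (i<k ∷ [])))))
    go (i ∷ []) (no ¬h) = trans (+-cong (coeff-const c (i ∷ []) ℕ.≤-refl)
        (not-linear (¬h ∘ proj₂)))
      (trans (+-identityˡ 0#) (sym (coeff-restrict-outside p ¬h)))
    go μ@(i ∷ j ∷ ν) h = trans (+-cong (coeff-const c μ (ℕ.s≤s ℕ.z≤n))
        (not-linear (λ ())))
      (trans (+-identityˡ 0#) (sym (vanishes h)))
      where
      vanishes : Dec (Inside μ) → coeff (substitute restriction p) μ ≈ 0#
      vanishes (yes hμ) = trans (coeff-restrict-inside p hμ) (affine μ (ℕ.s≤s (ℕ.s≤s ℕ.z≤n)))
      vanishes (no ¬hμ) = coeff-restrict-outside p ¬hμ

  restrict : Formula → Tree
  restrict (leaf p _) = leaf (coeff p []) (λ i → coeff p (toℕ i ∷ []))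
  restrict (add F G)  = add (restrict F) (restrict G)
  restrict (mul F G)  = mul (restrict F) (restrict G)

  value-restrict : ∀ F → valueᵗ (restrict F) ≋ substitute restriction (value F)
  value-restrict (leaf p h) = restrict-affine p h
  value-restrict (add F G)  = R.trans (R.+-cong (value-restrict F) (value-restrict G))
    (R.sym (substitute-⊕ restriction (value F) (value G)))
  value-restrict (mul F G)  = R.trans (R.*-cong (value-restrict F) (value-restrict G))
    (R.sym (substitute-⊗ restriction (value F) (value G)))

  leaves-restrict : ∀ F → leaves (restrict F) ℕ.≤ size F
  leaves-restrict (leaf _ _) = ℕ.≤-refl
  leaves-restrict (add F G)  = ℕ.m≤n⇒m≤1+n (ℕ.+-mono-≤ (leaves-restrict F) (leaves-restrict G))
  leaves-restrict (mul F G)  = ℕ.m≤n⇒m≤1+n (ℕ.+-mono-≤ (leaves-restrict F) (leaves-restrict G))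

  -- The polynomial `p` may be inhomogeneous and may involve further variables, as the approximants
  -- of a border computation do. Agreement is claimed at the words of the chosen degree in the first
  -- k variables; elsewhere the substituted `nce₃` vanishes by homogeneity.
  formula-nce₃ : ∀ {h n s p} d → FormulaSize≤ p s → s ℕ.≤ 4 ℕ.* 2 ℕ.^ h → programLength h ℕ.≤ n →
    ∃ λ (A : LinearMap k (n ℕ.* 9)) →
      (∀ {μ} → Word (suc d) k μ → coeff (nce₃ n (suc d) ∘ₗ A) μ ≈ coeff p μ) ×
      (∀ {μ} → ¬ Word (suc d) k μ → coeff (nce₃ n (suc d) ∘ₗ A) μ ≈ 0#)
  formula-nce₃ {h} {n} {p = p} d (F , size≤s , value≋p) s≤ ≤n =
    let A , agrees = tree-nce₃ {h} {n} (restrict F) (ℕ.≤-trans (leaves-restrict F) (ℕ.≤-trans size≤s s≤)) ≤n in A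
    , (λ {μ} w → trans (agrees μ d (proj₁ w)) (trans (coeff-≈ (value-restrict F) μ)
        (trans (coeff-restrict-inside (value F) (proj₂ w)) (coeff-≈ value≋p μ))))
    , word-coeff (nce₃ n (suc d) ∘ₗ A) (word-∘ₗ A {nce₃ n (suc d)} (word-nce₃ n (suc d)))

-- Polynomial and quasipolynomial growth

module Growth where

  open import Data.Nat.Base
  open import Data.Nat.Properties
  open import Relation.Binary.PropositionalEquality using (refl; sym; trans; cong)
  open ℕ-Solver using (solve; _:+_; _:*_; _:=_; con)

  n≤2^n : ∀ n → n ≤ 2 ^ n
  n≤2^n n = <⇒≤ (go n)
    where
    go : ∀ n → n < 2 ^ n
    go zero    = s≤s z≤n
    go (suc n) = ≤-trans (s≤s (go n)) (≤-trans (+-monoˡ-≤ (2 ^ n) (m^n>0 2 n))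
      (≤-reflexive (cong (2 ^ n +_) (sym (+-identityʳ _)))))

  module _ {x : ℕ} (2≤x : 2 ≤ x) where

    private instance
      x-nonZero : NonZero x
      x-nonZero = >-nonZero (≤-trans (s≤s z≤n) 2≤x)

    c≤x^c : ∀ c → c ≤ x ^ c
    c≤x^c c = ≤-trans (n≤2^n c) (^-monoˡ-≤ c 2≤x)

    x^-mono : ∀ {a b} → a ≤ b → x ^ a ≤ x ^ b
    x^-mono = ^-monoʳ-≤ x

    x^a+x^b≤ : ∀ a b → x ^ a + x ^ b ≤ x ^ suc (a + b)
    x^a+x^b≤ a b = ≤-trans (+-mono-≤ (x^-mono (m≤m+n a b)) (x^-mono (m≤n+m b a)))
      (≤-trans (≤-reflexive (cong (x ^ (a + b) +_) (sym (+-identityʳ _)))) (*-monoˡ-≤ (x ^ (a + b)) 2≤x))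

    2+x^a≤ : ∀ a → 2 + x ^ a ≤ x ^ (2 + a)
    2+x^a≤ a = ≤-trans (+-monoˡ-≤ (x ^ a) (≤-trans 2≤x (≤-reflexive (sym (*-identityʳ x))))) (x^a+x^b≤ 1 a)

  2≤2+ : ∀ {n} → 2 ≤ 2 + n
  2≤2+ = s≤s (s≤s z≤n)

  -- Polynomial bounds are normalised to powers of 2 + n. This base is at least 2 even for n = 0, so
  -- constants and sums are absorbed by a larger exponent.
  eval≤ : ∀ t → ∃[ c ] (∀ n → eval t n ≤ (2 + n) ^ c)
  eval≤ []      = 0 , λ _ → z≤n
  eval≤ (a ∷ t) = let c , h = eval≤ t in suc (a + suc c) , λ n →
    ≤-trans (+-mono-≤ (c≤x^c (2≤2+ {n}) a) (*-mono-≤ (m≤n+m n 2) (h n))) (x^a+x^b≤ 2≤2+ a (suc c))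

  times : ℕ → List ℕ → List ℕ
  times a []      = a ∷ []
  times a (b ∷ t) = a + 2 * b ∷ times b t

  eval-times : ∀ a t n → eval (times a t) n ≡ a + (2 + n) * eval t n
  eval-times a []      n = cong (a +_) (trans (*-zeroʳ n) (sym (*-zeroʳ (2 + n))))
  eval-times a (b ∷ t) n = trans (cong (λ v → a + 2 * b + n * v) (eval-times b t n))
    (solve 4 (λ a b n e → a :+ con 2 :* b :+ n :* (b :+ (con 2 :+ n) :* e) := a :+ (con 2 :+ n) :* (b :+ n :* e)) refl a b n (eval t n))

  power : ℕ → List ℕ
  power zero    = 1 ∷ []
  power (suc c) = times 0 (power c)

  eval-power : ∀ c n → eval (power c) n ≡ (2 + n) ^ c
  eval-power zero    n = cong suc (*-zeroʳ n)
  eval-power (suc c) n = trans (eval-times 0 (power c) n) (cong ((2 + n) *_) (eval-power c n))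

  poly-normal : ∀ {m} → PolynomiallyBounded m → ∃[ c ] (∀ n → m n ≤ (2 + n) ^ c)
  poly-normal (t , h) = let c , g = eval≤ t in c , λ n → ≤-trans (h n) (g n)

  poly-intro : ∀ {m} c → (∀ n → m n ≤ (2 + n) ^ c) → PolynomiallyBounded m
  poly-intro c h = power c , λ n → ≤-trans (h n) (≤-reflexive (sym (eval-power c n)))

  -- A logarithm rounded up, together with the reverse estimate that makes b^h polynomial in n for
  -- each fixed b.
  log-exponent : ∀ n → ∃[ h ] n ≤ 2 ^ h × 2 ^ h ≤ 2 * (2 + n)
  log-exponent zero    = 0 , z≤n , s≤s z≤n
  log-exponent (suc n) with log-exponent n
  ... | h , n≤ , ≤n with suc n ≤? 2 ^ h
  ...   | yes 1+n≤ = h , 1+n≤ , ≤-trans ≤n (*-monoʳ-≤ 2 (n≤1+n (2 + n)))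
  ...   | no  1+n≰ = suc h
        , ≤-trans (+-mono-≤ (m^n>0 2 h) n≤) (≤-reflexive (cong (2 ^ h +_) (sym (+-identityʳ _))))
        , *-monoʳ-≤ 2 (≤-trans (≤-pred (≰⇒> 1+n≰)) (m≤n+m n 3))

  lg : ℕ → ℕ
  lg n = proj₁ (log-exponent n)

  n≤2^lg : ∀ n → n ≤ 2 ^ lg n
  n≤2^lg n = proj₁ (proj₂ (log-exponent n))

  2^lg≤ : ∀ n → 2 ^ lg n ≤ (2 + n) ^ 2
  2^lg≤ n = ≤-trans (proj₂ (proj₂ (log-exponent n)))
    (≤-trans (*-monoˡ-≤ (2 + n) (2≤2+ {n})) (≤-reflexive (cong ((2 + n) *_) (sym (*-identityʳ (2 + n))))))

  power-lg≤ : ∀ {b} e n → b ≤ 2 ^ e → b ^ lg n ≤ (2 + n) ^ (2 * e)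
  power-lg≤ {b} e n b≤2^e = begin
    b ^ lg n  ≤⟨ ^-monoˡ-≤ (lg n) b≤2^e ⟩
    (2 ^ e) ^ lg n     ≡⟨ ^-*-assoc 2 e (lg n) ⟩
    2 ^ (e * lg n)     ≡⟨ cong (2 ^_) (*-comm e (lg n)) ⟩
    2 ^ (lg n * e)     ≡⟨ ^-*-assoc 2 (lg n) e ⟨
    (2 ^ lg n) ^ e     ≤⟨ ^-monoˡ-≤ e (2^lg≤ n) ⟩
    ((2 + n) ^ 2) ^ e  ≡⟨ ^-*-assoc (2 + n) 2 e ⟩
    (2 + n) ^ (2 * e) ∎
    where open ≤-Reasoning

  module _ {I : Set} (x : I → ℕ) (2≤x : ∀ i → 2 ≤ x i) where

    record PowerBounded (f : I → ℕ) : Set where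
      constructor power-bounded
      field
        exponent : ℕ
        bounds   : ∀ i → f i ≤ x i ^ exponent

    power-const : ∀ c → PowerBounded (λ _ → c)
    power-const c = power-bounded c λ i → c≤x^c (2≤x i) c

    power-+ : ∀ {f g} → PowerBounded f → PowerBounded g → PowerBounded (λ i → f i + g i)
    power-+ (power-bounded a p) (power-bounded b q) = power-bounded (suc (a + b)) λ i →
      ≤-trans (+-mono-≤ (p i) (q i)) (x^a+x^b≤ (2≤x i) a b)

    power-* : ∀ {f g} → PowerBounded f → PowerBounded g → PowerBounded (λ i → f i * g i)
    power-* (power-bounded a p) (power-bounded b q) = power-bounded (a + b) λ i →
      ≤-trans (*-mono-≤ (p i) (q i)) (≤-reflexive (sym (^-distribˡ-+-* (x i) a b)))

  -- The closure properties behind the two directions of the equivalences: `power-closed` turns a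
  -- bound on complexity into one on program length, and `∘-closed` bounds the formula size obtained
  -- from a reduction m applied to permanents of polynomial size N.
  record Boundedness (Bounded : (ℕ → ℕ) → Set) : Set where
    field
      power-closed : ∀ {m r} c → Bounded m → (∀ n → r n ≤ (2 + m n) ^ c) → Bounded r
      ∘-closed     : ∀ {m N r} c → Bounded m → PolynomiallyBounded N →
                     (∀ n → r n ≤ (2 + (m (N n) + N n)) ^ c) → Bounded r

  poly-growth : Boundedness PolynomiallyBounded
  poly-growth = record
    { power-closed = λ c bm h → let a , hm = poly-normal bm in poly-intro ((2 + a) * c) λ n →
        ≤-trans (h n) (≤-trans (^-monoˡ-≤ c (≤-trans (+-monoʳ-≤ 2 (hm n)) (2+x^a≤ (2≤2+ {n}) a)))
          (≤-reflexive (^-*-assoc (2 + n) (2 + a) c)))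
    ; ∘-closed = λ {m} {N} {r} c bm bN h →
        let a , hm = poly-normal bm
            b , hN = poly-normal bN
        in poly-intro ((2 + b) * ((2 + suc (a + 1)) * c)) λ n → let open ≤-Reasoning in begin
          r n  ≤⟨ h n ⟩
          (2 + (m (N n) + N n)) ^ c  ≤⟨ ^-monoˡ-≤ c (+-monoʳ-≤ 2 (+-mono-≤ (hm (N n))
             (≤-trans (m≤n+m (N n) 2) (≤-reflexive (sym (*-identityʳ (2 + N n))))))) ⟩
          (2 + ((2 + N n) ^ a + (2 + N n) ^ 1)) ^ c ≤⟨ ^-monoˡ-≤ c (+-monoʳ-≤ 2 (x^a+x^b≤ (2≤2+ {N n}) a 1)) ⟩
          (2 + (2 + N n) ^ suc (a + 1)) ^ c  ≤⟨ ^-monoˡ-≤ c (2+x^a≤ (2≤2+ {N n}) (suc (a + 1))) ⟩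
          ((2 + N n) ^ (2 + suc (a + 1))) ^ c       ≡⟨ ^-*-assoc (2 + N n) (2 + suc (a + 1)) c ⟩
          (2 + N n) ^ ((2 + suc (a + 1)) * c)       ≤⟨ ^-monoˡ-≤ ((2 + suc (a + 1)) * c)
             (≤-trans (+-monoʳ-≤ 2 (hN n)) (2+x^a≤ (2≤2+ {n}) b)) ⟩
          ((2 + n) ^ (2 + b)) ^ ((2 + suc (a + 1)) * c) ≡⟨ ^-*-assoc (2 + n) (2 + b) ((2 + suc (a + 1)) * c) ⟩
          (2 + n) ^ ((2 + b) * ((2 + suc (a + 1)) * c)) ∎
    }

  record Quasi (f : ℕ → ℕ) : Set where
    constructor quasi
    field
      exponent : ℕ
      bounds   : ∀ n → 2 ≤ n → f n ≤ n ^ ((2 + ⌈log₂ n ⌉) ^ exponent)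

  quasi-normal : ∀ {m} → QuasipolynomiallyBounded m → Quasi m
  quasi-normal (q , h) = let c , g = eval≤ q in quasi c λ n 2≤n →
    ≤-trans (h n 2≤n) (x^-mono 2≤n (g ⌈log₂ n ⌉))

  quasi-intro : ∀ {m} → Quasi m → QuasipolynomiallyBounded m
  quasi-intro (quasi c h) = power c , λ n 2≤n →
    ≤-trans (h n 2≤n) (≤-reflexive (cong (n ^_) (sym (eval-power c ⌈log₂ n ⌉))))

  module _ {n} (2≤n : 2 ≤ n) where

    private
      Z = 2 + ⌈log₂ n ⌉
      2≤Z : 2 ≤ Z
      2≤Z = 2≤2+

    tower-const : ∀ c → c ≤ n ^ (Z ^ c)
    tower-const c = ≤-trans (c≤x^c 2≤n c) (x^-mono 2≤n (c≤x^c 2≤Z c))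

    tower-+ : ∀ a b → n ^ (Z ^ a) + n ^ (Z ^ b) ≤ n ^ (Z ^ (3 + (a + b)))
    tower-+ a b = ≤-trans (x^a+x^b≤ 2≤n (Z ^ a) (Z ^ b)) (x^-mono 2≤n (≤-trans
      (s≤s (x^a+x^b≤ 2≤Z a b)) (≤-trans (n≤1+n _) (2+x^a≤ 2≤Z (suc (a + b))))))

    tower-^ : ∀ a c → (n ^ (Z ^ a)) ^ c ≤ n ^ (Z ^ (a + c))
    tower-^ a c = ≤-trans (≤-reflexive (^-*-assoc n (Z ^ a) c)) (x^-mono 2≤n
      (≤-trans (*-monoʳ-≤ (Z ^ a) (c≤x^c 2≤Z c)) (≤-reflexive (sym (^-distribˡ-+-* Z a c)))))

  quasi-mono : ∀ {f g} → (∀ n → 2 ≤ n → f n ≤ g n) → Quasi g → Quasi f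
  quasi-mono h (quasi e q) = quasi e λ n 2≤n → ≤-trans (h n 2≤n) (q n 2≤n)

  quasi-const : ∀ c → Quasi (λ _ → c)
  quasi-const c = quasi c λ n 2≤n → tower-const 2≤n c

  quasi-+ : ∀ {f g} → Quasi f → Quasi g → Quasi (λ n → f n + g n)
  quasi-+ (quasi a p) (quasi b q) = quasi (3 + (a + b)) λ n 2≤n →
    ≤-trans (+-mono-≤ (p n 2≤n) (q n 2≤n)) (tower-+ 2≤n a b)

  quasi-^ : ∀ {f} c → Quasi f → Quasi (λ n → f n ^ c)
  quasi-^ c (quasi a p) = quasi (a + c) λ n 2≤n → ≤-trans (^-monoˡ-≤ c (p n 2≤n)) (tower-^ 2≤n a c)

  2+n≤n^2 : ∀ {n} → 2 ≤ n → 2 + n ≤ n ^ 2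
  2+n≤n^2 {n} 2≤n = ≤-trans (+-monoˡ-≤ n 2≤n)
    (≤-trans (≤-reflexive (cong (n +_) (sym (+-identityʳ n))))
      (≤-trans (*-monoˡ-≤ n 2≤n) (≤-reflexive (cong (n *_) (sym (*-identityʳ n))))))

  n≤2^⌈log₂n⌉ : ∀ n → n ≤ 2 ^ ⌈log₂ n ⌉
  n≤2^⌈log₂n⌉ = <-rec (λ n → n ≤ 2 ^ ⌈log₂ n ⌉) go
    where
    go : ∀ n → (∀ {m} → m < n → m ≤ 2 ^ ⌈log₂ m ⌉) → n ≤ 2 ^ ⌈log₂ n ⌉
    go zero          ih = z≤n
    go (suc zero)    ih = ≤-refl
    go n@(suc (suc m)) ih = begin
      n  ≡⟨ ⌊n/2⌋+⌈n/2⌉≡n n ⟨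
      ⌊ n /2⌋ + ⌈ n /2⌉  ≤⟨ +-monoˡ-≤ ⌈ n /2⌉ (⌊n/2⌋≤⌈n/2⌉ n) ⟩
      ⌈ n /2⌉ + ⌈ n /2⌉  ≡⟨ cong (⌈ n /2⌉ +_) (+-identityʳ _) ⟨
      2 * ⌈ n /2⌉  ≤⟨ *-monoʳ-≤ 2 (ih (⌈n/2⌉<n m)) ⟩
      2 ^ suc ⌈log₂ ⌈ n /2⌉ ⌉  ≡⟨ cong (λ l → 2 ^ suc l) (⌈log₂⌈n/2⌉⌉≡⌈log₂n⌉∸1 n) ⟩
      2 ^ suc (⌈log₂ n ⌉ ∸ 1)  ≡⟨ cong (2 ^_) (m+[n∸m]≡n (⌈log₂⌉-mono-≤ {2} {n} (s≤s (s≤s z≤n)))) ⟩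
      2 ^ ⌈log₂ n ⌉ ∎
      where open ≤-Reasoning

  ⌈log₂⌉-^ : ∀ {m n} e → m ≤ n ^ e → ⌈log₂ m ⌉ ≤ ⌈log₂ n ⌉ * e
  ⌈log₂⌉-^ {m} {n} e m≤ = ≤-trans (⌈log₂⌉-mono-≤ (≤-trans m≤ (≤-trans (^-monoˡ-≤ e (n≤2^⌈log₂n⌉ n))
    (≤-reflexive (^-*-assoc 2 ⌈log₂ n ⌉ e))))) (≤-reflexive (⌈log₂2^n⌉≡n (⌈log₂ n ⌉ * e)))

  -- The logarithm of N n is at most a constant times that of n, so the exponent remains polynomial
  -- in the logarithm of n.
  quasi-∘ : ∀ {m N : ℕ → ℕ} b → Quasi m → (∀ n → N n ≤ (2 + n) ^ b) → Quasi (λ n → m (N n))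
  quasi-∘ {m} {N} b (quasi a qm) hN = quasi-mono bound (quasi-+ (quasi-const (m 0 + m 1)) (quasi e λ _ _ → ≤-refl))
    where
    e : ℕ
    e = 2 * b + (2 + 2 * b) * a
    bound : ∀ n → 2 ≤ n → m (N n) ≤ (m 0 + m 1) + n ^ ((2 + ⌈log₂ n ⌉) ^ e)
    bound n 2≤n with N n in eq
    -- A quasipolynomial bound says nothing about m at 0 and 1; these two values enter as a
    -- constant.
    ... | zero        = ≤-trans (m≤m+n (m 0) (m 1)) (m≤m+n _ _)
    ... | suc zero    = ≤-trans (m≤n+m (m 1) (m 0)) (m≤m+n _ _)
    ... | suc (suc k) = ≤-trans (begin
      m p  ≤⟨ qm p (s≤s (s≤s z≤n)) ⟩
      p ^ ((2 + ⌈log₂ p ⌉) ^ a)  ≤⟨ ^-monoˡ-≤ ((2 + ⌈log₂ p ⌉) ^ a) p≤ ⟩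
      (n ^ (2 * b)) ^ ((2 + ⌈log₂ p ⌉) ^ a)      ≡⟨ ^-*-assoc n (2 * b) _ ⟩
      n ^ (2 * b * (2 + ⌈log₂ p ⌉) ^ a)  ≤⟨ x^-mono 2≤n exponent ⟩
      n ^ (Z ^ e) ∎) (m≤n+m _ _)
      where
      open ≤-Reasoning
      p = suc (suc k)
      Z = 2 + ⌈log₂ n ⌉
      2≤Z : 2 ≤ Z
      2≤Z = 2≤2+
      p≤ : p ≤ n ^ (2 * b)
      p≤ = ≤-trans (≤-reflexive (sym eq)) (≤-trans (hN n) (≤-trans (^-monoˡ-≤ b (2+n≤n^2 2≤n))
        (≤-reflexive (^-*-assoc n 2 b))))
      log≤ : 2 + ⌈log₂ p ⌉ ≤ Z ^ (2 + 2 * b)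
      log≤ = begin
        2 + ⌈log₂ p ⌉  ≤⟨ +-mono-≤ (m≤m+n 2 ⌈log₂ n ⌉) (⌈log₂⌉-^ (2 * b) p≤) ⟩
        Z + ⌈log₂ n ⌉ * (2 * b)      ≤⟨ +-monoʳ-≤ Z (*-monoˡ-≤ (2 * b) (m≤n+m ⌈log₂ n ⌉ 2)) ⟩
        Z + Z * (2 * b)  ≡⟨ *-suc Z (2 * b) ⟨
        Z * suc (2 * b)  ≤⟨ *-monoʳ-≤ Z (c≤x^c 2≤Z (suc (2 * b))) ⟩
        Z ^ (2 + 2 * b) ∎
      exponent : 2 * b * (2 + ⌈log₂ p ⌉) ^ a ≤ Z ^ e
      exponent = begin
        2 * b * (2 + ⌈log₂ p ⌉) ^ a  ≤⟨ *-mono-≤ (c≤x^c 2≤Z (2 * b)) (^-monoˡ-≤ a log≤) ⟩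
        Z ^ (2 * b) * (Z ^ (2 + 2 * b)) ^ a       ≡⟨ cong (Z ^ (2 * b) *_) (^-*-assoc Z (2 + 2 * b) a) ⟩
        Z ^ (2 * b) * Z ^ ((2 + 2 * b) * a)       ≡⟨ ^-distribˡ-+-* Z (2 * b) ((2 + 2 * b) * a) ⟨
        Z ^ e ∎

  poly⇒quasi : ∀ {N : ℕ → ℕ} b → (∀ n → N n ≤ (2 + n) ^ b) → Quasi N
  poly⇒quasi b hN = quasi (2 * b) λ n 2≤n → ≤-trans (hN n) (≤-trans (^-monoˡ-≤ b (2+n≤n^2 2≤n))
    (≤-trans (≤-reflexive (^-*-assoc n 2 b)) (x^-mono 2≤n (c≤x^c {2 + ⌈log₂ n ⌉} (2≤2+ {⌈log₂ n ⌉}) (2 * b)))))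

  quasi-growth : Boundedness QuasipolynomiallyBounded
  quasi-growth = record
    { power-closed = λ {m} {r} c bm h →
        quasi-intro (quasi-mono {r} {λ n → (2 + m n) ^ c} (λ n _ → h n)
          (quasi-^ {λ n → 2 + m n} c (quasi-+ {λ _ → 2} {m} (quasi-const 2) (quasi-normal bm))))
    ; ∘-closed = λ {m} {N} {r} c bm bN h →
        let b , hN = poly-normal bN
        in quasi-intro (quasi-mono {r} {λ n → (2 + (m (N n) + N n)) ^ c} (λ n _ → h n)
             (quasi-^ {λ n → 2 + (m (N n) + N n)} c (quasi-+ {λ _ → 2} {λ n → m (N n) + N n} (quasi-const 2)
               (quasi-+ {λ n → m (N n)} {N} (quasi-∘ {m} {N} b (quasi-normal bm) hN) (poly⇒quasi {N} b hN)))))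
    }

-- Limits of numbers and continuity of linear functionals

module Limits where

  open import Defs
  open import Relation.Binary.PropositionalEquality using (refl; sym; trans; cong; subst)
  open ℚ-Solver using (solve; _:+_; _:*_; _:-_; :-_; _:=_; con)
  open PolynomialRing Complex.commutativeRing using (pair; Invariant; pair-without; pair-cong; without; coeff-without-↭; coeff-without-≁)

  -- z s tends to 0 as s grows, where each z s is a sequence of rationals that
  -- stands for a real number and hence is only considered eventually.
  Null : (ℕ → ℕ → ℚ) → Set
  Null z = ∀ ε → 0ℚ ℚ.< ε → ∃[ N ] (∀ s → N ℕ.≤ s → ∃[ M ] (∀ n → M ℕ.≤ n → ℚ.∣ z s n ∣ ℚ.≤ ε))

  0<½* : ∀ {ε} → 0ℚ ℚ.< ε → 0ℚ ℚ.< ½ ℚ.* ε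
  0<½* {ε} 0<ε = subst (ℚ._< ½ ℚ.* ε) (ℚ.*-zeroʳ ½) (ℚ.*-monoʳ-<-pos ½ 0<ε)

  ½*+½* : ∀ ε → ½ ℚ.* ε ℚ.+ ½ ℚ.* ε ≡ ε
  ½*+½* = solve 1 (λ e → con ½ :* e :+ con ½ :* e := e) refl

  null-resp : ∀ {z w} → (∀ s n → z s n ≡ w s n) → Null z → Null w
  null-resp e h ε 0<ε = let N , h′ = h ε 0<ε in N , λ s N≤s → let M , h″ = h′ s N≤s in
    M , λ n M≤n → subst (λ q → ℚ.∣ q ∣ ℚ.≤ ε) (e s n) (h″ n M≤n)

  null-vanishing : ∀ {z} → (∀ s → Vanishing₁.Vanishes (z s)) → Null z
  null-vanishing h ε 0<ε = 0 , λ s _ → let M , h′ = h s ε 0<ε in M , λ n M≤n → ℚ.<⇒≤ (h′ n M≤n)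

  null-neg : ∀ {z} → Null z → Null (λ s n → ℚ.- z s n)
  null-neg {z} h ε 0<ε = let N , h′ = h ε 0<ε in N , λ s N≤s → let M , h″ = h′ s N≤s in
    M , λ n M≤n → subst (ℚ._≤ ε) (sym (ℚ.∣-p∣≡∣p∣ (z s n))) (h″ n M≤n)

  null-+ : ∀ {z w} → Null z → Null w → Null (λ s n → z s n ℚ.+ w s n)
  null-+ {z} {w} hz hw ε 0<ε =
    let N , z≤ = hz (½ ℚ.* ε) (0<½* 0<ε)
        N′ , w≤ = hw (½ ℚ.* ε) (0<½* 0<ε)
    in N ℕ.⊔ N′ , λ s le →
      let M , z≤′ = z≤ s (ℕ.≤-trans (ℕ.m≤m⊔n N N′) le)
          M′ , w≤′ = w≤ s (ℕ.≤-trans (ℕ.m≤n⊔m N N′) le)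
      in M ℕ.⊔ M′ , λ n le′ → ℚ.≤-trans (ℚ.∣p+q∣≤∣p∣+∣q∣ (z s n) (w s n))
        (subst (ℚ.∣ z s n ∣ ℚ.+ ℚ.∣ w s n ∣ ℚ.≤_) (½*+½* ε)
          (ℚ.+-mono-≤ (z≤′ n (ℕ.≤-trans (ℕ.m≤m⊔n M M′) le′)) (w≤′ n (ℕ.≤-trans (ℕ.m≤n⊔m M M′) le′))))

  null-* : ∀ {z} {w : ℕ → ℚ} → Vanishing₁.EventuallyBounded w → Null z → Null (λ s n → w n ℚ.* z s n)
  null-* {z} {w} (B , 0<B , M₀ , w<B) h ε 0<ε = N , λ s N≤s →
    let M , z≤δ = h′ s N≤s in M₀ ℕ.⊔ M , λ n le → bound s n
      (w<B n (ℕ.≤-trans (ℕ.m≤m⊔n M₀ M) le)) (z≤δ n (ℕ.≤-trans (ℕ.m≤n⊔m M₀ M) le))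
    where
    instance
      B-pos : ℚ.Positive B
      B-pos = ℚ.positive 0<B
      B-nonNeg : ℚ.NonNegative B
      B-nonNeg = ℚ.pos⇒nonNeg B
      B-nonZero : ℚ.NonZero B
      B-nonZero = ℚ.pos⇒nonZero B
      1/B-pos : ℚ.Positive (ℚ.1/ B)
      1/B-pos = ℚ.1/pos⇒pos B
    δ : ℚ
    δ = ℚ.1/ B ℚ.* ε
    0<δ : 0ℚ ℚ.< δ
    0<δ = subst (ℚ._< δ) (ℚ.*-zeroʳ (ℚ.1/ B)) (ℚ.*-monoʳ-<-pos (ℚ.1/ B) 0<ε)
    Bδ≡ε : B ℚ.* δ ≡ ε
    Bδ≡ε = trans (sym (ℚ.*-assoc B (ℚ.1/ B) ε))
      (trans (cong (ℚ._* ε) (ℚ.*-inverseʳ B)) (ℚ.*-identityˡ ε))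
    N = proj₁ (h δ 0<δ)
    h′ = proj₂ (h δ 0<δ)
    bound : ∀ s n → ℚ.∣ w n ∣ ℚ.< B → ℚ.∣ z s n ∣ ℚ.≤ δ → ℚ.∣ w n ℚ.* z s n ∣ ℚ.≤ ε
    bound s n w< z≤ = subst (ℚ._≤ ε) (sym (ℚ.∣p*q∣≡∣p∣*∣q∣ (w n) (z s n)))
      (ℚ.≤-trans (ℚ.*-monoʳ-≤-nonNeg ℚ.∣ z s n ∣ {{ℚ.∣-∣-nonNeg (z s n)}} (ℚ.<⇒≤ w<))
        (subst (B ℚ.* ℚ.∣ z s n ∣ ℚ.≤_) Bδ≡ε (ℚ.*-monoˡ-≤-nonNeg B z≤)))

  ⟶ᵣ⇒null : ∀ {x y} → x ⟶ᵣ y → Null (λ s n → seq (x s) n ℚ.- seq y n)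
  ⟶ᵣ⇒null {x} {y} h ε 0<ε = let N , h′ = h ε 0<ε in N , λ s N≤s →
    let δ , 0<δ , M , h″ = h′ s N≤s in M , λ n M≤n → ℚ.≤-trans
      (subst (ℚ._≤ gap s n ℚ.+ δ) (ℚ.+-identityʳ (gap s n)) (ℚ.+-monoʳ-≤ (gap s n) (ℚ.<⇒≤ 0<δ))) (h″ n M≤n)
    where
    gap : ℕ → ℕ → ℚ
    gap s n = ℚ.∣ seq (x s) n ℚ.- seq y n ∣

  null⇒⟶ᵣ : ∀ x y → Null (λ s n → seq (x s) n ℚ.- seq y n) → x ⟶ᵣ y
  -- A strict inequality of reals asks for a rational gap; using only half of ε leaves the other
  -- half for it.
  null⇒⟶ᵣ x y h ε 0<ε = let N , h′ = h (½ ℚ.* ε) (0<½* 0<ε) in N , λ s N≤s →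
    let M , h″ = h′ s N≤s in ½ ℚ.* ε , 0<½* 0<ε , M , λ n M≤n →
      subst (ℚ.∣ seq (x s) n ℚ.- seq y n ∣ ℚ.+ ½ ℚ.* ε ℚ.≤_) (½*+½* ε) (ℚ.+-monoˡ-≤ (½ ℚ.* ε) (h″ n M≤n))

  ⟶ᵣ-cong : ∀ {x x′ y y′} → (∀ s → x s Real.≈ x′ s) → y Real.≈ y′ → x ⟶ᵣ y → x′ ⟶ᵣ y′
  ⟶ᵣ-cong {x} {x′} {y} {y′} ex ey h = null⇒⟶ᵣ x′ y′ (null-resp
    (λ s n → solve 4 (λ a a′ b b′ → (a′ :- a :+ (a :- b)) :+ (b :- b′) := a′ :- b′) refl
      (seq (x s) n) (seq (x′ s) n) (seq y n) (seq y′ n))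
    (null-+ (null-+ (null-vanishing (λ s → Real.difference-vanishes (Real.≈-sym (ex s)))) (⟶ᵣ⇒null {x} {y} h))
      (null-vanishing (λ _ → Real.difference-vanishes ey))))

  ⟶ᵣ-const : ∀ y → (λ _ → y) ⟶ᵣ y
  ⟶ᵣ-const y = null⇒⟶ᵣ (λ _ → y) y (null-vanishing (λ _ → Real.difference-vanishes (Real.≈-refl {y})))

  ⟶ᵣ-+ : ∀ {x y u v} → x ⟶ᵣ y → u ⟶ᵣ v → (λ s → x s Real.+ u s) ⟶ᵣ (y Real.+ v)
  ⟶ᵣ-+ {x} {y} {u} {v} h k = null⇒⟶ᵣ (λ s → x s Real.+ u s) (y Real.+ v) (null-resp
    (λ s n → solve 4 (λ a b c d → (a :- b) :+ (c :- d) := (a :+ c) :- (b :+ d)) refl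
      (seq (x s) n) (seq y n) (seq (u s) n) (seq v n))
    (null-+ (⟶ᵣ⇒null {x} {y} h) (⟶ᵣ⇒null {u} {v} k)))

  ⟶ᵣ-neg : ∀ {x y} → x ⟶ᵣ y → (λ s → Real.- x s) ⟶ᵣ (Real.- y)
  ⟶ᵣ-neg {x} {y} h = null⇒⟶ᵣ (λ s → Real.- x s) (Real.- y) (null-resp
    (λ s n → solve 2 (λ a b → :- (a :- b) := :- a :- (:- b)) refl (seq (x s) n) (seq y n))
    (null-neg (⟶ᵣ⇒null {x} {y} h)))

  -- The factor stays fixed along the sequence, as in a linear functional applied to varying
  -- coefficients.
  ⟶ᵣ-* : ∀ c {x y} → x ⟶ᵣ y → (λ s → c Real.* x s) ⟶ᵣ (c Real.* y)
  ⟶ᵣ-* c {x} {y} h = null⇒⟶ᵣ (λ s → c Real.* x s) (c Real.* y) (null-resp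
    (λ s n → solve 3 (λ c a b → c :* (a :- b) := c :* a :- c :* b) refl (seq c n) (seq (x s) n) (seq y n))
    (null-* {w = seq c} (Real.eventuallyBounded c) (⟶ᵣ⇒null {x} {y} h)))

  ⟶ᶜ-cong : ∀ {z z′ w w′} → (∀ s → z s Complex.≈ z′ s) → w Complex.≈ w′ → z ⟶ᶜ w → z′ ⟶ᶜ w′
  ⟶ᶜ-cong {z} {z′} {w} {w′} ez ew (h , k) =
    ⟶ᵣ-cong {λ s → re (z s)} {λ s → re (z′ s)} {re w} {re w′} (λ s → Complex.re-≈ (ez s)) (Complex.re-≈ ew) h ,
    ⟶ᵣ-cong {λ s → im (z s)} {λ s → im (z′ s)} {im w} {im w′} (λ s → Complex.im-≈ (ez s)) (Complex.im-≈ ew) k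

  ⟶ᶜ-const : ∀ w → (λ _ → w) ⟶ᶜ w
  ⟶ᶜ-const w = ⟶ᵣ-const (re w) , ⟶ᵣ-const (im w)

  ⟶ᶜ-+ : ∀ {z w z′ w′} → z ⟶ᶜ w → z′ ⟶ᶜ w′ → (λ s → z s Complex.+ z′ s) ⟶ᶜ (w Complex.+ w′)
  ⟶ᶜ-+ {z} {w} {z′} {w′} (h , k) (h′ , k′) =
    ⟶ᵣ-+ {λ s → re (z s)} {re w} {λ s → re (z′ s)} {re w′} h h′ ,
    ⟶ᵣ-+ {λ s → im (z s)} {im w} {λ s → im (z′ s)} {im w′} k k′

  ⟶ᶜ-* : ∀ c {z w} → z ⟶ᶜ w → (λ s → c Complex.* z s) ⟶ᶜ (c Complex.* w)
  ⟶ᶜ-* (a +i b) {z} {w} (h , k) =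
    ⟶ᵣ-+ {λ s → a Real.* x s} {a Real.* re w} {λ s → Real.- (b Real.* y s)} {Real.- (b Real.* im w)}
      (⟶ᵣ-* a {x} {re w} h) (⟶ᵣ-neg {λ s → b Real.* y s} {b Real.* im w} (⟶ᵣ-* b {y} {im w} k)) ,
    ⟶ᵣ-+ {λ s → a Real.* y s} {a Real.* im w} {λ s → b Real.* x s} {b Real.* re w}
      (⟶ᵣ-* a {y} {im w} k) (⟶ᵣ-* b {x} {re w} h)
    where
    x y : ℕ → ℝ
    x s = re (z s)
    y s = im (z s)

  -- Linear functionals are continuous on polynomials with a common finite support

  open CommutativeRing Complex.commutativeRing using () renaming (refl to ≈-refl; sym to ≈-sym; trans to ≈-trans; *-comm to ℂ*-comm; +-congʳ to ℂ+-congʳ)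

  SupportedBy : List Monomial → Poly → Set
  SupportedBy L p = ∀ μ → All (λ ν → ¬ (ν ↭ μ)) L → coeff p μ Complex.≈ Complex.0#

  without-supported : ∀ {ν L p} → SupportedBy (ν ∷ L) p → SupportedBy L (without ν p)
  without-supported {ν} {L} {p} h μ ¬L with μ ↭? ν
  ... | yes μ↭ν = coeff-without-↭ ν p μ↭ν
  ... | no  μ≁ν = ≈-trans (coeff-without-≁ ν p μ≁ν) (h μ ((λ π → μ≁ν (↭-sym π)) ∷ ¬L))

  without-⟶ : ∀ {g p} ν → g ⟶ p → (λ s → without ν (g s)) ⟶ without ν p
  without-⟶ {g} {p} ν h μ with μ ↭? ν
  ... | yes μ↭ν = ⟶ᶜ-cong {λ _ → Complex.0#} {λ s → coeff (without ν (g s)) μ} {Complex.0#} {coeff (without ν p) μ}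
    (λ s → ≈-sym (coeff-without-↭ ν (g s) μ↭ν)) (≈-sym (coeff-without-↭ ν p μ↭ν))
    (⟶ᶜ-const Complex.0#)
  ... | no  μ≁ν = ⟶ᶜ-cong {λ s → coeff (g s) μ} {λ s → coeff (without ν (g s)) μ} {coeff p μ} {coeff (without ν p) μ}
    (λ s → ≈-sym (coeff-without-≁ ν (g s) μ≁ν)) (≈-sym (coeff-without-≁ ν p μ≁ν)) (h μ)

  -- The term lists of the g s are unrelated to each other and of unbounded length. The common
  -- support reduces `pair φ` to one finite combination of coefficients, the same for all s, and
  -- each of these coefficients converges.
  pair-⟶ : ∀ {φ} → Invariant φ → ∀ L {g p} → (∀ s → SupportedBy L (g s)) → SupportedBy L p →
    g ⟶ p → (λ s → pair φ (g s)) ⟶ᶜ pair φ p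
  pair-⟶ {φ} inv [] {g} {p} hg hp h = ⟶ᶜ-cong
    {λ _ → Complex.0#} {λ s → pair φ (g s)} {Complex.0#} {pair φ p}
    (λ s → ≈-sym (pair-cong inv {g s} {0ₚ} (mk≋ λ μ → hg s μ [])))
    (≈-sym (pair-cong inv {p} {0ₚ} (mk≋ λ μ → hp μ []))) (⟶ᶜ-const Complex.0#)
  pair-⟶ {φ} inv (ν ∷ L) {g} {p} hg hp h = ⟶ᶜ-cong
    {λ s → φ ν Complex.* coeff (g s) ν Complex.+ pair φ (without ν (g s))} {λ s → pair φ (g s)}
    {φ ν Complex.* coeff p ν Complex.+ pair φ (without ν p)} {pair φ p}
    (λ s → ≈-sym (split (g s))) (≈-sym (split p))
    (⟶ᶜ-+ {λ s → φ ν Complex.* coeff (g s) ν} {φ ν Complex.* coeff p ν} {λ s → pair φ (without ν (g s))} {pair φ (without ν p)}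
      (⟶ᶜ-* (φ ν) {λ s → coeff (g s) ν} {coeff p ν} (h ν))
      (pair-⟶ inv L {λ s → without ν (g s)} {without ν p} (λ s → without-supported {ν} {L} {g s} (hg s)) (without-supported {ν} {L} {p} hp)
        (without-⟶ {g} {p} ν h)))
    where
    split : ∀ q → pair φ q Complex.≈ φ ν Complex.* coeff q ν Complex.+ pair φ (without ν q)
    split q = ≈-trans (pair-without inv ν q) (ℂ+-congʳ (ℂ*-comm (coeff q ν) (φ ν)))

-- The four equivalences

open import Defs
open Growth
open Limits
private
  module ℂR = CommutativeRing Complex.commutativeRing
open PolynomialRing Complex.commutativeRing
open Projections Complex.commutativeRing
open Interpolation Complex.commutativeRing using (Divisible)
open DepthReduction Complex.commutativeRing using (programLength; formula-nce₃)
open SkewPrograms Complex.commutativeRing using (formula⇒permanent; terms-affine; affine-1)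
private module Mult = SemiringMult ℂR.semiring

ι : ℚ → ℂ
ι q = Real.fromℚ q +i Real.0#

ι-+ : ∀ p q → ι p Complex.+ ι q Complex.≈ ι (p ℚ.+ q)
ι-+ p q = Complex.mk≈ (Real.pointwise λ _ → ≡.refl) (Real.pointwise λ _ → ≡.refl)

ι-* : ∀ p q → ι p Complex.* ι q Complex.≈ ι (p ℚ.* q)
ι-* p q = Complex.mk≈
  (Real.pointwise λ _ → ≡.trans (≡.cong (λ r → p ℚ.* q ℚ.- r) (ℚ.*-zeroˡ 0ℚ)) (ℚ.+-identityʳ (p ℚ.* q)))
  (Real.pointwise λ _ → ≡.cong₂ ℚ._+_ (ℚ.*-zeroʳ p) (ℚ.*-zeroˡ q))

fromℕ : ℕ → ℚ
fromℕ zero    = 0ℚ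
fromℕ (suc n) = 1ℚ ℚ.+ fromℕ n

ι-fromℕ : ∀ n → n Mult.× Complex.1# Complex.≈ ι (fromℕ n)
ι-fromℕ zero    = ℂR.refl
ι-fromℕ (suc n) = ℂR.trans (ℂR.+-congˡ {Complex.1#} (ι-fromℕ n)) (ι-+ 1ℚ (fromℕ n))

fromℕ-nonNeg : ∀ n → 0ℚ ℚ.≤ fromℕ n
fromℕ-nonNeg zero    = ℚ.≤-refl
fromℕ-nonNeg (suc n) = ℚ.+-mono-≤ (ℚ.nonNegative⁻¹ 1ℚ) (fromℕ-nonNeg n)

divisible : Divisible
divisible n = ι (ℚ.1/ q) , ℂR.trans (ℂR.*-congˡ {ι (ℚ.1/ q)} (ι-fromℕ (suc n)))
  (ℂR.trans (ι-* (ℚ.1/ q) q) (ℂR.reflexive (≡.cong ι (ℚ.*-inverseˡ q))))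
  where
  q = fromℕ (suc n)
  instance
    q-pos : ℚ.Positive q
    q-pos = ℚ.positive (ℚ.+-mono-<-≤ (ℚ.positive⁻¹ 1ℚ) (fromℕ-nonNeg n))
    q-nonZero : ℚ.NonZero q
    q-nonZero = ℚ.pos⇒nonZero q

-- The entry sum of nce_0, the 3 × 3 identity matrix, in the form to which that sum unfolds.
three : ℂ
three = Complex.1# Complex.+ (Complex.1# Complex.+ (Complex.1# Complex.+ Complex.0#))

three≉0 : ¬ (three Complex.≈ Complex.0#)
three≉0 e =
  let M , h = Real.difference-vanishes (Complex.re-≈ e) 1ℚ (ℚ.positive⁻¹ 1ℚ)
  in ℚ.<-irrefl ≡.refl (ℚ.≤-<-trans (ℚ.≤ᵇ⇒≤ _) (h M ℕ.≤-refl))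

coeff-nce₃-0 : ∀ m → coeff (nce₃ m 0) [] Complex.≈ three
coeff-nce₃-0 m = coeff-≈ (nce₃-esum m 0) []

nce₃-0-nonzero : ∀ m → ¬ (nce₃ m 0 ≋ 0ₚ)
nce₃-0-nonzero m z = three≉0 (ℂR.trans (ℂR.sym (coeff-nce₃-0 m)) (coeff-≈ z []))

-- The length depends on the size of the formula alone, and 0 fills the place of the number of
-- variables. The 7 comes from 100 ≤ 2^7 = 100 + 28.
programLength-bound : PowerBounded (2 ℕ.+_) (λ _ → 2≤2+) (λ s → programLength 0 (lg s))
programLength-bound = power-* _ _ {λ s → 100 ℕ.^ lg s} {λ _ → 6 ℕ.^ 4}
  (power-bounded (2 ℕ.* 7) λ s → power-lg≤ 7 s (ℕ.m≤m+n 100 28)) (power-const _ _ (6 ℕ.^ 4))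

size≤4*2^lg : ∀ s → s ℕ.≤ 4 ℕ.* 2 ℕ.^ lg s
size≤4*2^lg s = ℕ.≤-trans (n≤2^lg s) (ℕ.m≤m+n _ _)

nce₃-size-bound : PowerBounded (λ md → 2 ℕ.+ (proj₁ md ℕ.+ proj₂ md)) (λ _ → 2≤2+)
  (λ md → nce₃-size (lg (proj₁ md)) (proj₁ md) (proj₂ md))
nce₃-size-bound = 1 +′ ((3 +′ sum-bound) *′ (3 +′ (1 +′ (3 ×′ (1 +′ (1 +′ (3 ×′ (1 +′ (3 ×′ 6^lg)))))))))
  where
  x : ℕ × ℕ → ℕ
  x md = 2 ℕ.+ (proj₁ md ℕ.+ proj₂ md)
  Bound : (ℕ × ℕ → ℕ) → Set
  Bound = PowerBounded x (λ _ → 2≤2+)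
  _+′_ : ∀ c {f} → Bound f → Bound (λ md → c ℕ.+ f md)
  c +′ p = power-+ x (λ _ → 2≤2+) (power-const x (λ _ → 2≤2+) c) p
  _×′_ : ∀ c {f} → Bound f → Bound (λ md → c ℕ.* f md)
  c ×′ p = power-* x (λ _ → 2≤2+) (power-const x (λ _ → 2≤2+) c) p
  _*′_ : ∀ {f g} → Bound f → Bound g → Bound (λ md → f md ℕ.* g md)
  p *′ q = power-* x (λ _ → 2≤2+) p q
  sum-bound : Bound (λ md → proj₁ md ℕ.+ proj₂ md)
  sum-bound = power-bounded 1 λ { (m , d) → ℕ.≤-trans (ℕ.m≤n+m (m ℕ.+ d) 2) (ℕ.≤-reflexive (≡.sym (ℕ.*-identityʳ _))) }
  6^lg : Bound (λ md → 6 ℕ.^ lg (proj₁ md))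
  -- The 3 comes from 6 ≤ 2^3 = 6 + 2.
  6^lg = power-bounded (2 ℕ.* 3) λ { (m , d) → ℕ.≤-trans (power-lg≤ 3 m (ℕ.m≤m+n 6 2))
    (ℕ.^-monoˡ-≤ (2 ℕ.* 3) (ℕ.+-monoʳ-≤ 2 (ℕ.m≤m+n m d))) }

word-graded : ∀ n d → Terms (Word d (n ℕ.* n)) (graded per n d)
word-graded n d = All.map (λ { (|μ|≡d , (_ , inside)) → |μ|≡d , inside })
  (All.zip (All.all-filter (λ t → length (proj₂ t) ℕ.≟ d) (per n) , word-homogeneousPart d (word-permanent n)))

graded-top : ∀ n → graded per n n ≡ per n
graded-top n = filter-all (λ t → length (proj₂ t) ℕ.≟ n) (All.map proj₁ (word-permanent n))

word? : ∀ d k μ → Dec (Word d k μ)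
word? d k μ = (length μ ℕ.≟ d) ×-dec All.all? (ℕ._<? k) μ

n≤[2+n]^1 : ∀ n → n ℕ.≤ (2 ℕ.+ n) ℕ.^ 1
n≤[2+n]^1 n = ℕ.≤-trans (ℕ.m≤n+m n 2) (ℕ.≤-reflexive (≡.sym (ℕ.*-identityʳ (2 ℕ.+ n))))

per∈VNP : VNP per
per∈VNP = (((λ n → n) , id-bounded , degree) , ((λ n → n ℕ.* n) , square-bounded , variables)) , ((λ n → n) , id-bounded , complexity)
  where
  id-bounded : PolynomiallyBounded (λ n → n)
  id-bounded = poly-intro 1 n≤[2+n]^1
  square-bounded : PolynomiallyBounded (λ n → n ℕ.* n)
  square-bounded = poly-intro 2 λ n → ℕ.*-mono-≤ (ℕ.m≤n+m n 2) (n≤[2+n]^1 n)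
  degree : ∀ n → Degree≤ (per n) n
  degree n μ n<|μ| = word-coeff (per n) (word-permanent n) (λ w → ℕ.<⇒≢ n<|μ| (≡.sym (proj₁ w)))
  variables : ∀ n → Variables≤ (per n) (n ℕ.* n)
  variables n = upTo (n ℕ.* n) , ℕ.≤-reflexive (length-upTo (n ℕ.* n)) , λ μ i i∈μ i∉ →
    word-coeff (per n) (word-permanent n) (λ w → i∉ (∈-upTo⁺ (All.lookup (proj₂ w) i∈μ)))
  complexity : ∀ n → PermanentalComplexity≤ (per n) n
  complexity n = n , ℕ.≤-refl , (λ i j → var (toℕ (combine i j))) ,
    (λ i j → terms-affine (var (toℕ (combine i j))) (ℕ.≤-refl ∷ [])) , ≋-refl

-- Exact and border complexity

record Model (Complexity≤ : Poly → ℕ → Set) (Reduces : Poly → ℕ → Poly → Set) : Set where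
  field
    from-formula : ∀ {p k} → FormulaSize≤ p k → Complexity≤ p k
    lower        : ∀ {n s m h} d → Complexity≤ (per n) s → s ℕ.≤ 4 ℕ.* 2 ℕ.^ h → programLength 0 h ℕ.≤ m →
                   Reduces (graded per n d) d (nce₃ m d)
    -- Positive degree only: in degree 0 a reduction says no more than that `nce₃` is nonzero and
    -- yields no formula.
    upper        : ∀ {n m h} (M : Matrix (suc n)) → (∀ i j → Affine (M i j)) → m ℕ.≤ 2 ℕ.^ h →
                   Reduces (graded per (suc n) (suc n)) (suc n) (nce₃ m (suc n)) →
                   ∀ {p} → p ≋ permanent M → Complexity≤ p (nce₃-size h m (suc n))

graded-coeff : ∀ {n d μ} → Dec (Word d (n ℕ.* n) μ) → ∀ {z} →
  (Word d (n ℕ.* n) μ → z ℂR.≈ coeff (per n) μ) → (¬ Word d (n ℕ.* n) μ → z ℂR.≈ Complex.0#) →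
  coeff (graded per n d) μ ℂR.≈ z
graded-coeff {n} (yes w) h _ = ℂR.trans (coeff-homogeneousPart (per n) (proj₁ w)) (ℂR.sym (h w))
graded-coeff {n} {d} (no ¬w) _ h = ℂR.trans (word-coeff (graded per n d) (word-graded n d) ¬w) (ℂR.sym (h ¬w))

lower-exact : ∀ {n s m h} d → FormulaSize≤ (per n) s → s ℕ.≤ 4 ℕ.* 2 ℕ.^ h → programLength 0 h ℕ.≤ m →
  graded per n d ≤homlin[ d ] nce₃ m d
lower-exact {m = m} zero    _  _  _  = nce₃-0-nonzero m
lower-exact {n} {m = m} {h} (suc d) fs s≤ ≤m =
  let A , inside , outside = formula-nce₃ (n ℕ.* n) {h} {m} d fs s≤ ≤m
  in n ℕ.* n , m ℕ.* 9 , word-∈ (graded per n (suc d)) (word-graded n (suc d)) , word-∈ (nce₃ m (suc d)) (word-nce₃ m (suc d)) ,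
     A , mk≋ λ μ → graded-coeff {n} {suc d} {μ} (word? (suc d) (n ℕ.* n) μ) inside outside

-- Only the last step of the exact argument depends on the sequence index, the
-- number of variables and of matrices being the same for all approximants.
lower-border : ∀ {n s m h} d → BorderFormulaSize≤ (per n) s → s ℕ.≤ 4 ℕ.* 2 ℕ.^ h → programLength 0 h ℕ.≤ m →
  graded per n d ⊴homlin[ d ] nce₃ m d
lower-border {m = m} zero    _  _  _  = nce₃-0-nonzero m
lower-border {n} {m = m} {h} (suc d) (g , fs , g⟶per) s≤ ≤m =
  n ℕ.* n , m ℕ.* 9 , word-∈ (graded per n (suc d)) (word-graded n (suc d)) , word-∈ (nce₃ m (suc d)) (word-nce₃ m (suc d)) ,
  (λ j → proj₁ (projections j)) , λ μ → converges μ (word? (suc d) (n ℕ.* n) μ)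
  where
  projections : ∀ j → ∃ λ (A : LinearMap (n ℕ.* n) (m ℕ.* 9)) →
    (∀ {μ} → Word (suc d) (n ℕ.* n) μ → coeff (nce₃ m (suc d) ∘ₗ A) μ ℂR.≈ coeff (g j) μ) ×
    (∀ {μ} → ¬ Word (suc d) (n ℕ.* n) μ → coeff (nce₃ m (suc d) ∘ₗ A) μ ℂR.≈ Complex.0#)
  projections j = formula-nce₃ (n ℕ.* n) {h} {m} d (fs j) s≤ ≤m
  approximant : ℕ → Poly
  approximant j = nce₃ m (suc d) ∘ₗ proj₁ (projections j)
  converges : ∀ μ → Dec (Word (suc d) (n ℕ.* n) μ) →
    (λ j → coeff (approximant j) μ) ⟶ᶜ coeff (graded per n (suc d)) μ
  converges μ (yes w) = ⟶ᶜ-cong {λ j → coeff (g j) μ} {λ j → coeff (approximant j) μ} {coeff (per n) μ} {coeff (graded per n (suc d)) μ}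
    (λ j → ℂR.sym (proj₁ (proj₂ (projections j)) w))
    (ℂR.sym (coeff-homogeneousPart (per n) (proj₁ w))) (g⟶per μ)
  converges μ (no ¬w) = ⟶ᶜ-cong {λ _ → Complex.0#} {λ j → coeff (approximant j) μ} {Complex.0#} {coeff (graded per n (suc d)) μ}
    (λ j → ℂR.sym (proj₂ (proj₂ (projections j)) ¬w))
    (ℂR.sym (word-coeff (graded per n (suc d)) (word-graded n (suc d)) ¬w)) (⟶ᶜ-const Complex.0#)

substitute-graded : ∀ {n} (M : Matrix n) → substitute (projection M) (graded per n n) ≋ permanent M
substitute-graded {n} M = ≋-trans (≋-reflexive (≡.cong (substitute (projection M)) (graded-top n))) (permanent-projection M)

-- Substituting the entries of M for the variables on both sides of the reduction gives
-- `permanent M` on one side and nce_d of affine matrices on the other.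
upper-exact : ∀ {n m h} (M : Matrix (suc n)) → (∀ i j → Affine (M i j)) → m ℕ.≤ 2 ℕ.^ h →
  graded per (suc n) (suc n) ≤homlin[ suc n ] nce₃ m (suc n) →
  ∀ {p} → p ≋ permanent M → FormulaSize≤ p (nce₃-size h m (suc n))
upper-exact {n} {m} {h} M affine m≤ (k , l , _ , _ , A , per≋) {p} p≋ =
  let F , size≤ , value≋ = nce₃-formula divisible (affine-projection M affine) A {h} {m} (suc n) m≤
  in F , size≤ , ≋-trans value≋ (≋-trans (substitute-cong (projection M) (≋-sym per≋))
       (≋-trans (substitute-graded M) (≋-sym p≋)))

words : ℕ → ℕ → List Monomial
words zero    k = [] ∷ []
words (suc d) k = cartesianProductWith _∷_ (upTo k) (words d k)

∈-words : ∀ {d k μ} → Word d k μ → μ ∈ words d k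
∈-words {zero}  {μ = []}    _                         = here ≡.refl
∈-words {suc d} {μ = i ∷ μ} (|μ|≡d , i<k ∷ inside) =
  ∈-cartesianProductWith⁺ _∷_ (∈-upTo⁺ i<k) (∈-words (ℕ.suc-injective |μ|≡d , inside))

words-support : ∀ {d k} p → Terms (Word d k) p → SupportedBy (words d k) p
words-support {d} {k} p h μ none = word-coeff p h (λ w → All.lookup none (∈-words w) ↭-refl)

-- A coefficient after the substitution is the functional `pair (φ μ)` of the polynomial before it.
-- The approximants are homogeneous of degree `suc n` in the same k variables, so together with
-- `per` they have a common finite support and the functional is continuous along them.
upper-border : ∀ {n m h} (M : Matrix (suc n)) → (∀ i j → Affine (M i j)) → m ℕ.≤ 2 ℕ.^ h →
  graded per (suc n) (suc n) ⊴homlin[ suc n ] nce₃ m (suc n) →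
  ∀ {p} → p ≋ permanent M → BorderFormulaSize≤ p (nce₃-size h m (suc n))
upper-border {n} {m} {h} M affine m≤ (k , l , _ , _ , A , g⟶per) {p} p≋ =
  (λ j → substitute s (g j)) ,
  (λ j → nce₃-formula divisible (affine-projection M affine) (A j) {h} {m} (suc n) m≤) ,
  λ μ → ⟶ᶜ-cong {λ j → pair (φ μ) (g j)} {λ j → coeff (substitute s (g j)) μ} {pair (φ μ) q} {coeff p μ}
    (λ j → ℂR.sym (coeff-substitute s (g j) μ))
    (ℂR.trans (ℂR.sym (coeff-substitute s q μ)) (ℂR.trans (coeff-≈ (substitute-graded M) μ) (ℂR.sym (coeff-≈ p≋ μ))))
    (pair-⟶ {φ μ} (φ-invariant μ) L {g} {q} (λ j μ none → supported-g j μ (All.++⁻ˡ L₁ none))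
      (λ μ none → supported-q μ (All.++⁻ʳ L₁ none)) g⟶per)
  where
  s = projection M
  q = graded per (suc n) (suc n)
  g : ℕ → Poly
  g j = nce₃ m (suc n) ∘ₗ A j
  L₁ = words (suc n) k
  L₂ = words (suc n) (suc n ℕ.* suc n)
  L = L₁ ++ L₂
  supported-g : ∀ j → SupportedBy L₁ (g j)
  supported-g j = words-support (g j) (word-∘ₗ (A j) {nce₃ m (suc n)} (word-nce₃ m (suc n)))
  supported-q : SupportedBy L₂ q
  supported-q = words-support q (word-graded (suc n) (suc n))
  φ : Monomial → Monomial → ℂ
  φ μ ν = coeff (monomial s ν) μ
  φ-invariant : ∀ μ → Invariant (φ μ)
  φ-invariant μ {ν} {ν′} π = ℂR.trans (coeff-pair (monomial s ν) μ)
    (ℂR.trans (monomial-invariant (δ-invariant μ) s π) (ℂR.sym (coeff-pair (monomial s ν′) μ)))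

exact : Model FormulaSize≤ _≤homlin[_]_
exact = record
  { from-formula = λ h → h
  ; lower        = λ {n} {s} {m} {h} → lower-exact {n} {s} {m} {h}
  ; upper        = λ {n} {m} {h} → upper-exact {n} {m} {h}
  }

border : Model BorderFormulaSize≤ _⊴homlin[_]_
border = record
  { from-formula = λ {p} h → (λ _ → p) , (λ _ → h) , λ μ → ⟶ᶜ-const (coeff p μ)
  ; lower        = λ {n} {s} {m} {h} → lower-border {n} {s} {m} {h}
  ; upper        = λ {n} {m} {h} → upper-border {n} {m} {h}
  }

module _ {Bounded} (growth : Boundedness Bounded) {Complexity≤ Reduces} (model : Model Complexity≤ Reduces) where

  open Boundedness growth
  open Model model
  open PowerBounded using (exponent; bounds)

  contained⇒reduces : VNP ⊆ Class Bounded Complexity≤ → Reduction Bounded Reduces (graded per) nce₃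
  contained⇒reduces VNP⊆ = let _ , s , s-bounded , complexity = VNP⊆ per∈VNP in
    -- One matrix for each instruction that the program of a formula of size `s n` may have.
    (λ n → programLength 0 (lg (s n))) ,
    power-closed (exponent programLength-bound) s-bounded (λ n → bounds programLength-bound (s n)) ,
    λ n d → lower {n} {s n} {programLength 0 (lg (s n))} {lg (s n)} d (complexity n) (size≤4*2^lg (s n)) ℕ.≤-refl

  reduces⇒contained : Reduction Bounded Reduces (graded per) nce₃ → VNP ⊆ Class Bounded Complexity≤
  reduces⇒contained (m , m-bounded , reduces) {f} (f-family , k , (t , k≤) , complexity) =
    f-family , size′ , ∘-closed {m} {N} {size′} (exponent nce₃-size-bound) m-bounded (t , λ n → ℕ.≤-trans (N≤k n) (k≤ n)) size′≤ , bound
    where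
    -- The actual size of the matrix and not its bound `k n`: the reduction is applied to the
    -- permanent of exactly this size.
    N : ℕ → ℕ
    N n = proj₁ (complexity n)
    N≤k : ∀ n → N n ℕ.≤ k n
    N≤k n = proj₁ (proj₂ (complexity n))
    size′ : ℕ → ℕ
    size′ n = nce₃-size (lg (m (N n))) (m (N n)) (N n)
    size′≤ : ∀ n → size′ n ℕ.≤ (2 ℕ.+ (m (N n) ℕ.+ N n)) ℕ.^ exponent nce₃-size-bound
    size′≤ n = bounds nce₃-size-bound (m (N n) , N n)
    bound : ∀ n → Complexity≤ (f n) (size′ n)
    bound n = of-permanent (N n) (proj₁ (proj₂ (proj₂ (complexity n))))
      (proj₁ (proj₂ (proj₂ (proj₂ (complexity n))))) (proj₂ (proj₂ (proj₂ (proj₂ (complexity n)))))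
      where
      of-permanent : ∀ N (M : Matrix N) → (∀ i j → Affine (M i j)) → f n ≋ permanent M →
        Complexity≤ (f n) (nce₃-size (lg (m N)) (m N) N)
      -- The permanent of the empty matrix is 1, a formula with a single leaf.
      of-permanent zero    M _      f≋ = from-formula (leaf 1ₚ affine-1 , ℕ.s≤s ℕ.z≤n , ≋-sym f≋)
      of-permanent (suc N) M affine f≋ = upper {N} {m (suc N)} {lg (m (suc N))} M affine (n≤2^lg (m (suc N))) (reduces (suc N) (suc N)) f≋

  contained⇔reduces : VNP ⊆ Class Bounded Complexity≤ ⇔ Reduction Bounded Reduces (graded per) nce₃
  contained⇔reduces = mk⇔ contained⇒reduces reduces⇒contained

VF⊆VNP : VF ⊆ VNP
VF⊆VNP (f-family , m , bounded , size≤) = f-family , m , bounded , λ n → formula⇒permanent (size≤ n)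

theorem3p2 : ((VNP ≐ VF)         ⇔ (graded per ≤p-homlin  nce₃))
    × ((VNP ⊆ border-VF)  ⇔ (graded per ⊴p-homlin  nce₃))
    × ((VNP ⊆ VQP)        ⇔ (graded per ≤qp-homlin nce₃))
    × ((VNP ⊆ border-VQP) ⇔ (graded per ⊴qp-homlin nce₃))
theorem3p2 =
  mk⇔ (λ h → Equivalence.to VF⇔ (λ {f} → proj₁ h {f})) (λ r → (λ {f} → Equivalence.from VF⇔ r {f}) , (λ {f} → VF⊆VNP {f})) ,
  contained⇔reduces poly-growth border ,
  contained⇔reduces quasi-growth exact ,
  contained⇔reduces quasi-growth border
  where
  VF⇔ : VNP ⊆ VF ⇔ graded per ≤p-homlin nce₃
  VF⇔ = contained⇔reduces poly-growth exact
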